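{- Let $F$ be a graph with a color-critical edge and let $k+1=\chi(F)$. Let $H$ be a linear forest. Then $H$ is $F$-Turán-good, i.e., there is $n_0$ such that for all $n\ge n_0$, $$\mathrm{ex}(n,H,F)=\mathcal{N}(H,T(n,k)).$$ In particular, for every $k\ge 2$ and every $\ell\ge 1$, the path $P_\ell$ is $K_{k+1}$-Turán-good: for all sufficiently large $n$, among all $n$-vertex $K_{k+1}$-free graphs, the Turán graph $T(n,k)$ contains the maximum number of copies of $P_\ell$.
   Context: For graphs $H$ and $G$, $\mathcal{N}(H,G)$ denotes the number of (not necessarily induced) subgraphs of $G$ isomorphic to $H$ ("copies" of $H$ in $G$). For graphs $H,F$, $\mathrm{ex}(n,H,F)$ is the maximum of $\mathcal{N}(H,G)$ over all $n$-vertex graphs $G$ containing no subgraph isomorphic to $F$. The Turán graph $T(n,k)$ is the complete $k$-partite graph on $n$ vertices with each part of size $\lfloor n/k\rfloor$ or $\lceil n/k\rceil$. An edge of $F$ is color-critical if deleting it decreases the chromatic number $\chi(F)$. For a graph $F$ with $\chi(F)=k+1$, a graph $H$ is called $F$-Turán-good if $\mathrm{ex}(n,H,F)=\mathcal{N}(H,T(n,k))$ for all sufficiently large $n$. A linear forest is a graph each of whose connected components is a path; $P_\ell$ denotes the path on $\ell$ vertices. -}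

module Defs where

open import Data.Bool using (true; false)
open import Data.Empty using (⊥)
open import Data.Fin using (Fin; toℕ; finToFun; funToFin)
open import Data.Fin.Properties using (_≟_; all?; any?; finToFun-funToFin; toℕ≤pred[n])
open import Data.Fin.Subset using (Subset; _∈_)
open import Data.Fin.Subset.Properties using (_∈?_)
open import Data.List using (List; []; _∷_; _++_; length; filter; map; cartesianProduct; cartesianProductWith; allFin; tabulate; upTo; applyUpTo)
open import Data.List.Properties using (upTo-∷ʳ; filter-++; filter-accept; filter-reject; length-++; map-tabulate)
open import Data.Nat using (ℕ; zero; suc; _≤_; _<_; _≥_; _%_; _/_)
open import Data.Nat.Divisibility using (divides-refl)
open import Data.Nat.DivMod using ([m+kn]%n≡m%n; m<n⇒m%n≡m; m≡m%n+[m/n]*n; m%n<n; m<n⇒m/n≡0; m*n/n≡m; +-distrib-/-∣ʳ)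
import Data.Nat as ℕ
import Data.Nat.Properties as ℕ
open import Data.Product using (Σ-syntax; ∃-syntax; _×_; _,_)
open import Data.Sum using (_⊎_; inj₁; inj₂; swap; [_,_])
open import Data.Vec using (Vec; []; _∷_; lookup)
open import Function using (_∘_; id; _⇔_; mk⇔)
open import Function.Bundles using (module Equivalence)
open import Function.Definitions using (Injective)
open import Level using (0ℓ)
open import Relation.Binary using (Rel; Decidable; Symmetric)
open import Relation.Binary.Construct.Closure.ReflexiveTransitive using (Star)
open import Relation.Binary.PropositionalEquality using (_≡_; _≢_; refl; sym; trans; cong; cong₂; subst; subst₂; module ≡-Reasoning)
open import Relation.Nullary using (¬_; Dec; yes; no; does)
open import Relation.Nullary.Decidable using (map′; ¬?; _×-dec_; _⊎-dec_; _→-dec_)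
import Relation.Unary as U

record Graph (n : ℕ) : Set₁ where
  field
    Adj    : Rel (Fin n) 0ℓ
    adj?   : Decidable Adj
    symm   : Symmetric Adj
    irrefl : ∀ {v} → ¬ Adj v v

open Graph public

-- An isomorphism from H onto the graph with vertex set V and edge relation E.
record Iso {m n : ℕ} (H : Graph m) (V : Fin n → Set) (E : Rel (Fin n) 0ℓ) : Set where
  constructor mkIso
  field
    φ         : Fin m → Fin n
    injective : Injective _≡_ _≡_ φ
    onto      : ∀ v → V v ⇔ (∃[ i ] φ i ≡ v)
    edges     : ∀ i j → Adj H i j ⇔ E (φ i) (φ j)

-- Vertex set together with the rows of an adjacency matrix.
SubgraphData : ℕ → Set
SubgraphData n = Subset n × Vec (Subset n) n

module _ {n : ℕ} where

  InVertices : SubgraphData n → Fin n → Set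
  InVertices (V , _) v = v ∈ V

  InEdges : SubgraphData n → Rel (Fin n) 0ℓ
  InEdges (_ , E) u v = v ∈ lookup E u

  IsSubgraph : Graph n → SubgraphData n → Set
  IsSubgraph G S = ∀ u v → InEdges S u v →
    InEdges S v u × Adj G u v × InVertices S u × InVertices S v

  IsCopy : ∀ {m} → Graph m → Graph n → SubgraphData n → Set
  IsCopy H G S = IsSubgraph G S × Iso H (InVertices S) (InEdges S)

private
  _⇔-dec_ : {A B : Set} → Dec A → Dec B → Dec (A ⇔ B)
  a? ⇔-dec b? = map′ (λ (f , g) → mk⇔ f g)
    (λ e → Equivalence.to e , Equivalence.from e) ((a? →-dec b?) ×-dec (b? →-dec a?))

module _ {m n : ℕ} (H : Graph m) {V : Fin n → Set} {E : Rel (Fin n) 0ℓ} where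

  private
    Good : (Fin m → Fin n) → Set
    Good f = (∀ i j → f i ≡ f j → i ≡ j)
           × (∀ v → V v ⇔ (∃[ i ] f i ≡ v))
           × (∀ i j → Adj H i j ⇔ E (f i) (f j))

    good-resp : ∀ {f g} → (∀ i → f i ≡ g i) → Good f → Good g
    good-resp f≗g (inj , onto , edges) =
      (λ i j e → inj i j (trans (f≗g i) (trans e (sym (f≗g j))))) ,
      (λ v → mk⇔
        (λ x → let (i , e) = Equivalence.to (onto v) x in i , trans (sym (f≗g i)) e)
        (λ (i , e) → Equivalence.from (onto v) (i , trans (f≗g i) e))) ,
      (λ i j → subst₂ (λ a b → Adj H i j ⇔ E a b) (f≗g i) (f≗g j) (edges i j))

  iso? : U.Decidable V → Decidable E → Dec (Iso H V E)
  iso? V? E? = map′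
    (λ (k , inj , onto , edges) → mkIso (finToFun k) (λ {i} {j} → inj i j) onto edges)
    (λ (mkIso f inj onto edges) → funToFin f ,
      good-resp (λ i → sym (finToFun-funToFin f i)) ((λ i j → inj) , onto , edges))
    (any? λ k → good? (finToFun k))
    where
    good? : ∀ f → Dec (Good f)
    good? f =
      all? (λ i → all? λ j → (f i ≟ f j) →-dec (i ≟ j)) ×-dec
      all? (λ v → V? v ⇔-dec any? λ i → f i ≟ v) ×-dec
      all? (λ i → all? λ j → adj? H i j ⇔-dec E? (f i) (f j))

isCopy? : ∀ {m n} (H : Graph m) (G : Graph n) → U.Decidable (IsCopy H G)
isCopy? H G (V , E) =
  all? (λ u → all? λ v → (v ∈? lookup E u) →-dec
    ((u ∈? lookup E v) ×-dec adj? G u v ×-dec (u ∈? V) ×-dec (v ∈? V)))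
  ×-dec iso? H (_∈? V) (λ u v → v ∈? lookup E u)

vectors : {A : Set} → List A → ∀ n → List (Vec A n)
vectors xs zero    = [] ∷ []
vectors xs (suc n) = cartesianProductWith _∷_ xs (vectors xs n)

-- Every element of SubgraphData n occurs in this list exactly once.
allSubgraphData : ∀ n → List (SubgraphData n)
allSubgraphData n = cartesianProduct subsets (vectors subsets n)
  where
  subsets : List (Subset n)
  subsets = vectors (true ∷ false ∷ []) n

𝓝 : ∀ {m n} → Graph m → Graph n → ℕ
𝓝 H G = length (filter (isCopy? H G) (allSubgraphData _))

_IsFree_ : ∀ {n m} → Graph n → Graph m → Set
G IsFree F = ¬ (∃[ S ] IsCopy F G S)

-- ex(n,H,F) = c
ex[_,_,_]≡_ : ∀ {h f} → ℕ → Graph h → Graph f → ℕ → Set₁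
ex[ n , H , F ]≡ c =
  (∃[ G ] (_IsFree_ {n} G F × 𝓝 H G ≡ c)) ×
  (∀ (G : Graph n) → G IsFree F → 𝓝 H G ≤ c)

Colorable : ∀ {n} → Graph n → ℕ → Set
Colorable {n} G c = Σ[ col ∈ (Fin n → Fin c) ] (∀ u v → Adj G u v → col u ≢ col v)

-- χ(G) = c
χ[_]≡_ : ∀ {n} → Graph n → ℕ → Set
χ[ G ]≡ c = Colorable G c × (∀ d → Colorable G d → c ≤ d)

deleteEdge : ∀ {n} → Graph n → Fin n → Fin n → Graph n
deleteEdge G u v = record
  { Adj    = λ x y → Adj G x y × ¬ ((x ≡ u × y ≡ v) ⊎ (x ≡ v × y ≡ u))
  ; adj?   = λ x y → adj? G x y ×-dec
               ¬? (((x ≟ u) ×-dec (y ≟ v)) ⊎-dec ((x ≟ v) ×-dec (y ≟ u)))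
  ; symm   = λ (xy , ne) → symm G xy ,
               λ { (inj₁ (p , q)) → ne (inj₂ (q , p)) ; (inj₂ (p , q)) → ne (inj₁ (q , p)) }
  ; irrefl = λ (xx , _) → irrefl G xx
  }

ColorCritical : ∀ {n} → Graph n → Fin n → Fin n → Set
ColorCritical G u v = Adj G u v ×
  (∃[ c ] ∃[ d ] (χ[ G ]≡ c × χ[ deleteEdge G u v ]≡ d × d < c))

HasColorCriticalEdge : ∀ {n} → Graph n → Set
HasColorCriticalEdge G = ∃[ u ] ∃[ v ] ColorCritical G u v

complete : ∀ n → Graph n
complete n = record
  { Adj    = _≢_
  ; adj?   = λ u v → ¬? (u ≟ v)
  ; symm   = λ u≢v v≡u → u≢v (sym v≡u)
  ; irrefl = λ v≢v → v≢v refl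
  }

edgeless : ∀ n → Graph n
edgeless n = record
  { Adj    = λ _ _ → ⊥
  ; adj?   = λ _ _ → no λ ()
  ; symm   = λ ()
  ; irrefl = λ ()
  }

path : ∀ ℓ → Graph ℓ
path ℓ = record
  { Adj    = λ u v → toℕ v ≡ suc (toℕ u) ⊎ toℕ u ≡ suc (toℕ v)
  ; adj?   = λ u v → (toℕ v ℕ.≟ suc (toℕ u)) ⊎-dec (toℕ u ℕ.≟ suc (toℕ v))
  ; symm   = swap
  ; irrefl = [ (λ e → ℕ.1+n≢n (sym e)) , (λ e → ℕ.1+n≢n (sym e)) ]
  }

-- The parts are the residue classes modulo the number of parts; turán-balanced
-- below shows that they have the required sizes. The value for zero parts is a
-- convention only: χ(F) = k + 1 and a color-critical edge force k ≥ 1.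
turán : (n k : ℕ) → Graph n
turán n zero    = edgeless n
turán n (suc k) = record
  { Adj    = λ u v → toℕ u % suc k ≢ toℕ v % suc k
  ; adj?   = λ u v → ¬? (toℕ u % suc k ℕ.≟ toℕ v % suc k)
  ; symm   = λ ne e → ne (sym e)
  ; irrefl = λ ne → ne refl
  }

-- The connected component of v is the set of vertices reachable from v.
LinearForest : ∀ {n} → Graph n → Set
LinearForest H = ∀ v → ∃[ ℓ ] Iso (path ℓ) (Star (Adj H) v) (Adj H)

-- H is F-Turán-good, where χ(F) = k + 1.
TuránGood : ∀ {f h} → ℕ → Graph f → Graph h → Set₁
TuránGood k F H = χ[ F ]≡ suc k ×
  (∃[ n₀ ] (∀ n → n ≥ n₀ → ex[ n , H , F ]≡ 𝓝 H (turán n k)))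

partSize : (n k : ℕ) → Fin (suc k) → ℕ
partSize n k r = length (filter (λ v → toℕ v % suc k ℕ.≟ toℕ r) (allFin n))

private
  module Balanced (k : ℕ) (r : ℕ) (r≤k : r ≤ k) where

    K : ℕ
    K = suc k

    P? : U.Decidable (λ i → i % K ≡ r)
    P? i = i % K ℕ.≟ r

    cnt : ℕ → ℕ
    cnt n = length (filter P? (upTo n))

    cnt-suc : ∀ n → cnt (suc n) ≡ length (filter P? (n ∷ [])) ℕ.+ cnt n
    cnt-suc n = begin
      length (filter P? (upTo (suc n)))                  ≡⟨ cong (length ∘ filter P?) (upTo-∷ʳ n) ⟨
      length (filter P? (upTo n ++ n ∷ []))              ≡⟨ cong length (filter-++ P? (upTo n) (n ∷ [])) ⟩
      length (filter P? (upTo n) ++ filter P? (n ∷ []))  ≡⟨ length-++ (filter P? (upTo n)) ⟩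
      cnt n ℕ.+ length (filter P? (n ∷ []))              ≡⟨ ℕ.+-comm (cnt n) _ ⟩
      length (filter P? (n ∷ [])) ℕ.+ cnt n              ∎
      where open ≡-Reasoning

    cnt-suc-yes : ∀ n → n % K ≡ r → cnt (suc n) ≡ suc (cnt n)
    cnt-suc-yes n p = trans (cnt-suc n)
      (cong (λ l → length l ℕ.+ cnt n) (filter-accept P? {x = n} {xs = []} p))

    cnt-suc-no : ∀ n → n % K ≢ r → cnt (suc n) ≡ cnt n
    cnt-suc-no n p = trans (cnt-suc n)
      (cong (λ l → length l ℕ.+ cnt n) (filter-reject P? {x = n} {xs = []} p))

    mod : ∀ t q → t < K → (t ℕ.+ q ℕ.* K) % K ≡ t
    mod t q t<K = trans ([m+kn]%n≡m%n t q K) (m<n⇒m%n≡m t<K)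

    below : ∀ q t → t ≤ r → cnt (t ℕ.+ q ℕ.* K) ≡ cnt (q ℕ.* K)
    below q zero    _   = refl
    below q (suc t) t<r = trans
      (cnt-suc-no _ (λ e → ℕ.<⇒≢ t<r (trans (sym (mod t q (ℕ.<-trans t<r (ℕ.s≤s r≤k)))) e)))
      (below q t (ℕ.<⇒≤ t<r))

    above : ∀ q t → r < t → t ≤ K → cnt (t ℕ.+ q ℕ.* K) ≡ suc (cnt (q ℕ.* K))
    above q (suc t) (ℕ.s≤s r≤t) t<K with r ℕ.≟ t
    ... | yes refl = trans (cnt-suc-yes _ (mod t q t<K)) (cong suc (below q t ℕ.≤-refl))
    ... | no r≢t   = trans (cnt-suc-no _ (λ e → r≢t (trans (sym e) (mod t q t<K))))
                           (above q t (ℕ.≤∧≢⇒< r≤t r≢t) (ℕ.<⇒≤ t<K))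

    multiples : ∀ q → cnt (q ℕ.* K) ≡ q
    multiples zero    = refl
    multiples (suc q) = trans (above q K (ℕ.s≤s r≤k) ℕ.≤-refl) (cong suc (multiples q))

    ceil : ∀ t q → 0 < t → t < K → (t ℕ.+ q ℕ.* K ℕ.+ k) / K ≡ suc q
    ceil (suc t) q _ t<K = begin
      (suc t ℕ.+ q ℕ.* K ℕ.+ k) / K    ≡⟨ cong (_/ K) rearrange ⟩
      (t ℕ.+ suc q ℕ.* K) / K          ≡⟨ +-distrib-/-∣ʳ t (divides-refl (suc q)) ⟩
      t / K ℕ.+ suc q ℕ.* K / K        ≡⟨ cong₂ ℕ._+_ (m<n⇒m/n≡0 (ℕ.<⇒≤ t<K)) (m*n/n≡m (suc q) K) ⟩
      suc q                            ∎
      where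
      open ≡-Reasoning
      rearrange : suc t ℕ.+ q ℕ.* K ℕ.+ k ≡ t ℕ.+ suc q ℕ.* K
      rearrange = begin
        suc (t ℕ.+ q ℕ.* K ℕ.+ k)    ≡⟨ ℕ.+-suc (t ℕ.+ q ℕ.* K) k ⟨
        t ℕ.+ q ℕ.* K ℕ.+ K          ≡⟨ ℕ.+-assoc t (q ℕ.* K) K ⟩
        t ℕ.+ (q ℕ.* K ℕ.+ K)        ≡⟨ cong (t ℕ.+_) (ℕ.+-comm (q ℕ.* K) K) ⟩
        t ℕ.+ (K ℕ.+ q ℕ.* K)        ∎

    balanced : ∀ n → cnt n ≡ n / K ⊎ cnt n ≡ (n ℕ.+ k) / K
    balanced n with n % K ℕ.≤? r
    ... | yes t≤r = inj₁ (trans (cong cnt (m≡m%n+[m/n]*n n K))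
                    (trans (below (n / K) (n % K) t≤r) (multiples (n / K))))
    ... | no t≰r  = inj₂ (trans (cong cnt (m≡m%n+[m/n]*n n K))
                    (trans (above (n / K) (n % K) r<t (ℕ.<⇒≤ (m%n<n n K)))
                    (trans (cong suc (multiples (n / K)))
                    (trans (sym (ceil (n % K) (n / K) (ℕ.≤-<-trans ℕ.z≤n r<t) (m%n<n n K)))
                           (cong (λ x → (x ℕ.+ k) / K) (sym (m≡m%n+[m/n]*n n K)))))))
      where r<t = ℕ.≰⇒> t≰r

    length-filter-map : ∀ {A : Set} (f : A → ℕ) xs →
      length (filter (P? ∘ f) xs) ≡ length (filter P? (map f xs))
    length-filter-map f []       = refl
    length-filter-map f (x ∷ xs) with does (P? (f x))
    ... | true  = cong suc (length-filter-map f xs)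
    ... | false = length-filter-map f xs

    tabulate-applyUpTo : ∀ n (g : ℕ → ℕ) → tabulate {n = n} (g ∘ toℕ) ≡ applyUpTo g n
    tabulate-applyUpTo zero    g = refl
    tabulate-applyUpTo (suc n) g = cong (g 0 ∷_) (tabulate-applyUpTo n (g ∘ suc))

-- (n + k) / suc k is ⌈ n / (k + 1) ⌉.
turán-balanced : ∀ n k (r : Fin (suc k)) →
  partSize n k r ≡ n / suc k ⊎ partSize n k r ≡ (n ℕ.+ k) / suc k
turán-balanced n k r =
  subst (λ c → c ≡ n / suc k ⊎ c ≡ (n ℕ.+ k) / suc k) (sym eq) (B.balanced n)
  where
  module B = Balanced k (toℕ r) (toℕ≤pred[n] r)
  eq : partSize n k r ≡ B.cnt n
  eq = trans (B.length-filter-map toℕ (allFin n))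
         (cong (length ∘ filter B.P?)
           (trans (map-tabulate id toℕ) (B.tabulate-applyUpTo n id)))

{-# OPTIONS --safe #-}

-- Write κ = k - 1. Copies are counted by embeddings (each copy has as many parametrisations as
-- H has automorphisms), and a linear forest is a sequence of vertices in which some
-- consecutive pairs are joined.
--
-- Balancing is exact. For two classes of sizes a and b of a complete multipartite graph, the
-- part of a linear forest inside them is a union of alternating paths; by Vandermonde it has
-- 2ᵉ (a)_M (b)_M (a+b-2M)_r embeddings, where r counts the odd paths and e the even ones.
-- This grows when a larger class gives a vertex to a smaller one.
--
-- The rest is Simonovits' progressive induction. Deleting a vertex lying in fewer embeddings than
-- the last vertex of the Turán graph strictly increases the surplus over the Turán graph, so a
-- large F-free graph with a surplus would lead to a smaller one with an impossibly large surplus;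
-- hence it suffices to treat large graphs without such light vertices. There, a weighted
-- Erdős-Stone bound gives w(2a+1) ≤ (κ/k) w(a)² + o(·) for the number w(a) of walks with a edges.
-- Together with w(a)² ≤ n w(2a), applied to walks with 2ⁱ(a+1) vertices, it yields
-- w(a+1) ≤ (κ/k) n w(a) + o(·). Having almost the Turán number of embeddings therefore forces
-- w(1) ≈ (κ/k) n², and w(2) then shows that almost all degrees are close to (κ/k) n; so a
-- vertex of smaller degree would be light. Finally, minimum degree (κ/k - ε) n makes an
-- F-free graph k-colourable, since a complete k-partite subgraph plus an edge inside a part
-- already contains F.

module Submission where

open import Defs
open import Data.Bool using (Bool; true; false; if_then_else_)
import Data.Bool.Properties as Boolₚ
open import Data.Empty using (⊥; ⊥-elim)
open import Data.Fin using (Fin; zero; suc; toℕ; punchIn; fromℕ; fromℕ<; combine; remQuot; inject≤; splitAt; join)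
open import Data.Fin.Induction using (<-weakInduction)
open import Data.Fin.Permutation.Components using (transpose; transpose-inverse)
open import Data.Fin.Properties using (_≟_; all?; any?; punchInᵢ≢i; punchIn-injective; toℕ-fromℕ<; toℕ-injective; remQuot-combine; suc-injective; toℕ-inject₁; inject≤-injective; injective⇒≤; ¬Fin0; splitAt-join; join-splitAt)
open import Data.Fin.Subset using (Subset; _∈_)
open import Data.Fin.Subset.Properties using (⊆-antisym; _∈?_)
open import Data.List using (List; []; _∷_; _++_; length; filter; allFin; tabulate; cartesianProductWith) renaming (map to mapᴸ)
open import Data.List.Membership.Propositional using () renaming (_∈_ to _∈ᴸ_)
open import Data.List.Membership.Propositional.Properties using (∈-allFin)
open import Data.List.Properties using (map-cong; map-++; map-∘; filter-≐)
open import Data.List.Relation.Unary.Any using (here; there)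
open import Data.Nat using (ℕ; zero; suc; _+_; _*_; _∸_; _^_; _≤_; _<_; z≤n; s≤s; _/_; _%_; >-nonZero; NonZero)
import Data.Nat as ℕ
open import Data.Nat.Combinatorics.Base using (_P′_)
open import Data.Nat.Combinatorics.Specification using (nP′k≡n[n∸1P′k∸1])
open import Data.Nat.DivMod using (_mod_; m/n*n≤m; m%n<n; m≡m%n+[m/n]*n; /-monoˡ-≤)
open import Data.Nat.ListAction using (sum)
open import Data.Nat.ListAction.Properties using (sum-++)
open import Data.Nat.Properties hiding (_≟_; suc-injective)
open import Data.Nat.Properties using () renaming (_≟_ to _≟ℕ_; suc-injective to suc-injectiveℕ)
open import Data.Nat.Tactic.RingSolver using (solve-∀)
open import Data.Product using (Σ-syntax; ∃-syntax; _×_; _,_; proj₁; proj₂)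
import Data.Product.Properties as Productₚ
open import Data.Sum using (_⊎_; inj₁; inj₂; [_,_]′; swap) renaming (map to map⊎)
open import Data.Sum.Relation.Binary.Pointwise using (Pointwise; inj₁; inj₂)
open import Data.Unit using (⊤; tt)
open import Data.Vec using (Vec; []; _∷_; lookup; map; replicate) renaming (tabulate to tabulateᵛ; _++_ to _++ᵛ_)
open import Data.Vec.Properties using (map-id; lookup∘tabulate; []=⇒lookup; lookup⇒[]=)
import Data.Vec.Properties as Vecₚ
open import Data.Vec.Relation.Binary.Pointwise.Extensional using (ext; Pointwise-≡⇒≡)
open import Function using (_∘_; id; case_of_; _⇔_; mk⇔)
open import Function.Bundles using (module Equivalence)
open import Function.Definitions using (Injective)
open import Level using (0ℓ)
open import Relation.Binary using (Rel)
open import Relation.Binary.Construct.Closure.ReflexiveTransitive using (Star; ε; _◅_; _◅◅_; reverse)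
open import Relation.Binary.Definitions using (DecidableEquality)
open import Relation.Binary.PropositionalEquality using (_≡_; _≢_; _≗_; refl; sym; trans; cong; cong₂; subst; subst₂; module ≡-Reasoning)
open import Relation.Nullary using (¬_; Dec; yes; no; does; contradiction)
open import Relation.Nullary.Decidable using (map′; ¬?; _×-dec_; _⊎-dec_; _→-dec_; dec-true; dec-false; decidable-stable)
open import Relation.Unary using (Decidable)
open import Algebra.Properties.CommutativeSemigroup *-commutativeSemigroup using (x∙yz≈y∙xz; x∙yz≈yx∙z; x∙yz≈xz∙y; xy∙z≈y∙xz; interchange)
open import Algebra.Properties.CommutativeSemigroup +-commutativeSemigroup using () renaming (interchange to +-interchange)
open import Algebra.Properties.Semiring.Sum +-*-semiring using (∑-comm; ∑-distrib-+; sum-remove; *-distribˡ-sum; *-distribʳ-sum; sum-cong-≗) renaming (sum to ∑)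

private
  variable
    n m k : ℕ

-- Indicators, finite sums and counting

𝟙 : {P : Set} → Dec P → ℕ
𝟙 d = if does d then 1 else 0

𝟙≤1 : {P : Set} (d : Dec P) → 𝟙 d ≤ 1
𝟙≤1 (yes _) = ≤-refl
𝟙≤1 (no _)  = z≤n

𝟙-yes : {P : Set} (d : Dec P) → P → 𝟙 d ≡ 1
𝟙-yes d p = cong (if_then 1 else 0) (dec-true d p)

𝟙-no : {P : Set} (d : Dec P) → ¬ P → 𝟙 d ≡ 0
𝟙-no d ¬p = cong (if_then 1 else 0) (dec-false d ¬p)

𝟙-pos⁻¹ : {P : Set} (d : Dec P) → 0 < 𝟙 d → P
𝟙-pos⁻¹ (yes p) _ = p

𝟙-mono : {P Q : Set} (d : Dec P) (e : Dec Q) → (P → Q) → 𝟙 d ≤ 𝟙 e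
𝟙-mono (no _)  e f = z≤n
𝟙-mono (yes p) e f = ≤-reflexive (sym (𝟙-yes e (f p)))

𝟙-cong : {P Q : Set} (d : Dec P) (e : Dec Q) → (P → Q) → (Q → P) → 𝟙 d ≡ 𝟙 e
𝟙-cong d e f g = ≤-antisym (𝟙-mono d e f) (𝟙-mono e d g)

𝟙-× : {P Q : Set} (d : Dec P) (e : Dec Q) → 𝟙 (d ×-dec e) ≡ 𝟙 d * 𝟙 e
𝟙-× (yes _) e = sym (+-identityʳ (𝟙 e))
𝟙-× (no _)  e = refl

𝟙*-cong : {P : Set} (d : Dec P) {a b : ℕ} → (P → a ≡ b) → 𝟙 d * a ≡ 𝟙 d * b
𝟙*-cong (yes p) a≡b = cong (1 *_) (a≡b p)
𝟙*-cong (no _)  a≡b = refl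

𝟙-≟-comm : (i j : Fin n) → 𝟙 (i ≟ j) ≡ 𝟙 (j ≟ i)
𝟙-≟-comm i j = 𝟙-cong (i ≟ j) (j ≟ i) sym sym

𝟙*≤ : {P : Set} (d : Dec P) (c : ℕ) → 𝟙 d * c ≤ c
𝟙*≤ d c = ≤-trans (*-monoˡ-≤ c (𝟙≤1 d)) (≤-reflexive (*-identityˡ c))

∑-mono : {f g : Fin n → ℕ} → (∀ i → f i ≤ g i) → ∑ f ≤ ∑ g
∑-mono {zero}  _   = z≤n
∑-mono {suc n} f≤g = +-mono-≤ (f≤g zero) (∑-mono (f≤g ∘ suc))

∑-const : ∀ n c → ∑ {n} (λ _ → c) ≡ n * c
∑-const zero    c = refl
∑-const (suc n) c = cong (c +_) (∑-const n c)

∑-one : ∀ n → ∑ {n} (λ _ → 1) ≡ n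
∑-one n = trans (∑-const n 1) (*-identityʳ n)

∑-zero : {f : Fin n → ℕ} → (∀ i → f i ≡ 0) → ∑ f ≡ 0
∑-zero {n} f≡0 = trans (sum-cong-≗ f≡0) (trans (∑-const n 0) (*-zeroʳ n))

∑≤n*c : {f : Fin n → ℕ} (c : ℕ) → (∀ i → f i ≤ c) → ∑ f ≤ n * c
∑≤n*c {n} c f≤c = ≤-trans (∑-mono f≤c) (≤-reflexive (∑-const n c))

∑-*ˡ : (c : ℕ) (f : Fin n → ℕ) → ∑ (λ i → c * f i) ≡ c * ∑ f
∑-*ˡ c f = sym (*-distribˡ-sum c f)

∑-*ʳ : (c : ℕ) (f : Fin n → ℕ) → ∑ (λ i → f i * c) ≡ ∑ f * c
∑-*ʳ c f = sym (*-distribʳ-sum c f)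

∑-linear : (c d : ℕ) (f g : Fin n → ℕ) → ∑ (λ i → c * f i + d * g i) ≡ c * ∑ f + d * ∑ g
∑-linear c d f g = trans (∑-distrib-+ (λ i → c * f i) (λ i → d * g i)) (cong₂ _+_ (∑-*ˡ c f) (∑-*ˡ d g))

∑-adjoint : (M : Fin n → Fin m → ℕ) (x : Fin n → ℕ) (y : Fin m → ℕ) →
  ∑ (λ v → x v * ∑ λ u → M v u * y u) ≡ ∑ (λ u → ∑ (λ v → M v u * x v) * y u)
∑-adjoint M x y = begin
  ∑ (λ v → x v * ∑ λ u → M v u * y u)      ≡⟨ sum-cong-≗ (λ v → *-distribˡ-sum (x v) λ u → M v u * y u) ⟩
  ∑ (λ v → ∑ λ u → x v * (M v u * y u))    ≡⟨ ∑-comm (λ v u → x v * (M v u * y u)) ⟩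
  ∑ (λ u → ∑ λ v → x v * (M v u * y u))    ≡⟨ sum-cong-≗ (λ u → sum-cong-≗ λ v → x∙yz≈yx∙z (x v) (M v u) (y u)) ⟩
  ∑ (λ u → ∑ λ v → M v u * x v * y u)      ≡⟨ sum-cong-≗ (λ u → ∑-*ʳ (y u) λ v → M v u * x v) ⟩
  ∑ (λ u → ∑ (λ v → M v u * x v) * y u)    ∎
  where open ≡-Reasoning

term≤∑ : (f : Fin n → ℕ) (i : Fin n) → f i ≤ ∑ f
term≤∑ f zero    = m≤m+n _ _
term≤∑ f (suc i) = ≤-trans (term≤∑ (f ∘ suc) i) (m≤n+m _ _)

two-terms≤∑ : (f : Fin n → ℕ) {i j : Fin n} → i ≢ j → f i + f j ≤ ∑ f
two-terms≤∑ f {zero}  {zero}  i≢j = contradiction refl i≢j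
two-terms≤∑ f {zero}  {suc j} i≢j = +-monoʳ-≤ (f zero) (term≤∑ (f ∘ suc) j)
two-terms≤∑ f {suc i} {zero}  i≢j = ≤-trans (≤-reflexive (+-comm (f (suc i)) (f zero))) (+-monoʳ-≤ (f zero) (term≤∑ (f ∘ suc) i))
two-terms≤∑ f {suc i} {suc j} i≢j = ≤-trans (two-terms≤∑ (f ∘ suc) (i≢j ∘ cong suc)) (m≤n+m _ (f zero))

∑-pos⇒∃ : (f : Fin n → ℕ) → 0 < ∑ f → ∃[ i ] 0 < f i
∑-pos⇒∃ {suc n} f 0<∑ with f zero in eq
... | suc _ = zero , subst (0 <_) (sym eq) (s≤s z≤n)
... | zero  = let i , 0<fi = ∑-pos⇒∃ (f ∘ suc) 0<∑ in suc i , 0<fi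

∑-≡⇒≗ : {f g : Fin n → ℕ} → (∀ i → f i ≤ g i) → ∑ f ≡ ∑ g → f ≗ g
∑-≡⇒≗ {suc n} {f} {g} f≤g eq zero    = ≤-antisym (f≤g zero) (+-cancelʳ-≤ (∑ (f ∘ suc)) (g zero) (f zero)
  (≤-trans (+-monoʳ-≤ (g zero) (∑-mono (f≤g ∘ suc))) (≤-reflexive (sym eq))))
∑-≡⇒≗ {suc n} {f} {g} f≤g eq (suc i) = ∑-≡⇒≗ (f≤g ∘ suc) (+-cancelˡ-≡ (f zero) _ _
  (trans eq (cong (_+ ∑ (g ∘ suc)) (sym (∑-≡⇒≗ f≤g eq zero))))) i

∑-δ : (a : Fin n) (f : Fin n → ℕ) → ∑ (λ i → 𝟙 (i ≟ a) * f i) ≡ f a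
∑-δ {suc n} zero    f = trans (cong₂ _+_ (*-identityˡ (f zero)) (∑-zero {f = λ i → 0 * f (suc i)} λ _ → refl)) (+-identityʳ (f zero))
∑-δ {suc n} (suc a) f = ∑-δ a (f ∘ suc)

count : {P : Fin n → Set} → Decidable P → ℕ
count P? = ∑ λ i → 𝟙 (P? i)

module _ {n : ℕ} {P : Fin n → Set} (P? : Decidable P) where

  count≤n : count P? ≤ n
  count≤n = ≤-trans (∑≤n*c 1 λ i → 𝟙≤1 (P? i)) (≤-reflexive (*-identityʳ n))

  count-none : (∀ i → ¬ P i) → count P? ≡ 0
  count-none none = ∑-zero λ i → 𝟙-no (P? i) (none i)

  count-all : (∀ i → P i) → count P? ≡ n
  count-all all = trans (sum-cong-≗ λ i → 𝟙-yes (P? i) (all i)) (∑-one n)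

  count-mono : {Q : Fin n → Set} (Q? : Decidable Q) → (∀ {i} → P i → Q i) → count P? ≤ count Q?
  count-mono Q? P⊆Q = ∑-mono λ i → 𝟙-mono (P? i) (Q? i) P⊆Q

  count-cong : {Q : Fin n → Set} (Q? : Decidable Q) → (∀ {i} → P i → Q i) → (∀ {i} → Q i → P i) → count P? ≡ count Q?
  count-cong Q? P⊆Q Q⊆P = sum-cong-≗ λ i → 𝟙-cong (P? i) (Q? i) P⊆Q Q⊆P

  count-split : {Q : Fin n → Set} (Q? : Decidable Q) →
    count P? ≡ count (λ i → P? i ×-dec Q? i) + count (λ i → P? i ×-dec ¬? (Q? i))
  count-split Q? = trans (sum-cong-≗ λ i → split (P? i) (Q? i)) (∑-distrib-+ (λ i → 𝟙 (P? i ×-dec Q? i)) _)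
    where
    split : {A B : Set} (a : Dec A) (b : Dec B) → 𝟙 a ≡ 𝟙 (a ×-dec b) + 𝟙 (a ×-dec ¬? b)
    split (yes _) (yes _) = refl
    split (yes _) (no _)  = refl
    split (no _)  _       = refl

  count-complement : count P? + count (λ i → ¬? (P? i)) ≡ n
  count-complement = trans (sym (∑-distrib-+ (λ i → 𝟙 (P? i)) _)) (trans (sum-cong-≗ λ i → complement (P? i)) (∑-one n))
    where
    complement : {A : Set} (a : Dec A) → 𝟙 a + 𝟙 (¬? a) ≡ 1
    complement (yes _) = refl
    complement (no _)  = refl

  count-disjoint : {Q R : Fin n → Set} (Q? : Decidable Q) (R? : Decidable R) → (∀ {i} → P i → ¬ Q i) →
    (∀ {i} → P i → R i) → (∀ {i} → Q i → R i) → count P? + count Q? ≤ count R?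
  count-disjoint Q? R? P∩Q=∅ P⊆R Q⊆R = ≤-trans (≤-reflexive (sym (∑-distrib-+ (λ i → 𝟙 (P? i)) _))) (∑-mono bound)
    where
    bound : ∀ i → 𝟙 (P? i) + 𝟙 (Q? i) ≤ 𝟙 (R? i)
    bound i with P? i | Q? i
    ... | yes p | yes q = contradiction q (P∩Q=∅ p)
    ... | yes p | no _  = ≤-reflexive (sym (𝟙-yes (R? i) (P⊆R p)))
    ... | no _  | yes q = ≤-reflexive (sym (𝟙-yes (R? i) (Q⊆R q)))
    ... | no _  | no _  = z≤n

  count-cover : {Q R : Fin n → Set} (Q? : Decidable Q) (R? : Decidable R) → (∀ {i} → P i → Q i ⊎ R i) → count P? ≤ count Q? + count R?
  count-cover Q? R? P⊆Q∪R = ≤-trans (∑-mono bound) (≤-reflexive (∑-distrib-+ (λ i → 𝟙 (Q? i)) _))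
    where
    bound : ∀ i → 𝟙 (P? i) ≤ 𝟙 (Q? i) + 𝟙 (R? i)
    bound i with P? i
    ... | no _  = z≤n
    ... | yes p with P⊆Q∪R p
    ...   | inj₁ q = ≤-trans (≤-reflexive (sym (𝟙-yes (Q? i) q))) (m≤m+n _ _)
    ...   | inj₂ r = ≤-trans (≤-reflexive (sym (𝟙-yes (R? i) r))) (m≤n+m _ _)

  count-cover₃ : {Q R S : Fin n → Set} (Q? : Decidable Q) (R? : Decidable R) (S? : Decidable S) → (∀ {i} → P i → Q i ⊎ R i ⊎ S i) →
    count P? ≤ count Q? + (count R? + count S?)
  count-cover₃ Q? R? S? P⊆Q∪R∪S = ≤-trans (count-cover Q? (λ i → R? i ⊎-dec S? i) P⊆Q∪R∪S)
    (+-monoʳ-≤ (count Q?) (≤-trans (∑-mono λ i → 𝟙-⊎ (R? i) (S? i)) (≤-reflexive (∑-distrib-+ (λ i → 𝟙 (R? i)) _))))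
    where
    𝟙-⊎ : {A B : Set} (a : Dec A) (b : Dec B) → 𝟙 (a ⊎-dec b) ≤ 𝟙 a + 𝟙 b
    𝟙-⊎ (yes _) b = s≤s z≤n
    𝟙-⊎ (no _)  b = ≤-refl

count-fibre≤1 : (f : Fin m → Fin n) → Injective _≡_ _≡_ f → (a : Fin n) → count (λ i → f i ≟ a) ≤ 1
count-fibre≤1 {zero}  f inj a = z≤n
count-fibre≤1 {suc m} f inj a with f zero ≟ a
... | no _   = count-fibre≤1 (f ∘ suc) (suc-injective ∘ inj) a
... | yes f0≡a = ≤-reflexive (cong suc (count-none (λ i → f (suc i) ≟ a)
  λ i fi≡a → 0≢1+n (cong toℕ (inj (trans f0≡a (sym fi≡a))))))

∑-𝟙-≟ : (a : Fin n) → ∑ (λ i → 𝟙 (a ≟ i)) ≡ 1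
∑-𝟙-≟ a = trans (sum-cong-≗ λ i → trans (𝟙-≟-comm a i) (sym (*-identityʳ _))) (∑-δ a λ _ → 1)

∑-count-fibres : (f : Fin n → Fin k) → ∑ (λ j → count λ v → f v ≟ j) ≡ n
∑-count-fibres {n} f = begin
  ∑ (λ j → ∑ λ v → 𝟙 (f v ≟ j))          ≡⟨ ∑-comm (λ j v → 𝟙 (f v ≟ j)) ⟩
  ∑ (λ v → ∑ λ j → 𝟙 (f v ≟ j))          ≡⟨ sum-cong-≗ (λ v → ∑-𝟙-≟ (f v)) ⟩
  ∑ {n} (λ v → 1)                         ≡⟨ ∑-one n ⟩
  n                                       ∎
  where open ≡-Reasoning

∑-by-fibre : (f : Fin n → Fin k) (x : Fin n → ℕ) (y : Fin k → ℕ) →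
  ∑ (λ v → x v * y (f v)) ≡ ∑ λ j → ∑ (λ v → 𝟙 (f v ≟ j) * x v) * y j
∑-by-fibre f x y = trans (sum-cong-≗ λ v → cong (x v *_) (sym (value (f v)))) (∑-adjoint (λ v j → 𝟙 (f v ≟ j)) x y)
  where
  value : ∀ a → ∑ (λ j → 𝟙 (a ≟ j) * y j) ≡ y a
  value a = trans (sum-cong-≗ λ j → cong (_* y j) (𝟙-≟-comm a j)) (∑-δ a y)

record Selection {n : ℕ} (P : Fin n → Set) (t : ℕ) : Set where
  field
    select           : Fin t → Fin n
    select-injective : Injective _≡_ _≡_ select
    select-member    : ∀ i → P (select i)

open Selection public

selection : {P : Fin n → Set} (P? : Decidable P) (t : ℕ) → t ≤ count P? → Selection P t
selection P? zero _ = record { select = λ () ; select-injective = λ {} ; select-member = λ () }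
selection {suc n} {P} P? (suc t) t<count with P? zero
... | no _   = record
  { select = suc ∘ select S ; select-injective = select-injective S ∘ suc-injective ; select-member = select-member S }
  where S = selection (P? ∘ suc) (suc t) t<count
... | yes p₀ = record { select = select₀ ; select-injective = injective₀ ; select-member = member₀ }
  where
  S = selection (P? ∘ suc) t (≤-pred t<count)
  select₀ : Fin (suc t) → Fin (suc n)
  select₀ zero    = zero
  select₀ (suc i) = suc (select S i)
  injective₀ : Injective _≡_ _≡_ select₀
  injective₀ {zero}  {zero}  _ = refl
  injective₀ {suc i} {suc j} e = cong suc (select-injective S (suc-injective e))
  member₀ : ∀ i → P (select₀ i)
  member₀ zero    = p₀
  member₀ (suc i) = select-member S i

-- Sums over vertex sequences

∑ᵛ : ∀ m → (Vec (Fin n) m → ℕ) → ℕ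
∑ᵛ zero    f = f []
∑ᵛ (suc m) f = ∑ λ x → ∑ᵛ m λ xs → f (x ∷ xs)

∑ᵛ-cong : ∀ m {f g : Vec (Fin n) m → ℕ} → (∀ x → f x ≡ g x) → ∑ᵛ m f ≡ ∑ᵛ m g
∑ᵛ-cong zero    f≗g = f≗g []
∑ᵛ-cong (suc m) f≗g = sum-cong-≗ λ x → ∑ᵛ-cong m λ xs → f≗g (x ∷ xs)

∑ᵛ-mono : ∀ m {f g : Vec (Fin n) m → ℕ} → (∀ x → f x ≤ g x) → ∑ᵛ m f ≤ ∑ᵛ m g
∑ᵛ-mono zero    f≤g = f≤g []
∑ᵛ-mono (suc m) f≤g = ∑-mono λ x → ∑ᵛ-mono m λ xs → f≤g (x ∷ xs)

∑ᵛ-const : ∀ m c → ∑ᵛ {n} m (λ _ → c) ≡ n ^ m * c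
∑ᵛ-const     zero    c = sym (*-identityˡ c)
∑ᵛ-const {n} (suc m) c = begin
  ∑ {n} (λ _ → ∑ᵛ {n} m λ _ → c)   ≡⟨ sum-cong-≗ {n} (λ _ → ∑ᵛ-const m c) ⟩
  ∑ {n} (λ _ → n ^ m * c)          ≡⟨ ∑-const n _ ⟩
  n * (n ^ m * c)                  ≡⟨ *-assoc n (n ^ m) c ⟨
  n ^ suc m * c                    ∎
  where open ≡-Reasoning

∑ᵛ-zero : ∀ m {f : Vec (Fin n) m → ℕ} → (∀ x → f x ≡ 0) → ∑ᵛ m f ≡ 0
∑ᵛ-zero {n} m f≡0 = trans (∑ᵛ-cong m f≡0) (trans (∑ᵛ-const m 0) (*-zeroʳ (n ^ m)))

∑ᵛ-+ : ∀ m (f g : Vec (Fin n) m → ℕ) → ∑ᵛ m (λ x → f x + g x) ≡ ∑ᵛ m f + ∑ᵛ m g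
∑ᵛ-+ zero    f g = refl
∑ᵛ-+ (suc m) f g = trans (sum-cong-≗ λ x → ∑ᵛ-+ m (λ xs → f (x ∷ xs)) (λ xs → g (x ∷ xs)))
  (∑-distrib-+ (λ x → ∑ᵛ m λ xs → f (x ∷ xs)) _)

∑ᵛ-*ˡ : ∀ m c (f : Vec (Fin n) m → ℕ) → ∑ᵛ m (λ x → c * f x) ≡ c * ∑ᵛ m f
∑ᵛ-*ˡ zero    c f = refl
∑ᵛ-*ˡ (suc m) c f = trans (sum-cong-≗ λ x → ∑ᵛ-*ˡ m c λ xs → f (x ∷ xs)) (∑-*ˡ c λ x → ∑ᵛ m λ xs → f (x ∷ xs))

∑ᵛ-∑ : ∀ m (f : Vec (Fin n) m → Fin k → ℕ) → ∑ᵛ m (λ x → ∑ (f x)) ≡ ∑ λ i → ∑ᵛ m λ x → f x i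
∑ᵛ-∑ zero    f = refl
∑ᵛ-∑ (suc m) f = trans (sum-cong-≗ λ x → ∑ᵛ-∑ m λ xs → f (x ∷ xs)) (∑-comm λ x i → ∑ᵛ m λ xs → f (x ∷ xs) i)

occ : Fin n → Vec (Fin n) m → ℕ
occ v []       = 0
occ v (x ∷ xs) = 𝟙 (x ≟ v) + occ v xs

absent : Fin n → Vec (Fin n) m → ℕ
absent v x = 𝟙 (occ v x ≟ℕ 0)

distinct : Vec (Fin n) m → ℕ
distinct []       = 1
distinct (x ∷ xs) = absent x xs * distinct xs

distinct≤1 : (x : Vec (Fin n) m) → distinct x ≤ 1
distinct≤1 []       = ≤-refl
distinct≤1 (x ∷ xs) = *-mono-≤ (𝟙≤1 (occ x xs ≟ℕ 0)) (distinct≤1 xs)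

distinct-absent-or-once : (v : Fin n) (x : Vec (Fin n) m) → distinct x * (absent v x + occ v x) ≡ distinct x
distinct-absent-or-once v [] = refl
distinct-absent-or-once v (x ∷ xs) with x ≟ v | occ x xs in eq
... | _        | suc _ = refl
... | yes refl | zero  rewrite eq = *-identityʳ _
... | no _     | zero  = begin
  (distinct xs + 0) * (absent v xs + occ v xs)   ≡⟨ cong (_* (absent v xs + occ v xs)) (+-identityʳ (distinct xs)) ⟩
  distinct xs * (absent v xs + occ v xs)         ≡⟨ distinct-absent-or-once v xs ⟩
  distinct xs                                    ≡⟨ +-identityʳ (distinct xs) ⟨
  distinct xs + 0                                ∎
  where open ≡-Reasoning

occ-map : (f : Fin n → Fin k) → Injective _≡_ _≡_ f → ∀ v (x : Vec (Fin n) m) → occ (f v) (map f x) ≡ occ v x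
occ-map f inj v []       = refl
occ-map f inj v (x ∷ xs) = cong₂ _+_ (𝟙-cong (f x ≟ f v) (x ≟ v) inj (cong f)) (occ-map f inj v xs)

distinct-map : (f : Fin n → Fin k) → Injective _≡_ _≡_ f → (x : Vec (Fin n) m) → distinct (map f x) ≡ distinct x
distinct-map f inj []       = refl
distinct-map f inj (x ∷ xs) = cong₂ _*_ (cong (λ o → 𝟙 (o ≟ℕ 0)) (occ-map f inj x xs)) (distinct-map f inj xs)

∑-occ-fibre : (f : Fin n → Fin k) (j : Fin k) (x : Vec (Fin n) m) → ∑ (λ v → 𝟙 (f v ≟ j) * occ v x) ≡ occ j (map f x)
∑-occ-fibre {n} f j []   = ∑-zero {n} λ v → *-zeroʳ (𝟙 (f v ≟ j))
∑-occ-fibre f j (x ∷ xs) = begin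
  ∑ (λ v → 𝟙 (f v ≟ j) * (𝟙 (x ≟ v) + occ v xs))
    ≡⟨ sum-cong-≗ (λ v → trans (cong (λ i → 𝟙 (f v ≟ j) * (i + occ v xs)) (𝟙-≟-comm x v)) (expand (𝟙 (f v ≟ j)) (𝟙 (v ≟ x)) (occ v xs))) ⟩
  ∑ (λ v → 𝟙 (v ≟ x) * 𝟙 (f v ≟ j) + 𝟙 (f v ≟ j) * occ v xs)
    ≡⟨ ∑-distrib-+ (λ v → 𝟙 (v ≟ x) * 𝟙 (f v ≟ j)) _ ⟩
  ∑ (λ v → 𝟙 (v ≟ x) * 𝟙 (f v ≟ j)) + ∑ (λ v → 𝟙 (f v ≟ j) * occ v xs)
    ≡⟨ cong₂ _+_ (∑-δ x λ v → 𝟙 (f v ≟ j)) (∑-occ-fibre f j xs) ⟩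
  𝟙 (f x ≟ j) + occ j (map f xs) ∎
  where
  open ≡-Reasoning
  expand : ∀ p q r → p * (q + r) ≡ q * p + p * r
  expand = solve-∀

∑-occ : (x : Vec (Fin n) m) → ∑ (λ v → occ v x) ≡ m
∑-occ {n} []   = ∑-zero {n} λ _ → refl
∑-occ (x ∷ xs) = trans (∑-distrib-+ (λ v → 𝟙 (x ≟ v)) _) (cong₂ _+_ (∑-𝟙-≟ x) (∑-occ xs))

-- Embeddings of linear forests

adjacency : Graph n → Fin n → Fin n → ℕ
adjacency G u v = 𝟙 (adj? G u v)

link : Graph n → Bool → Fin n → Fin n → ℕ
link G true  u v = adjacency G u v
link G false u v = 1

link-sym : (G : Graph n) (b : Bool) (u v : Fin n) → link G b u v ≡ link G b v u
link-sym G true  u v = 𝟙-cong (adj? G u v) (adj? G v u) (symm G) (symm G)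
link-sym G false u v = refl

link≤1 : (G : Graph n) (b : Bool) (u v : Fin n) → link G b u v ≤ 1
link≤1 G true  u v = 𝟙≤1 (adj? G u v)
link≤1 G false u v = ≤-refl

deg : Graph n → Fin n → ℕ
deg G v = count (adj? G v)

-- A linear forest with m + 1 vertices is encoded by m flags, the i-th one telling whether
-- the i-th and (i+1)-st vertices are adjacent; hom is the indicator of homomorphisms.
hom : Graph n → Vec Bool m → Vec (Fin n) (suc m) → ℕ
hom G []       _            = 1
hom G (b ∷ bs) (x ∷ y ∷ xs) = link G b x y * hom G bs (y ∷ xs)

hom≤1 : (G : Graph n) (bs : Vec Bool m) (x : Vec (Fin n) (suc m)) → hom G bs x ≤ 1
hom≤1 G []       x            = ≤-refl
hom≤1 G (b ∷ bs) (x ∷ y ∷ xs) = *-mono-≤ (link≤1 G b x y) (hom≤1 G bs (y ∷ xs))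

embeddings : Graph n → Vec Bool m → ℕ
embeddings {m = m} G bs = ∑ᵛ (suc m) λ x → distinct x * hom G bs x

embeddings≤ : (G : Graph n) (bs : Vec Bool m) → embeddings G bs ≤ n ^ suc m
embeddings≤ {n} {m} G bs = ≤-trans (∑ᵛ-mono (suc m) λ x → *-mono-≤ (distinct≤1 x) (hom≤1 G bs x))
  (≤-reflexive (trans (∑ᵛ-const {n} (suc m) 1) (*-identityʳ (n ^ suc m))))

hom-map-mono : (G : Graph n) (H : Graph k) {p : ℕ} (f : Fin p → Fin n) (g : Fin p → Fin k) →
  (∀ u v → Adj G (f u) (f v) → Adj H (g u) (g v)) →
  (bs : Vec Bool m) (x : Vec (Fin p) (suc m)) → hom G bs (map f x) ≤ hom H bs (map g x)
hom-map-mono G H f g f⇒g []           x            = ≤-refl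
hom-map-mono G H f g f⇒g (true ∷ bs)  (x ∷ y ∷ xs) =
  *-mono-≤ (𝟙-mono (adj? G (f x) (f y)) (adj? H (g x) (g y)) (f⇒g x y)) (hom-map-mono G H f g f⇒g bs (y ∷ xs))
hom-map-mono G H f g f⇒g (false ∷ bs) (x ∷ y ∷ xs) = *-monoʳ-≤ 1 (hom-map-mono G H f g f⇒g bs (y ∷ xs))

hom-mono : (G : Graph n) (H : Graph k) (f : Fin n → Fin k) → (∀ u v → Adj G u v → Adj H (f u) (f v)) →
  (bs : Vec Bool m) (x : Vec (Fin n) (suc m)) → hom G bs x ≤ hom H bs (map f x)
hom-mono G H f preserves bs x = subst (λ y → hom G bs y ≤ hom H bs (map f x)) (map-id x) (hom-map-mono G H id f preserves bs x)

hom-reflect : (G : Graph n) (H : Graph k) (f : Fin n → Fin k) → (∀ u v → Adj H (f u) (f v) → Adj G u v) →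
  (bs : Vec Bool m) (x : Vec (Fin n) (suc m)) → hom H bs (map f x) ≤ hom G bs x
hom-reflect G H f reflects bs x = subst (λ y → hom H bs (map f x) ≤ hom G bs y) (map-id x) (hom-map-mono H G f id reflects bs x)

embeddings-mono : (G H : Graph n) → (∀ u v → Adj G u v → Adj H u v) → (bs : Vec Bool m) → embeddings G bs ≤ embeddings H bs
embeddings-mono {m = m} G H G⊆H bs = ∑ᵛ-mono (suc m) λ x → *-monoʳ-≤ (distinct x)
  (subst (hom G bs x ≤_) (cong (hom H bs) (map-id x)) (hom-mono G H id G⊆H bs x))

edgeCount : Vec Bool m → ℕ
edgeCount []           = 0
edgeCount (true ∷ bs)  = suc (edgeCount bs)
edgeCount (false ∷ bs) = edgeCount bs

edgeless-embeddings-mono : (G H : Graph n) (bs : Vec Bool m) → edgeCount bs ≡ 0 → embeddings G bs ≤ embeddings H bs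
edgeless-embeddings-mono {m = m} G H bs e≡0 = ∑ᵛ-mono (suc m) λ x → *-monoʳ-≤ (distinct x) (hom≤ bs e≡0 x)
  where
  hom≤ : (bs : Vec Bool k) → edgeCount bs ≡ 0 → ∀ x → hom G bs x ≤ hom H bs x
  hom≤ []           e≡0 x            = ≤-refl
  hom≤ (false ∷ bs) e≡0 (x ∷ y ∷ xs) = *-monoʳ-≤ 1 (hom≤ bs e≡0 (y ∷ xs))

-- Copies and embeddings

∑ᴸ : {B : Set} → (B → ℕ) → List B → ℕ
∑ᴸ f xs = sum (mapᴸ f xs)

∑ᴸ-cong : {B : Set} {f g : B → ℕ} → f ≗ g → ∀ xs → ∑ᴸ f xs ≡ ∑ᴸ g xs
∑ᴸ-cong f≗g xs = cong sum (map-cong f≗g xs)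

∑ᴸ-*ʳ : {B : Set} (f : B → ℕ) (c : ℕ) → ∀ xs → ∑ᴸ (λ x → f x * c) xs ≡ ∑ᴸ f xs * c
∑ᴸ-*ʳ f c []       = refl
∑ᴸ-*ʳ f c (x ∷ xs) = trans (cong (f x * c +_) (∑ᴸ-*ʳ f c xs)) (sym (*-distribʳ-+ c (f x) _))

∑ᴸ-product : {B C D : Set} (f : D → ℕ) (g : B → C → D) → ∀ xs ys →
  ∑ᴸ f (cartesianProductWith g xs ys) ≡ ∑ᴸ (λ x → ∑ᴸ (λ y → f (g x y)) ys) xs
∑ᴸ-product f g []       ys = refl
∑ᴸ-product f g (x ∷ xs) ys = begin
  ∑ᴸ f (mapᴸ (g x) ys ++ cartesianProductWith g xs ys)                  ≡⟨ cong sum (map-++ f (mapᴸ (g x) ys) _) ⟩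
  sum (mapᴸ f (mapᴸ (g x) ys) ++ mapᴸ f (cartesianProductWith g xs ys)) ≡⟨ sum-++ (mapᴸ f (mapᴸ (g x) ys)) _ ⟩
  ∑ᴸ f (mapᴸ (g x) ys) + ∑ᴸ f (cartesianProductWith g xs ys)            ≡⟨ cong₂ _+_ (cong sum (sym (map-∘ ys))) (∑ᴸ-product f g xs ys) ⟩
  ∑ᴸ (λ y → f (g x y)) ys + ∑ᴸ (λ x → ∑ᴸ (λ y → f (g x y)) ys) xs       ∎
  where open ≡-Reasoning

length-filter : {B : Set} {P : B → Set} (P? : Decidable P) → ∀ xs → length (filter P? xs) ≡ ∑ᴸ (𝟙 ∘ P?) xs
length-filter P? [] = refl
length-filter P? (x ∷ xs) with P? x
... | yes _ = cong suc (length-filter P? xs)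
... | no _  = length-filter P? xs

∑ᴸ-tabulate : {B : Set} (f : B → ℕ) (g : Fin n → B) → ∑ᴸ f (tabulate g) ≡ ∑ (f ∘ g)
∑ᴸ-tabulate {zero}  f g = refl
∑ᴸ-tabulate {suc n} f g = cong (f (g zero) +_) (∑ᴸ-tabulate f (g ∘ suc))

∑ᵛ-∑ᴸ : ∀ m {B : Set} (f : Vec (Fin n) m → B → ℕ) xs → ∑ᵛ m (λ x → ∑ᴸ (f x) xs) ≡ ∑ᴸ (λ b → ∑ᵛ m λ x → f x b) xs
∑ᵛ-∑ᴸ m f []       = ∑ᵛ-zero m λ _ → refl
∑ᵛ-∑ᴸ m f (b ∷ xs) = trans (∑ᵛ-+ m (λ x → f x b) _) (cong (∑ᵛ m (λ x → f x b) +_) (∑ᵛ-∑ᴸ m f xs))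

record Enumerates {B : Set} (_≟ᴮ_ : DecidableEquality B) (xs : List B) : Set where
  constructor enumerates
  field once : ∀ a → ∑ᴸ (λ x → 𝟙 (x ≟ᴮ a)) xs ≡ 1

open Enumerates

enumerates-δ : {B : Set} {_≟ᴮ_ : DecidableEquality B} {xs : List B} → Enumerates _≟ᴮ_ xs → ∀ a c → ∑ᴸ (λ x → 𝟙 (x ≟ᴮ a) * c) xs ≡ c
enumerates-δ {_≟ᴮ_ = _≟ᴮ_} {xs} enum a c = trans (∑ᴸ-*ʳ (λ x → 𝟙 (x ≟ᴮ a)) c xs) (trans (cong (_* c) (once enum a)) (*-identityˡ c))

enumerates-product : {B C D : Set} {_≟ᴮ_ : DecidableEquality B} {_≟ᶜ_ : DecidableEquality C} {_≟ᴰ_ : DecidableEquality D}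
  (g : B → C → D) → (∀ {b c b′ c′} → g b c ≡ g b′ c′ → b ≡ b′ × c ≡ c′) → (∀ d → ∃[ b ] ∃[ c ] d ≡ g b c) →
  {xs : List B} {ys : List C} → Enumerates _≟ᴮ_ xs → Enumerates _≟ᶜ_ ys → Enumerates _≟ᴰ_ (cartesianProductWith g xs ys)
enumerates-product {_≟ᴮ_ = _≟ᴮ_} {_≟ᶜ_} {_≟ᴰ_} g injective onto {xs} {ys} enumˣ enumʸ = enumerates each
  where
  open ≡-Reasoning
  both : ∀ b c x y → 𝟙 (g x y ≟ᴰ g b c) ≡ 𝟙 (y ≟ᶜ c) * 𝟙 (x ≟ᴮ b)
  both b c x y = trans
    (𝟙-cong (g x y ≟ᴰ g b c) ((y ≟ᶜ c) ×-dec (x ≟ᴮ b)) (λ e → let eˣ , eʸ = injective e in eʸ , eˣ) λ { (refl , refl) → refl })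
    (𝟙-× (y ≟ᶜ c) (x ≟ᴮ b))
  each : ∀ d → ∑ᴸ (λ z → 𝟙 (z ≟ᴰ d)) (cartesianProductWith g xs ys) ≡ 1
  each d with onto d
  ... | b , c , refl = begin
    ∑ᴸ (λ z → 𝟙 (z ≟ᴰ g b c)) (cartesianProductWith g xs ys)      ≡⟨ ∑ᴸ-product (λ z → 𝟙 (z ≟ᴰ g b c)) g xs ys ⟩
    ∑ᴸ (λ x → ∑ᴸ (λ y → 𝟙 (g x y ≟ᴰ g b c)) ys) xs
      ≡⟨ ∑ᴸ-cong (λ x → trans (∑ᴸ-cong (both b c x) ys) (∑ᴸ-*ʳ (λ y → 𝟙 (y ≟ᶜ c)) (𝟙 (x ≟ᴮ b)) ys)) xs ⟩
    ∑ᴸ (λ x → ∑ᴸ (λ y → 𝟙 (y ≟ᶜ c)) ys * 𝟙 (x ≟ᴮ b)) xs           ≡⟨ ∑ᴸ-cong (λ x → trans (cong (_* 𝟙 (x ≟ᴮ b)) (once enumʸ c)) (*-identityˡ _)) xs ⟩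
    ∑ᴸ (λ x → 𝟙 (x ≟ᴮ b)) xs                                      ≡⟨ once enumˣ b ⟩
    1                                                             ∎

enumerates-vectors : {B : Set} {_≟ᴮ_ : DecidableEquality B} {xs : List B} → Enumerates _≟ᴮ_ xs → ∀ m → Enumerates (Vecₚ.≡-dec _≟ᴮ_) (vectors xs m)
enumerates-vectors enum zero    = enumerates λ { [] → refl }
enumerates-vectors enum (suc m) = enumerates-product _∷_ Vecₚ.∷-injective (λ { (x ∷ xs) → x , xs , refl }) enum (enumerates-vectors enum m)

_≟ˢ_ : DecidableEquality (SubgraphData n)
_≟ˢ_ = Productₚ.≡-dec (Vecₚ.≡-dec Boolₚ._≟_) (Vecₚ.≡-dec (Vecₚ.≡-dec Boolₚ._≟_))

enumerates-subgraphs : ∀ n → Enumerates _≟ˢ_ (allSubgraphData n)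
enumerates-subgraphs n = enumerates-product _,_ (λ { refl → refl , refl }) (λ { (V , E) → V , E , refl }) subsets (enumerates-vectors subsets n)
  where
  bools : Enumerates Boolₚ._≟_ (true ∷ false ∷ [])
  bools = enumerates λ { true → refl ; false → refl }
  subsets : Enumerates (Vecₚ.≡-dec Boolₚ._≟_) (vectors (true ∷ false ∷ []) n)
  subsets = enumerates-vectors bools n

_≟ᵛ_ : DecidableEquality (Vec (Fin n) m)
_≟ᵛ_ = Vecₚ.≡-dec _≟_

∑ᵛ-comm : ∀ m {p} m′ (f : Vec (Fin n) m → Vec (Fin p) m′ → ℕ) → ∑ᵛ m (λ x → ∑ᵛ m′ (f x)) ≡ ∑ᵛ m′ λ y → ∑ᵛ m λ x → f x y
∑ᵛ-comm zero    m′ f = refl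
∑ᵛ-comm (suc m) m′ f = trans (sum-cong-≗ λ x → ∑ᵛ-comm m m′ λ xs → f (x ∷ xs)) (sym (∑ᵛ-∑ m′ λ y x → ∑ᵛ m λ xs → f (x ∷ xs) y))

∑ᵛ-δ : ∀ m (a : Vec (Fin n) m) (f : Vec (Fin n) m → ℕ) → ∑ᵛ m (λ x → 𝟙 (x ≟ᵛ a) * f x) ≡ f a
∑ᵛ-δ zero    []       f = *-identityˡ _
∑ᵛ-δ (suc m) (a ∷ as) f = begin
  ∑ (λ x → ∑ᵛ m λ xs → 𝟙 ((x ∷ xs) ≟ᵛ (a ∷ as)) * f (x ∷ xs))
    ≡⟨ sum-cong-≗ (λ x → ∑ᵛ-cong m λ xs → trans (cong (_* f (x ∷ xs)) (𝟙-× (x ≟ a) (xs ≟ᵛ as))) (*-assoc (𝟙 (x ≟ a)) (𝟙 (xs ≟ᵛ as)) _)) ⟩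
  ∑ (λ x → ∑ᵛ m λ xs → 𝟙 (x ≟ a) * (𝟙 (xs ≟ᵛ as) * f (x ∷ xs)))
    ≡⟨ sum-cong-≗ (λ x → trans (∑ᵛ-*ˡ m (𝟙 (x ≟ a)) λ xs → 𝟙 (xs ≟ᵛ as) * f (x ∷ xs)) (cong (𝟙 (x ≟ a) *_) (∑ᵛ-δ m as λ xs → f (x ∷ xs)))) ⟩
  ∑ (λ x → 𝟙 (x ≟ a) * f (x ∷ as))
    ≡⟨ ∑-δ a (λ x → f (x ∷ as)) ⟩
  f (a ∷ as) ∎
  where open ≡-Reasoning

term≤∑ᵛ : ∀ m (f : Vec (Fin n) m → ℕ) x → f x ≤ ∑ᵛ m f
term≤∑ᵛ zero    f []       = ≤-refl
term≤∑ᵛ (suc m) f (x ∷ xs) = ≤-trans (term≤∑ᵛ m (λ ys → f (x ∷ ys)) xs) (term≤∑ (λ y → ∑ᵛ m λ ys → f (y ∷ ys)) x)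

∑ᵛ-pos⇒∃ : ∀ m (f : Vec (Fin n) m → ℕ) → 0 < ∑ᵛ m f → ∃[ x ] 0 < f x
∑ᵛ-pos⇒∃ zero    f 0<∑ = [] , 0<∑
∑ᵛ-pos⇒∃ (suc m) f 0<∑ = let x , 0<∑ₓ = ∑-pos⇒∃ _ 0<∑ ; xs , 0<f = ∑ᵛ-pos⇒∃ m _ 0<∑ₓ in x ∷ xs , 0<f

∑ᵛ-unique≤1 : ∀ m (f : Vec (Fin n) m → ℕ) → (∀ x → f x ≤ 1) → (∀ x y → 0 < f x → 0 < f y → x ≡ y) → ∑ᵛ m f ≤ 1
∑ᵛ-unique≤1 m f f≤1 unique with 0 <? ∑ᵛ m f
... | no ∑≯0  = ≤-trans (≮⇒≥ ∑≯0) z≤n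
... | yes 0<∑ with ∑ᵛ-pos⇒∃ m f 0<∑
...   | a , 0<fa = ≤-trans (∑ᵛ-mono m (λ x → bound x (x ≟ᵛ a))) (≤-reflexive (∑ᵛ-δ m a λ _ → 1))
  where
  bound : ∀ x (d : Dec (x ≡ a)) → f x ≤ 𝟙 d * 1
  bound x (yes _)   = f≤1 x
  bound x (no x≢a)  = ≮⇒≥ λ 0<fx → x≢a (unique x a 0<fx 0<fa)

∑ᵛ-𝟙-injection : ∀ m {p} m′ {P : Vec (Fin n) m → Set} {Q : Vec (Fin p) m′ → Set} (P? : Decidable P) (Q? : Decidable Q) →
  (g : ∀ x → P x → Vec (Fin p) m′) → (∀ x px → Q (g x px)) → (∀ x x′ px px′ → g x px ≡ g x′ px′ → x ≡ x′) →
  ∑ᵛ m (𝟙 ∘ P?) ≤ ∑ᵛ m′ (𝟙 ∘ Q?)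
∑ᵛ-𝟙-injection m m′ {P} {Q} P? Q? g g∈Q g-injective = begin
  ∑ᵛ m (𝟙 ∘ P?)                                                ≤⟨ ∑ᵛ-mono m (λ x → maps-into-Q x (P? x)) ⟩
  ∑ᵛ m (λ x → ∑ᵛ m′ λ y → 𝟙 (Q? y) * maps-to x (P? x) y)         ≡⟨ ∑ᵛ-comm m m′ (λ x y → 𝟙 (Q? y) * maps-to x (P? x) y) ⟩
  ∑ᵛ m′ (λ y → ∑ᵛ m λ x → 𝟙 (Q? y) * maps-to x (P? x) y)         ≡⟨ ∑ᵛ-cong m′ (λ y → ∑ᵛ-*ˡ m (𝟙 (Q? y)) λ x → maps-to x (P? x) y) ⟩
  ∑ᵛ m′ (λ y → 𝟙 (Q? y) * ∑ᵛ m λ x → maps-to x (P? x) y)         ≤⟨ ∑ᵛ-mono m′ (λ y → *-monoʳ-≤ (𝟙 (Q? y)) (at-most-once y)) ⟩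
  ∑ᵛ m′ (λ y → 𝟙 (Q? y) * 1)                                   ≡⟨ ∑ᵛ-cong m′ (λ y → *-identityʳ (𝟙 (Q? y))) ⟩
  ∑ᵛ m′ (𝟙 ∘ Q?)                                               ∎
  where
  open ≤-Reasoning
  maps-to : ∀ x → Dec (P x) → Vec (Fin _) m′ → ℕ
  maps-to x (yes px) y = 𝟙 (y ≟ᵛ g x px)
  maps-to x (no _)   y = 0
  maps-into-Q : ∀ x (d : Dec (P x)) → 𝟙 d ≤ ∑ᵛ m′ λ y → 𝟙 (Q? y) * maps-to x d y
  maps-into-Q x (no _)   = z≤n
  maps-into-Q x (yes px) = ≤-reflexive (sym (trans (∑ᵛ-cong m′ λ y → *-comm (𝟙 (Q? y)) (𝟙 (y ≟ᵛ g x px)))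
    (trans (∑ᵛ-δ m′ (g x px) (𝟙 ∘ Q?)) (𝟙-yes (Q? (g x px)) (g∈Q x px)))))
  at-most-once : ∀ y → ∑ᵛ m (λ x → maps-to x (P? x) y) ≤ 1
  at-most-once y = ∑ᵛ-unique≤1 m _ (λ x → ≤1 x (P? x)) λ x x′ → unique x x′ (P? x) (P? x′)
    where
    ≤1 : ∀ x (d : Dec (P x)) → maps-to x d y ≤ 1
    ≤1 x (yes px) = 𝟙≤1 (y ≟ᵛ g x px)
    ≤1 x (no _)   = z≤n
    unique : ∀ x x′ (d : Dec (P x)) (d′ : Dec (P x′)) → 0 < maps-to x d y → 0 < maps-to x′ d′ y → x ≡ x′
    unique x x′ (yes px) (yes px′) h h′ = g-injective x x′ px px′ (trans (sym (𝟙-pos⁻¹ (y ≟ᵛ g x px) h)) (𝟙-pos⁻¹ (y ≟ᵛ g x′ px′) h′))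

_⇔-dec_ : {A B : Set} → Dec A → Dec B → Dec (A ⇔ B)
a? ⇔-dec b? = map′ (λ (f , g) → mk⇔ f g) (λ e → Equivalence.to e , Equivalence.from e) ((a? →-dec b?) ×-dec (b? →-dec a?))

injective? : Decidable {A = Fin n → Fin k} (Injective _≡_ _≡_)
injective? f = map′ (λ inj {i} {j} → inj i j) (λ inj i j → inj {i} {j}) (all? λ i → all? λ j → (f i ≟ f j) →-dec (i ≟ j))

record IsIso (H : Graph m) (V : Fin n → Set) (E : Rel (Fin n) 0ℓ) (φ : Fin m → Fin n) : Set where
  constructor isIso
  field
    φ-injective : Injective _≡_ _≡_ φ
    φ-onto      : ∀ v → V v ⇔ (∃[ i ] φ i ≡ v)
    φ-edges     : ∀ i j → Adj H i j ⇔ E (φ i) (φ j)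

IsIsoᴳ : Graph m → Graph n → (Fin m → Fin n) → Set
IsIsoᴳ H G = IsIso H (λ _ → ⊤) (Adj G)

module _ {n : ℕ} {V : Fin n → Set} {E : Rel (Fin n) 0ℓ} where

  open Equivalence

  isIso? : (H : Graph m) → Decidable V → (∀ u v → Dec (E u v)) → Decidable (IsIso H V E)
  isIso? H V? E? φ =
    map′ (λ (injective , onto , edges) → isIso injective onto edges) (λ (isIso injective onto edges) → (λ {_ _} → injective) , onto , edges)
    (injective? φ ×-dec
     all? (λ v → V? v ⇔-dec any? λ i → φ i ≟ v) ×-dec
     all? (λ i → all? λ j → adj? H i j ⇔-dec E? (φ i) (φ j)))

  isIso-resp-≗ : (H : Graph m) {φ ψ : Fin m → Fin n} → φ ≗ ψ → IsIso H V E φ → IsIso H V E ψ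
  isIso-resp-≗ H φ≗ψ (isIso injective onto edges) = isIso
    (λ {i} {j} e → injective (trans (φ≗ψ i) (trans e (sym (φ≗ψ j)))))
    (λ v → mk⇔ (λ v∈ → let i , e = to (onto v) v∈ in i , trans (sym (φ≗ψ i)) e) (λ (i , e) → from (onto v) (i , trans (φ≗ψ i) e)))
    (λ i j → subst₂ (λ a b → Adj H i j ⇔ E a b) (φ≗ψ i) (φ≗ψ j) (edges i j))

  isIso-∘ : (H : Graph m) (K : Graph k) {φ : Fin m → Fin n} {π : Fin k → Fin m} → IsIso H V E φ → IsIsoᴳ K H π → IsIso K V E (φ ∘ π)
  isIso-∘ H K {φ} {π} (isIso φ-injective φ-onto φ-edges) (isIso π-injective π-onto π-edges) = isIso
    (π-injective ∘ φ-injective)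
    (λ v → mk⇔ (λ v∈ → let i , φi≡v = to (φ-onto v) v∈ ; a , πa≡i = to (π-onto i) tt in a , trans (cong φ πa≡i) φi≡v)
               (λ (a , e) → from (φ-onto v) (π a , e)))
    (λ a b → mk⇔ (to (φ-edges (π a) (π b)) ∘ to (π-edges a b)) (from (π-edges a b) ∘ from (φ-edges (π a) (π b))))

  isIso-factor : (H : Graph m) (K : Graph k) {φ : Fin m → Fin n} {ψ : Fin k → Fin n} → IsIso H V E φ → IsIso K V E ψ →
    ∃[ π ] (IsIsoᴳ K H π × φ ∘ π ≗ ψ)
  isIso-factor H K {φ} {ψ} (isIso φ-injective φ-onto φ-edges) (isIso ψ-injective ψ-onto ψ-edges) =
    (λ a → proj₁ (lift a)) , isIso injective onto edges , (λ a → proj₂ (lift a))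
    where
    lift : ∀ a → ∃[ i ] φ i ≡ ψ a
    lift a = to (φ-onto (ψ a)) (from (ψ-onto (ψ a)) (a , refl))
    injective : ∀ {a b} → proj₁ (lift a) ≡ proj₁ (lift b) → a ≡ b
    injective {a} {b} e = ψ-injective (trans (sym (proj₂ (lift a))) (trans (cong φ e) (proj₂ (lift b))))
    onto : ∀ i → ⊤ ⇔ (∃[ a ] proj₁ (lift a) ≡ i)
    onto i =
      mk⇔ (λ _ → let a , ψa≡φi = to (ψ-onto (φ i)) (from (φ-onto (φ i)) (i , refl)) in a , φ-injective (trans (proj₂ (lift a)) ψa≡φi)) (λ _ → tt)
    edges : ∀ a b → Adj K a b ⇔ Adj H (proj₁ (lift a)) (proj₁ (lift b))
    edges a b = mk⇔
      (λ ab → from (φ-edges _ _) (subst₂ E (sym (proj₂ (lift a))) (sym (proj₂ (lift b))) (to (ψ-edges a b) ab)))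
      (λ ij → from (ψ-edges a b) (subst₂ E (proj₂ (lift a)) (proj₂ (lift b)) (to (φ-edges _ _) ij)))

isIsoᴳ? : (H : Graph m) (G : Graph n) → Decidable (IsIsoᴳ H G)
isIsoᴳ? H G = isIso? H (λ _ → yes tt) (adj? G)

isIsoᴳ-id : (H : Graph m) → IsIsoᴳ H H id
isIsoᴳ-id H = isIso id (λ v → mk⇔ (λ _ → v , refl) (λ _ → tt)) (λ i j → mk⇔ id id)

automorphisms : Graph m → ℕ
automorphisms {m} H = ∑ᵛ m λ s → 𝟙 (isIsoᴳ? H H (lookup s))

automorphisms-pos : (H : Graph m) → 0 < automorphisms H
automorphisms-pos {m} H = ≤-trans
  (≤-reflexive (sym (𝟙-yes (isIsoᴳ? H H (lookup ids)) (isIso-resp-≗ H (λ i → sym (lookup∘tabulate id i)) (isIsoᴳ-id H)))))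
  (term≤∑ᵛ m (λ s → 𝟙 (isIsoᴳ? H H (lookup s))) ids)
  where
  ids : Vec (Fin m) m
  ids = tabulateᵛ id

isomorphisms≡automorphisms : (H : Graph m) {V : Fin n → Set} {E : Rel (Fin n) 0ℓ} (V? : Decidable V) (E? : ∀ u v → Dec (E u v)) {φ : Fin m → Fin n} →
  IsIso H V E φ → ∑ᵛ m (λ x → 𝟙 (isIso? H V? E? (lookup x))) ≡ automorphisms H
isomorphisms≡automorphisms {m} H {V} {E} V? E? {φ} iso = ≤-antisym
  (∑ᵛ-𝟙-injection m m (λ x → isIso? H V? E? (lookup x)) (λ s → isIsoᴳ? H H (lookup s)) quotient quotient-iso quotient-injective)
  (∑ᵛ-𝟙-injection m m (λ s → isIsoᴳ? H H (lookup s)) (λ x → isIso? H V? E? (lookup x)) (λ s _ → map φ s)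
    (λ s σ → isIso-resp-≗ H (λ i → sym (Vecₚ.lookup-map i φ s)) (isIso-∘ H H iso σ))
    (λ s s′ _ _ e → Pointwise-≡⇒≡ (ext λ i → IsIso.φ-injective iso
      (trans (sym (Vecₚ.lookup-map i φ s)) (trans (cong (λ x → lookup x i) e) (Vecₚ.lookup-map i φ s′))))))
  where
  quotient : ∀ x → IsIso H V E (lookup x) → Vec (Fin m) m
  quotient x ψ = tabulateᵛ (proj₁ (isIso-factor H H iso ψ))
  quotient-iso : ∀ x (ψ : IsIso H V E (lookup x)) → IsIsoᴳ H H (lookup (quotient x ψ))
  quotient-iso x ψ = let π , π-iso , _ = isIso-factor H H iso ψ in isIso-resp-≗ H (λ i → sym (lookup∘tabulate π i)) π-iso
  recover : ∀ x (ψ : IsIso H V E (lookup x)) i → φ (lookup (quotient x ψ) i) ≡ lookup x i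
  recover x ψ i = let π , _ , φ∘π≗ψ = isIso-factor H H iso ψ in trans (cong φ (lookup∘tabulate π i)) (φ∘π≗ψ i)
  quotient-injective : ∀ x x′ (ψ : IsIso H V E (lookup x)) (ψ′ : IsIso H V E (lookup x′)) → quotient x ψ ≡ quotient x′ ψ′ → x ≡ x′
  quotient-injective x x′ ψ ψ′ e = Pointwise-≡⇒≡ (ext λ i → trans (sym (recover x ψ i)) (trans (cong (λ s → φ (lookup s i)) e) (recover x′ ψ′ i)))

IsEmbedding : Graph m → Graph n → (Fin m → Fin n) → Set
IsEmbedding H G φ = Injective _≡_ _≡_ φ × (∀ i j → Adj H i j → Adj G (φ i) (φ j))

isEmbedding? : (H : Graph m) (G : Graph n) → Decidable (IsEmbedding H G)
isEmbedding? H G φ = injective? φ ×-dec all? λ i → all? λ j → adj? H i j →-dec adj? G (φ i) (φ j)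

embeddingCount : Graph m → Graph n → ℕ
embeddingCount {m} H G = ∑ᵛ m λ x → 𝟙 (isEmbedding? H G (lookup x))

∈-tabulate : {P : Fin n → Set} (P? : Decidable P) (v : Fin n) → v ∈ tabulateᵛ (does ∘ P?) ⇔ P v
∈-tabulate P? v = mk⇔
  (λ v∈ → does-true⇒ (P? v) (trans (sym (lookup∘tabulate (does ∘ P?) v)) ([]=⇒lookup v∈)))
  (λ p → lookup⇒[]= v _ (trans (lookup∘tabulate (does ∘ P?) v) (dec-true (P? v) p)))
  where
  does-true⇒ : {P : Set} (d : Dec P) → does d ≡ true → P
  does-true⇒ (yes p) _ = p

module _ {m n : ℕ} (H : Graph m) (φ : Fin m → Fin n) where

  open Equivalence

  ImageVertex : Fin n → Set
  ImageVertex v = ∃[ i ] φ i ≡ v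

  ImageEdge : Fin n → Fin n → Set
  ImageEdge u v = ∃[ i ] ∃[ j ] (φ i ≡ u × φ j ≡ v × Adj H i j)

  imageVertex? : Decidable ImageVertex
  imageVertex? v = any? λ i → φ i ≟ v

  imageEdge? : ∀ u → Decidable (ImageEdge u)
  imageEdge? u v = any? λ i → any? λ j → (φ i ≟ u) ×-dec (φ j ≟ v) ×-dec adj? H i j

  image : SubgraphData n
  image = tabulateᵛ (does ∘ imageVertex?) , tabulateᵛ λ u → tabulateᵛ (does ∘ imageEdge? u)

  image-vertices : ∀ v → InVertices image v ⇔ ImageVertex v
  image-vertices = ∈-tabulate imageVertex?

  image-edges : ∀ u v → InEdges image u v ⇔ ImageEdge u v
  image-edges u v =
    subst (λ row → v ∈ row ⇔ ImageEdge u v) (sym (lookup∘tabulate (λ u → tabulateᵛ (does ∘ imageEdge? u)) u)) (∈-tabulate (imageEdge? u) v)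

  ≡image : (S : SubgraphData n) → (∀ v → InVertices S v ⇔ ImageVertex v) → (∀ u v → InEdges S u v ⇔ ImageEdge u v) → S ≡ image
  ≡image S vertices edges = cong₂ _,_
    (⊆-antisym (λ {v} → from (image-vertices v) ∘ to (vertices v)) (λ {v} → from (vertices v) ∘ to (image-vertices v)))
    (Pointwise-≡⇒≡ (ext λ u → ⊆-antisym (λ {v} → from (image-edges u v) ∘ to (edges u v)) (λ {v} → from (edges u v) ∘ to (image-edges u v))))

Parametrises : Graph m → Graph n → SubgraphData n → (Fin m → Fin n) → Set
Parametrises H G S φ = IsSubgraph G S × IsIso H (InVertices S) (InEdges S) φ

parametrises⇔ : (H : Graph m) (G : Graph n) (S : SubgraphData n) (φ : Fin m → Fin n) →
  Parametrises H G S φ ⇔ (S ≡ image H φ × IsEmbedding H G φ)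
parametrises⇔ H G S φ = mk⇔ to-embedding from-embedding
  where
  open Equivalence
  to-embedding : Parametrises H G S φ → S ≡ image H φ × IsEmbedding H G φ
  to-embedding (subgraph , isIso injective vertices edges) =
    ≡image H φ S vertices (λ u v → mk⇔ (image-edge u v) λ { (i , j , refl , refl , ij) → to (edges i j) ij }) ,
    injective , λ i j ij → let _ , uv , _ = subgraph _ _ (to (edges i j) ij) in uv
    where
    image-edge : ∀ u v → InEdges S u v → ImageEdge H φ u v
    image-edge u v uv with subgraph u v uv
    ... | _ , _ , u∈ , v∈ with to (vertices u) u∈ | to (vertices v) v∈
    ...   | i , refl | j , refl = i , j , refl , refl , from (edges i j) uv
  from-embedding : S ≡ image H φ × IsEmbedding H G φ → Parametrises H G S φ
  from-embedding (refl , injective , preserves) = subgraph , isIso injective (image-vertices H φ)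
    (λ i j → mk⇔ (λ ij → from (image-edges H φ _ _) (i , j , refl , refl , ij)) (edge i j))
    where
    subgraph : IsSubgraph G (image H φ)
    subgraph u v uv with to (image-edges H φ u v) uv
    ... | i , j , refl , refl , ij = from (image-edges H φ _ _) (j , i , refl , refl , symm H ij) , preserves i j ij ,
      from (image-vertices H φ _) (i , refl) , from (image-vertices H φ _) (j , refl)
    edge : ∀ i j → InEdges (image H φ) (φ i) (φ j) → Adj H i j
    edge i j uv with to (image-edges H φ _ _) uv
    ... | i′ , j′ , ei , ej , ij with injective ei | injective ej
    ...   | refl | refl = ij

copy⇒embedding : (H : Graph m) (G : Graph n) (S : SubgraphData n) → IsCopy H G S → ∃[ φ ] IsEmbedding H G φ
copy⇒embedding H G S (subgraph , mkIso φ injective vertices edges) =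
  φ , proj₂ (Equivalence.to (parametrises⇔ H G S φ) (subgraph , isIso injective vertices edges))

free⇒¬embedding : (F : Graph m) (G : Graph n) → G IsFree F → ∀ φ → ¬ IsEmbedding F G φ
free⇒¬embedding F G free φ embedding with Equivalence.from (parametrises⇔ F G (image F φ) φ) (refl , embedding)
... | subgraph , isIso injective vertices edges = free (image F φ , subgraph , mkIso φ injective vertices edges)

isSubgraph? : (G : Graph n) → Decidable (IsSubgraph G)
isSubgraph? G (V , E) = all? λ u → all? λ v → (v ∈? lookup E u) →-dec ((u ∈? lookup E v) ×-dec adj? G u v ×-dec (u ∈? V) ×-dec (v ∈? V))

parametrises? : (H : Graph m) (G : Graph n) (S : SubgraphData n) → Decidable (Parametrises H G S)
parametrises? H G S@(V , E) φ = isSubgraph? G S ×-dec isIso? H (_∈? V) (λ u v → v ∈? lookup E u) φ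

-- Double counting of the pairs (copy of H, parametrisation of it by H).
𝓝*automorphisms : (H : Graph m) (G : Graph n) → 𝓝 H G * automorphisms H ≡ embeddingCount H G
𝓝*automorphisms {m} {n} H G = begin
  𝓝 H G * automorphisms H                                                    ≡⟨ cong (_* automorphisms H) (length-filter (isCopy? H G) all) ⟩
  ∑ᴸ (𝟙 ∘ isCopy? H G) all * automorphisms H                                 ≡⟨ ∑ᴸ-*ʳ (𝟙 ∘ isCopy? H G) (automorphisms H) all ⟨
  ∑ᴸ (λ S → 𝟙 (isCopy? H G S) * automorphisms H) all                         ≡⟨ ∑ᴸ-cong (λ S → parametrisations S (isCopy? H G S)) all ⟩
  ∑ᴸ (λ S → ∑ᵛ m λ x → 𝟙 (parametrises? H G S (lookup x))) all              ≡⟨ ∑ᵛ-∑ᴸ m (λ x S → 𝟙 (parametrises? H G S (lookup x))) all ⟨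
  ∑ᵛ m (λ x → ∑ᴸ (λ S → 𝟙 (parametrises? H G S (lookup x))) all)            ≡⟨ ∑ᵛ-cong m (λ x → trans (∑ᴸ-cong (λ S → parametrised-image S x) all)
                                                                                  (enumerates-δ (enumerates-subgraphs n) (image H (lookup x)) (𝟙 (isEmbedding? H G (lookup x))))) ⟩
  embeddingCount H G                                                         ∎
  where
  open ≡-Reasoning
  open Equivalence
  all = allSubgraphData n
  parametrised-image : ∀ S x → 𝟙 (parametrises? H G S (lookup x)) ≡ 𝟙 (S ≟ˢ image H (lookup x)) * 𝟙 (isEmbedding? H G (lookup x))
  parametrised-image S x = trans
    (𝟙-cong (parametrises? H G S (lookup x)) (S ≟ˢ image H (lookup x) ×-dec isEmbedding? H G (lookup x)) (to (parametrises⇔ H G S _)) (from (parametrises⇔ H G S _)))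
    (𝟙-× (S ≟ˢ image H (lookup x)) (isEmbedding? H G (lookup x)))
  parametrisations : ∀ S (d : Dec (IsCopy H G S)) → 𝟙 d * automorphisms H ≡ ∑ᵛ m λ x → 𝟙 (parametrises? H G S (lookup x))
  parametrisations S (no ¬copy) = sym (∑ᵛ-zero m λ x → 𝟙-no (parametrises? H G S (lookup x))
    λ (subgraph , isIso injective vertices edges) → ¬copy (subgraph , mkIso (lookup x) injective vertices edges))
  parametrisations S@(V , E) (yes (subgraph , mkIso φ injective vertices edges)) = begin
    1 * automorphisms H                                      ≡⟨ *-identityˡ _ ⟩
    automorphisms H
      ≡⟨ isomorphisms≡automorphisms H (_∈? V) (λ u v → v ∈? lookup E u) (isIso injective vertices edges) ⟨
    ∑ᵛ m (λ x → 𝟙 (isIso? H (_∈? V) (λ u v → v ∈? lookup E u) (lookup x)))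
      ≡⟨ ∑ᵛ-cong m (λ x → 𝟙-cong (isIso? H (_∈? V) (λ u v → v ∈? lookup E u) (lookup x)) (parametrises? H G S (lookup x)) (subgraph ,_) proj₂) ⟩
    ∑ᵛ m (λ x → 𝟙 (parametrises? H G S (lookup x)))          ∎

𝓝-mono : (H : Graph m) (G G′ : Graph n) → embeddingCount H G ≤ embeddingCount H G′ → 𝓝 H G ≤ 𝓝 H G′
𝓝-mono H G G′ le = *-cancelʳ-≤ _ _ (automorphisms H) {{>-nonZero (automorphisms-pos H)}}
  (subst₂ _≤_ (sym (𝓝*automorphisms H G)) (sym (𝓝*automorphisms H G′)) le)

𝓝-iso : (H : Graph m) (K : Graph k) {π : Fin k → Fin m} → IsIsoᴳ K H π → (G : Graph n) → 𝓝 H G ≡ 𝓝 K G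
𝓝-iso {n = n} H K {π} π-iso G =
  cong length (filter-≐ (isCopy? H G) (isCopy? K G) ((λ {S} → transport H K π-iso S) , (λ {S} → transport K H π⁻¹-iso S)) (allSubgraphData n))
  where
  π⁻¹-iso : IsIsoᴳ H K _
  π⁻¹-iso = proj₁ (proj₂ (isIso-factor K H π-iso (isIsoᴳ-id H)))
  transport : ∀ {p q} (H : Graph p) (K : Graph q) {π : Fin q → Fin p} → IsIsoᴳ K H π → ∀ S → IsCopy H G S → IsCopy K G S
  transport H K {π} π-iso S (subgraph , mkIso φ injective vertices edges) with isIso-∘ {E = InEdges S} H K {φ} {π} (isIso injective vertices edges) π-iso
  ... | isIso injective′ vertices′ edges′ = subgraph , mkIso (φ ∘ π) injective′ vertices′ edges′

-- Linear forests

Step : Vec Bool m → Fin (suc m) → Fin (suc m) → Set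
Step []       _       _             = ⊥
Step (b ∷ bs) zero    zero          = ⊥
Step (b ∷ bs) zero    (suc zero)    = b ≡ true
Step (b ∷ bs) zero    (suc (suc _)) = ⊥
Step (b ∷ bs) (suc i) zero          = ⊥
Step (b ∷ bs) (suc i) (suc j)       = Step bs i j

step? : (bs : Vec Bool m) (i j : Fin (suc m)) → Dec (Step bs i j)
step? []       _       _             = no λ ()
step? (b ∷ bs) zero    zero          = no λ ()
step? (b ∷ bs) zero    (suc zero)    = b Boolₚ.≟ true
step? (b ∷ bs) zero    (suc (suc _)) = no λ ()
step? (b ∷ bs) (suc i) zero          = no λ ()
step? (b ∷ bs) (suc i) (suc j)       = step? bs i j

step-irrefl : (bs : Vec Bool m) (i : Fin (suc m)) → ¬ Step bs i i
step-irrefl (b ∷ bs) (suc i) = step-irrefl bs i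

forest : Vec Bool m → Graph (suc m)
forest bs = record
  { Adj    = λ i j → Step bs i j ⊎ Step bs j i
  ; adj?   = λ i j → step? bs i j ⊎-dec step? bs j i
  ; symm   = swap
  ; irrefl = [ step-irrefl bs _ , step-irrefl bs _ ]′
  }

occ≡0⇔ : (v : Fin n) (x : Vec (Fin n) m) → occ v x ≡ 0 ⇔ (∀ i → lookup x i ≢ v)
occ≡0⇔ v []       = mk⇔ (λ _ ()) (λ _ → refl)
occ≡0⇔ v (x ∷ xs) = mk⇔ (to′ (x ≟ v)) λ ≢v → cong₂ _+_ (𝟙-no (x ≟ v) (≢v zero)) (from (occ≡0⇔ v xs) (≢v ∘ suc))
  where
  open Equivalence
  to′ : (d : Dec (x ≡ v)) → 𝟙 d + occ v xs ≡ 0 → ∀ i → lookup (x ∷ xs) i ≢ v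
  to′ (no x≢v) occ≡0 zero    = x≢v
  to′ (no _)   occ≡0 (suc i) = to (occ≡0⇔ v xs) occ≡0 i

distinct≡𝟙-injective : (x : Vec (Fin n) m) → distinct x ≡ 𝟙 (injective? (lookup x))
distinct≡𝟙-injective {n} []   = sym (𝟙-yes (injective? (lookup {A = Fin n} [])) λ {})
distinct≡𝟙-injective (x ∷ xs) = begin
  absent x xs * distinct xs                                    ≡⟨ cong (absent x xs *_) (distinct≡𝟙-injective xs) ⟩
  absent x xs * 𝟙 (injective? (lookup xs))                     ≡⟨ 𝟙-× (occ x xs ≟ℕ 0) (injective? (lookup xs)) ⟨
  𝟙 ((occ x xs ≟ℕ 0) ×-dec injective? (lookup xs))
    ≡⟨ 𝟙-cong ((occ x xs ≟ℕ 0) ×-dec injective? (lookup xs)) (injective? (lookup (x ∷ xs))) extend restrict ⟩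
  𝟙 (injective? (lookup (x ∷ xs)))                            ∎
  where
  open ≡-Reasoning
  open Equivalence (occ≡0⇔ x xs)
  extend : occ x xs ≡ 0 × Injective _≡_ _≡_ (lookup xs) → Injective _≡_ _≡_ (lookup (x ∷ xs))
  extend (absent , _)   {zero}  {zero}  _ = refl
  extend (absent , _)   {zero}  {suc j} e = contradiction (sym e) (to absent j)
  extend (absent , _)   {suc i} {zero}  e = contradiction e (to absent i)
  extend (_ , injective) {suc i} {suc j} e = cong suc (injective e)
  restrict : Injective _≡_ _≡_ (lookup (x ∷ xs)) → occ x xs ≡ 0 × Injective _≡_ _≡_ (lookup xs)
  restrict injective = from (λ i e → 0≢1+n (sym (cong toℕ (injective {suc i} {zero} e)))) , λ e → suc-injective (injective e)

module _ (G : Graph n) where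

  FollowsSteps : (bs : Vec Bool m) → Vec (Fin n) (suc m) → Set
  FollowsSteps bs x = ∀ i j → Step bs i j → Adj G (lookup x i) (lookup x j)

  followsSteps? : (bs : Vec Bool m) → Decidable (FollowsSteps bs)
  followsSteps? bs x = all? λ i → all? λ j → step? bs i j →-dec adj? G (lookup x i) (lookup x j)

  followsSteps-false⇔ : (bs : Vec Bool m) {x y : Fin n} {xs : Vec (Fin n) m} →
    FollowsSteps bs (y ∷ xs) ⇔ FollowsSteps (false ∷ bs) (x ∷ y ∷ xs)
  followsSteps-false⇔ bs {x} {y} {xs} = mk⇔ extend λ follows i j → follows (suc i) (suc j)
    where
    extend : FollowsSteps bs (y ∷ xs) → FollowsSteps (false ∷ bs) (x ∷ y ∷ xs)
    extend follows zero    (suc zero)    ()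
    extend follows (suc i) (suc j)       s = follows i j s

  followsSteps-true⇔ : (bs : Vec Bool m) {x y : Fin n} {xs : Vec (Fin n) m} →
    (Adj G x y × FollowsSteps bs (y ∷ xs)) ⇔ FollowsSteps (true ∷ bs) (x ∷ y ∷ xs)
  followsSteps-true⇔ bs {x} {y} {xs} = mk⇔ extend λ follows → follows zero (suc zero) refl , λ i j → follows (suc i) (suc j)
    where
    extend : Adj G x y × FollowsSteps bs (y ∷ xs) → FollowsSteps (true ∷ bs) (x ∷ y ∷ xs)
    extend (xy , follows) zero    (suc zero) refl = xy
    extend (xy , follows) (suc i) (suc j)    s    = follows i j s

  hom≡𝟙-followsSteps : (bs : Vec Bool m) (x : Vec (Fin n) (suc m)) → hom G bs x ≡ 𝟙 (followsSteps? bs x)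
  hom≡𝟙-followsSteps []           x            = sym (𝟙-yes (followsSteps? [] x) λ i j ())
  hom≡𝟙-followsSteps (true ∷ bs)  (x ∷ y ∷ xs) = begin
    adjacency G x y * hom G bs (y ∷ xs)                    ≡⟨ cong (adjacency G x y *_) (hom≡𝟙-followsSteps bs (y ∷ xs)) ⟩
    adjacency G x y * 𝟙 (followsSteps? bs (y ∷ xs))        ≡⟨ 𝟙-× (adj? G x y) (followsSteps? bs (y ∷ xs)) ⟨
    𝟙 (adj? G x y ×-dec followsSteps? bs (y ∷ xs))
      ≡⟨ 𝟙-cong (adj? G x y ×-dec followsSteps? bs (y ∷ xs)) (followsSteps? (true ∷ bs) (x ∷ y ∷ xs)) to from ⟩
    𝟙 (followsSteps? (true ∷ bs) (x ∷ y ∷ xs))             ∎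
    where
    open ≡-Reasoning
    open Equivalence (followsSteps-true⇔ bs {x} {y} {xs})
  hom≡𝟙-followsSteps (false ∷ bs) (x ∷ y ∷ xs) = begin
    1 * hom G bs (y ∷ xs)                                  ≡⟨ *-identityˡ _ ⟩
    hom G bs (y ∷ xs)                                      ≡⟨ hom≡𝟙-followsSteps bs (y ∷ xs) ⟩
    𝟙 (followsSteps? bs (y ∷ xs))                          ≡⟨ 𝟙-cong (followsSteps? bs (y ∷ xs)) (followsSteps? (false ∷ bs) (x ∷ y ∷ xs)) to from ⟩
    𝟙 (followsSteps? (false ∷ bs) (x ∷ y ∷ xs))            ∎
    where
    open ≡-Reasoning
    open Equivalence (followsSteps-false⇔ bs {x} {y} {xs})

  embeddingCount-forest : (bs : Vec Bool m) → embeddingCount (forest bs) G ≡ embeddings G bs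
  embeddingCount-forest {m} bs = ∑ᵛ-cong (suc m) λ x → begin
    𝟙 (isEmbedding? (forest bs) G (lookup x))
      ≡⟨ 𝟙-cong (isEmbedding? (forest bs) G (lookup x)) (injective? (lookup x) ×-dec followsSteps? bs x)
                                                                        (λ (injective , preserves) → (λ {_ _} → injective) , λ i j s → preserves i j (inj₁ s))
                                                                        (λ (injective , follows) → (λ {_ _} → injective) , λ { i j (inj₁ s) → follows i j s ; i j (inj₂ s) → symm G (follows j i s) }) ⟩
    𝟙 (injective? (lookup x) ×-dec followsSteps? bs x)             ≡⟨ 𝟙-× (injective? (lookup x)) (followsSteps? bs x) ⟩
    𝟙 (injective? (lookup x)) * 𝟙 (followsSteps? bs x)             ≡⟨ cong₂ _*_ (distinct≡𝟙-injective x) (hom≡𝟙-followsSteps bs x) ⟨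
    distinct x * hom G bs x                                        ∎
    where open ≡-Reasoning

step-path⇔ : (i j : Fin (suc m)) → Step (replicate m true) i j ⇔ toℕ j ≡ suc (toℕ i)
step-path⇔ {zero}  zero    zero          = mk⇔ (λ ()) (λ ())
step-path⇔ {suc m} zero    zero          = mk⇔ (λ ()) (λ ())
step-path⇔ {suc m} zero    (suc zero)    = mk⇔ (λ _ → refl) (λ _ → refl)
step-path⇔ {suc m} zero    (suc (suc j)) = mk⇔ (λ ()) (λ ())
step-path⇔ {suc m} (suc i) zero          = mk⇔ (λ ()) (λ ())
step-path⇔ {suc m} (suc i) (suc j)       = mk⇔ (cong suc ∘ to) (from ∘ suc-injectiveℕ)
  where open Equivalence (step-path⇔ i j)

forest-path-iso : ∀ m → IsIsoᴳ (forest (replicate m true)) (path (suc m)) id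
forest-path-iso m = isIso id (λ v → mk⇔ (λ _ → v , refl) (λ _ → tt))
  λ i j → mk⇔ (map⊎ (to (step-path⇔ i j)) (to (step-path⇔ j i))) (map⊎ (from (step-path⇔ i j)) (from (step-path⇔ j i)))
  where open Equivalence

step-++ : ∀ {m′} (bs : Vec Bool m) (bs′ : Vec Bool m′) i j →
  Step (bs ++ᵛ false ∷ bs′) i j ⇔ Pointwise (Step bs) (Step bs′) (splitAt (suc m) i) (splitAt (suc m) j)
step-++ []       bs′ zero    zero          = mk⇔ (λ ()) λ { (inj₁ ()) }
step-++ []       bs′ zero    (suc zero)    = mk⇔ (λ ()) λ ()
step-++ []       bs′ zero    (suc (suc j)) = mk⇔ (λ ()) λ ()
step-++ []       bs′ (suc i) zero          = mk⇔ (λ ()) λ ()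
step-++ []       bs′ (suc i) (suc j)       = mk⇔ inj₂ λ { (inj₂ s) → s }
step-++ (b ∷ bs) bs′ zero    zero          = mk⇔ (λ ()) λ { (inj₁ ()) }
step-++ (b ∷ bs) bs′ zero    (suc zero)    = mk⇔ inj₁ λ { (inj₁ s) → s }
step-++ {suc m} (b ∷ bs) bs′ zero (suc (suc j)) with splitAt m j
... | inj₁ _ = mk⇔ (λ ()) λ { (inj₁ ()) }
... | inj₂ _ = mk⇔ (λ ()) λ ()
step-++ {suc m} (b ∷ bs) bs′ (suc i) zero with splitAt (suc m) i
... | inj₁ _ = mk⇔ (λ ()) λ { (inj₁ ()) }
... | inj₂ _ = mk⇔ (λ ()) λ ()
step-++ {suc m} (b ∷ bs) bs′ (suc i) (suc j) with splitAt (suc m) i | splitAt (suc m) j | step-++ bs bs′ i j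
... | inj₁ _ | inj₁ _ | ih = mk⇔ (λ s → case to ih s of λ { (inj₁ s) → inj₁ s }) λ { (inj₁ s) → from ih (inj₁ s) }
  where open Equivalence
... | inj₁ _ | inj₂ _ | ih = mk⇔ (λ s → case to ih s of λ ()) λ ()
  where open Equivalence
... | inj₂ _ | inj₁ _ | ih = mk⇔ (λ s → case to ih s of λ ()) λ ()
  where open Equivalence
... | inj₂ _ | inj₂ _ | ih = mk⇔ (λ s → case to ih s of λ { (inj₂ s) → inj₂ s }) λ { (inj₂ s) → from ih (inj₂ s) }
  where open Equivalence

module _ {m m′ n : ℕ} (bs : Vec Bool m) (bs′ : Vec Bool m′) {V V′ : Fin n → Set} {E : Rel (Fin n) 0ℓ} where

  open Equivalence

  isIso-union : {φ : Fin (suc m) → Fin n} {φ′ : Fin (suc m′) → Fin n} →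
    IsIso (forest bs) V E φ → IsIso (forest bs′) V′ E φ′ →
    (∀ {v} → V v → ¬ V′ v) → (∀ {u v} → V u → V′ v → ¬ E u v × ¬ E v u) →
    IsIso (forest (bs ++ᵛ false ∷ bs′)) (λ v → V v ⊎ V′ v) E ([ φ , φ′ ]′ ∘ splitAt (suc m))
  isIso-union {φ} {φ′} (isIso injective onto edges) (isIso injective′ onto′ edges′) disjoint separated =
    isIso (λ {i} {j} e → splitAt-injective i j (union-injective _ _ e)) union-onto
      λ i j → mk⇔ (to (union-edges _ _) ∘ map⊎ (to (step-++ bs bs′ i j)) (to (step-++ bs bs′ j i)))
                  (map⊎ (from (step-++ bs bs′ i j)) (from (step-++ bs bs′ j i)) ∘ from (union-edges _ _))
    where
    φ∪φ′ : Fin (suc m) ⊎ Fin (suc m′) → Fin n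
    φ∪φ′ = [ φ , φ′ ]′
    splitAt-injective : ∀ i j → splitAt (suc m) i ≡ splitAt (suc m) {suc m′} j → i ≡ j
    splitAt-injective i j e = trans (sym (join-splitAt (suc m) (suc m′) i)) (trans (cong (join (suc m) (suc m′)) e) (join-splitAt (suc m) (suc m′) j))
    inV : ∀ i → V (φ i)
    inV i = from (onto (φ i)) (i , refl)
    inV′ : ∀ i → V′ (φ′ i)
    inV′ i = from (onto′ (φ′ i)) (i , refl)
    union-injective : ∀ s t → φ∪φ′ s ≡ φ∪φ′ t → s ≡ t
    union-injective (inj₁ i) (inj₁ j) e = cong inj₁ (injective e)
    union-injective (inj₁ i) (inj₂ j) e = contradiction (subst V′ (sym e) (inV′ j)) (disjoint (inV i))
    union-injective (inj₂ i) (inj₁ j) e = contradiction (subst V′ e (inV′ i)) (disjoint (inV j))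
    union-injective (inj₂ i) (inj₂ j) e = cong inj₂ (injective′ e)
    union-onto : ∀ v → (V v ⊎ V′ v) ⇔ (∃[ i ] φ∪φ′ (splitAt (suc m) i) ≡ v)
    union-onto v = mk⇔ [ (λ v∈ → let i , e = to (onto v) v∈ in preimage (inj₁ i) e) , (λ v∈ → let i , e = to (onto′ v) v∈ in preimage (inj₂ i) e) ]′
      λ (i , e) → subst (λ v → V v ⊎ V′ v) e (covered (splitAt (suc m) i))
      where
      preimage : ∀ s → φ∪φ′ s ≡ v → ∃[ i ] φ∪φ′ (splitAt (suc m) i) ≡ v
      preimage s e = join (suc m) (suc m′) s , trans (cong φ∪φ′ (splitAt-join (suc m) (suc m′) s)) e
      covered : ∀ s → V (φ∪φ′ s) ⊎ V′ (φ∪φ′ s)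
      covered (inj₁ i) = inj₁ (inV i)
      covered (inj₂ i) = inj₂ (inV′ i)
    union-edges : ∀ s t → (Pointwise (Step bs) (Step bs′) s t ⊎ Pointwise (Step bs) (Step bs′) t s) ⇔ E (φ∪φ′ s) (φ∪φ′ t)
    union-edges (inj₁ i) (inj₁ j) = mk⇔ (λ { (inj₁ (inj₁ s)) → to (edges i j) (inj₁ s) ; (inj₂ (inj₁ s)) → to (edges i j) (inj₂ s) })
      (map⊎ inj₁ inj₁ ∘ from (edges i j))
    union-edges (inj₁ i) (inj₂ j) = mk⇔ (λ { (inj₁ ()) ; (inj₂ ()) }) λ e → contradiction e (proj₁ (separated (inV i) (inV′ j)))
    union-edges (inj₂ i) (inj₁ j) = mk⇔ (λ { (inj₁ ()) ; (inj₂ ()) }) λ e → contradiction e (proj₂ (separated (inV j) (inV′ i)))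
    union-edges (inj₂ i) (inj₂ j) = mk⇔ (λ { (inj₁ (inj₂ s)) → to (edges′ i j) (inj₁ s) ; (inj₂ (inj₂ s)) → to (edges′ i j) (inj₂ s) })
      (map⊎ inj₂ inj₂ ∘ from (edges′ i j))

module _ {h : ℕ} (H : Graph h) where

  Closed : (Fin h → Set) → Set
  Closed V = ∀ {u v} → V u → Adj H u v → V v

  record Layout : Set₁ where
    field
      {len}   : ℕ
      flags   : Vec Bool len
      Covered : Fin h → Set
      closed  : Closed Covered
      {place} : Fin (suc len) → Fin h
      placed  : IsIso (forest flags) Covered (Adj H) place

  open Layout

  open Equivalence

  component-layout : LinearForest H → (v : Fin h) → ∃[ L ] (Covered L v × (∀ {u} → Covered L u → Star (Adj H) v u))
  component-layout linear v with linear v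
  ... | zero  , mkIso φ injective onto edges = contradiction (proj₁ (to (onto v) ε)) ¬Fin0
  ... | suc ℓ , mkIso φ injective onto edges = record
    { flags   = replicate ℓ true
    ; Covered = Star (Adj H) v
    ; closed  = λ reach uw → reach ◅◅ (uw ◅ ε)
    ; placed  = isIso-∘ (path (suc ℓ)) (forest (replicate ℓ true)) (isIso injective onto edges) (forest-path-iso ℓ)
    } , ε , id

  covered? : (L : Layout) → Decidable (Covered L)
  covered? L v = map′ (from (φ-onto v)) (to (φ-onto v)) (any? λ i → place L i ≟ v)
    where open IsIso (placed L)

  extend : LinearForest H → (L : Layout) (v : Fin h) → ∃[ L′ ] ((∀ {u} → Covered L u → Covered L′ u) × Covered L′ v)
  extend linear L v with covered? L v
  ... | yes v∈ = L , id , v∈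
  ... | no v∉  = record
    { flags   = flags C ++ᵛ false ∷ flags L
    ; Covered = λ u → Covered C u ⊎ Covered L u
    ; closed  = λ { (inj₁ u∈) uw → inj₁ (closed C u∈ uw) ; (inj₂ u∈) uw → inj₂ (closed L u∈ uw) }
    ; placed  = isIso-union (flags C) (flags L) (placed C) (placed L) disjoint
        λ u∈C w∈L → (λ uw → disjoint (closed C u∈C uw) w∈L) , (λ wu → disjoint u∈C (closed L w∈L wu))
    } , inj₂ , inj₁ v∈C
    where
    component = component-layout linear v
    C   = proj₁ component
    v∈C = proj₁ (proj₂ component)
    closed-star : ∀ {u w} → Covered L u → Star (Adj H) u w → Covered L w
    closed-star u∈ ε          = u∈
    closed-star u∈ (uw ◅ ws)  = closed-star (closed L u∈ uw) ws
    disjoint : ∀ {u} → Covered C u → ¬ Covered L u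
    disjoint u∈C u∈L = v∉ (closed-star u∈L (reverse (symm H) (proj₂ (proj₂ component) u∈C)))

  cover : LinearForest H → (v : Fin h) (vs : List (Fin h)) → ∃[ L ] (∀ {u} → u ∈ᴸ v ∷ vs → Covered L u)
  cover linear v []       = let L , v∈ , _ = component-layout linear v in L , λ { (here refl) → v∈ }
  cover linear v (w ∷ vs) with cover linear w vs
  ... | L , covered with extend linear L v
  ...   | L′ , L⊆L′ , v∈ = L′ , λ { (here refl) → v∈ ; (there u∈) → L⊆L′ (covered u∈) }

linearForest-layout : (H : Graph (suc n)) → LinearForest H → ∃[ m ] Σ[ bs ∈ Vec Bool m ] ∃[ π ] IsIsoᴳ (forest bs) H π
linearForest-layout {n} H linear with cover H linear zero (tabulate suc)
... | L , covered = Layout.len L , Layout.flags L , Layout.place L ,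
  isIso φ-injective (λ v → mk⇔ (λ _ → to (φ-onto v) (covered (∈-allFin v))) (λ _ → tt)) φ-edges
  where
  open IsIso (Layout.placed L)
  open Equivalence

-- A linear forest without vertices has no flags, hence the first alternative.
𝓝-linearForest : (H : Graph k) → LinearForest H →
  (∀ {n} (G G′ : Graph n) → 𝓝 H G ≤ 𝓝 H G′) ⊎
  (∃[ m ] Σ[ bs ∈ Vec Bool m ] (∀ {n} (G G′ : Graph n) → embeddings G bs ≤ embeddings G′ bs → 𝓝 H G ≤ 𝓝 H G′))
𝓝-linearForest {zero}  H _ = inj₁ λ G G′ →
  𝓝-mono H G G′ (𝟙-mono (isEmbedding? H G (lookup [])) (isEmbedding? H G′ (lookup [])) λ _ → (λ {}) , λ ())
𝓝-linearForest {suc k} H linear with linearForest-layout H linear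
... | m , bs , π , iso = inj₂ (m , bs , λ G G′ le → subst₂ _≤_ (sym (𝓝-iso H (forest bs) iso G)) (sym (𝓝-iso H (forest bs) iso G′))
  (𝓝-mono (forest bs) G G′ (subst₂ _≤_ (sym (embeddingCount-forest G bs)) (sym (embeddingCount-forest G′ bs)) le)))

-- Complete multipartite graphs

P′-suc : ∀ a x → a P′ suc x ≡ a * (ℕ.pred a P′ x)
P′-suc zero    x = cong (_* (0 P′ x)) (0∸n≡0 x)
P′-suc (suc a) x = nP′k≡n[n∸1P′k∸1] (suc a) (suc x)

a<x⇒aP′x≡0 : ∀ {a x} → a < x → a P′ x ≡ 0
a<x⇒aP′x≡0 {a} {suc x} (s≤s a≤x) = cong (_* (a P′ x)) (m≤n⇒m∸n≡0 a≤x)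

suc-*-∸-exchange : ∀ {a b} x → b ≤ a → suc a * (b ∸ x) ≤ (a ∸ x) * suc b
suc-*-∸-exchange {a} {b} x b≤a with x ≤? b
... | no x≰b  = ≤-trans (≤-reflexive (trans (cong (suc a *_) (m≤n⇒m∸n≡0 (<⇒≤ (≰⇒> x≰b)))) (*-zeroʳ (suc a)))) z≤n
... | yes x≤b = begin
  suc a * (b ∸ x)                              ≡⟨ cong (λ t → suc t * (b ∸ x)) (m∸n+n≡m (≤-trans x≤b b≤a)) ⟨
  suc (a ∸ x + x) * (b ∸ x)                    ≡⟨ expandˡ (a ∸ x) (b ∸ x) x ⟩
  (a ∸ x) * (b ∸ x) + suc x * (b ∸ x)          ≤⟨ +-monoʳ-≤ ((a ∸ x) * (b ∸ x)) (*-monoʳ-≤ (suc x) (∸-monoˡ-≤ x b≤a)) ⟩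
  (a ∸ x) * (b ∸ x) + suc x * (a ∸ x)          ≡⟨ expandʳ (a ∸ x) (b ∸ x) x ⟨
  (a ∸ x) * suc (b ∸ x + x)                    ≡⟨ cong (λ t → (a ∸ x) * suc t) (m∸n+n≡m x≤b) ⟩
  (a ∸ x) * suc b                              ∎
  where
  open ≤-Reasoning
  expandˡ : ∀ p q x → suc (p + x) * q ≡ p * q + suc x * q
  expandˡ = solve-∀
  expandʳ : ∀ p q x → p * suc (q + x) ≡ p * q + suc x * p
  expandʳ = solve-∀

P′-product-mono : ∀ {a b} x → b ≤ a → (suc a P′ x) * (b P′ x) ≤ (a P′ x) * (suc b P′ x)
P′-product-mono zero    _   = ≤-refl
P′-product-mono {a} {b} (suc x) b≤a = begin
  (suc a P′ suc x) * ((b ∸ x) * (b P′ x))       ≡⟨ cong (_* ((b ∸ x) * (b P′ x))) (P′-suc (suc a) x) ⟩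
  suc a * (a P′ x) * ((b ∸ x) * (b P′ x))       ≡⟨ interchange (suc a) (a P′ x) (b ∸ x) (b P′ x) ⟩
  suc a * (b ∸ x) * ((a P′ x) * (b P′ x))       ≤⟨ *-monoˡ-≤ ((a P′ x) * (b P′ x)) (suc-*-∸-exchange x b≤a) ⟩
  (a ∸ x) * suc b * ((a P′ x) * (b P′ x))       ≡⟨ interchange (a ∸ x) (suc b) (a P′ x) (b P′ x) ⟩
  (a ∸ x) * (a P′ x) * (suc b * (b P′ x))       ≡⟨ cong ((a ∸ x) * (a P′ x) *_) (P′-suc (suc b) x) ⟨
  (a ∸ x) * (a P′ x) * (suc b P′ suc x)         ∎
  where open ≤-Reasoning

classSize : (Fin n → Fin k) → Fin k → ℕ
classSize col j = count λ v → col v ≟ j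

∑-fresh-of-colour : (col : Fin n → Fin k) (j : Fin k) (x : Vec (Fin n) m) →
  ∑ (λ v → 𝟙 (col v ≟ j) * (absent v x * distinct x)) ≡ (classSize col j ∸ occ j (map col x)) * distinct x
∑-fresh-of-colour col j x = begin
  ∑ fresh                                            ≡⟨ m+n∸n≡m (∑ fresh) (o * d) ⟨
  ∑ fresh + o * d ∸ o * d                            ≡⟨ cong (_∸ o * d) fresh-or-used ⟩
  classSize col j * d ∸ o * d                        ≡⟨ *-distribʳ-∸ d (classSize col j) o ⟨
  (classSize col j ∸ o) * d                          ∎
  where
  open ≡-Reasoning
  d = distinct x
  o = occ j (map col x)
  fresh : Fin _ → ℕ
  fresh v = 𝟙 (col v ≟ j) * (absent v x * d)
  collect : ∀ i a o d → i * (a * d) + i * o * d ≡ i * (d * (a + o))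
  collect = solve-∀
  fresh-or-used : ∑ fresh + o * d ≡ classSize col j * d
  fresh-or-used = begin
    ∑ fresh + o * d                                    ≡⟨ cong (λ t → ∑ fresh + t * d) (∑-occ-fibre col j x) ⟨
    ∑ fresh + ∑ (λ v → 𝟙 (col v ≟ j) * occ v x) * d    ≡⟨ cong (∑ fresh +_) (*-distribʳ-sum d λ v → 𝟙 (col v ≟ j) * occ v x) ⟩
    ∑ fresh + ∑ (λ v → 𝟙 (col v ≟ j) * occ v x * d)    ≡⟨ ∑-distrib-+ fresh _ ⟨
    ∑ (λ v → fresh v + 𝟙 (col v ≟ j) * occ v x * d)    ≡⟨ sum-cong-≗ (λ v → trans (collect (𝟙 (col v ≟ j)) (absent v x) (occ v x) d)
                                                            (cong (𝟙 (col v ≟ j) *_) (distinct-absent-or-once v x))) ⟩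
    ∑ (λ v → 𝟙 (col v ≟ j) * d)                        ≡⟨ ∑-*ʳ d (λ v → 𝟙 (col v ≟ j)) ⟩
    classSize col j * d                                ∎

-- The number of injective vertex sequences with prescribed colours, given the class sizes.
lifts : (Fin k → ℕ) → Vec (Fin k) m → ℕ
lifts s []      = 1
lifts s (j ∷ κ) = (s j ∸ occ j κ) * lifts s κ

lifts-cong : {s t : Fin k → ℕ} → s ≗ t → (κ : Vec (Fin k) m) → lifts s κ ≡ lifts t κ
lifts-cong s≗t []      = refl
lifts-cong s≗t (j ∷ κ) = cong₂ _*_ (cong (_∸ occ j κ) (s≗t j)) (lifts-cong s≗t κ)

∑ᵛ-by-colour : (col : Fin n → Fin k) (m : ℕ) (θ : Vec (Fin k) m → ℕ) →
  ∑ᵛ m (λ x → distinct x * θ (map col x)) ≡ ∑ᵛ m (λ κ → lifts (classSize col) κ * θ κ)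
∑ᵛ-by-colour col zero    θ = refl
∑ᵛ-by-colour {n} {k} col (suc m) θ = begin
  ∑ (λ v → ∑ᵛ m λ x → absent v x * distinct x * θ (col v ∷ map col x))
    ≡⟨ ∑ᵛ-∑ m (λ x v → absent v x * distinct x * θ (col v ∷ map col x)) ⟨
  ∑ᵛ m (λ x → ∑ λ v → absent v x * distinct x * θ (col v ∷ map col x))
    ≡⟨ ∑ᵛ-cong m (λ x → trans (∑-by-fibre col (λ v → absent v x * distinct x) λ j → θ (j ∷ map col x))
         (sum-cong-≗ λ j → trans (cong (_* θ (j ∷ map col x)) (∑-fresh-of-colour col j x)) (xy∙z≈y∙xz (free j (map col x)) (distinct x) _))) ⟩
  ∑ᵛ m (λ x → ∑ λ j → distinct x * (free j (map col x) * θ (j ∷ map col x)))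
    ≡⟨ ∑ᵛ-∑ m (λ x j → distinct x * (free j (map col x) * θ (j ∷ map col x))) ⟩
  ∑ (λ j → ∑ᵛ m λ x → distinct x * (free j (map col x) * θ (j ∷ map col x)))
    ≡⟨ sum-cong-≗ (λ j → ∑ᵛ-by-colour col m λ κ → free j κ * θ (j ∷ κ)) ⟩
  ∑ (λ j → ∑ᵛ m λ κ → lifts (classSize col) κ * (free j κ * θ (j ∷ κ)))
    ≡⟨ sum-cong-≗ (λ j → ∑ᵛ-cong m λ κ → x∙yz≈yx∙z (lifts (classSize col) κ) (free j κ) (θ (j ∷ κ))) ⟩
  ∑ (λ j → ∑ᵛ m λ κ → free j κ * lifts (classSize col) κ * θ (j ∷ κ)) ∎
  where
  open ≡-Reasoning
  free : Fin k → Vec (Fin k) m → ℕ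
  free j κ = classSize col j ∸ occ j κ

shiftˡ shiftʳ : (ℕ → ℕ → ℕ) → ℕ → ℕ → ℕ
shiftˡ g x y = g (suc x) y
shiftʳ g x y = g x (suc y)

-- (shiftˡ + shiftʳ) ^ r
spread : ℕ → (ℕ → ℕ → ℕ) → ℕ → ℕ → ℕ
spread zero    g = g
spread (suc r) g x y = spread r g (suc x) y + spread r g x (suc y)

spread-shift : ∀ r g x y → spread r (shiftˡ (shiftʳ g)) x y ≡ spread r g (suc x) (suc y)
spread-shift zero    g x y = refl
spread-shift (suc r) g x y = cong₂ _+_ (spread-shift r g (suc x) y) (spread-shift r g x (suc y))

spread-suc : ∀ r g x y → spread r (λ x y → shiftˡ g x y + shiftʳ g x y) x y ≡ spread (suc r) g x y
spread-suc zero    g x y = refl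
spread-suc (suc r) g x y = cong₂ _+_ (spread-suc r g (suc x) y) (spread-suc r g x (suc y))

fall₂ : ℕ → ℕ → ℕ → ℕ → ℕ
fall₂ a b x y = (a P′ x) * (b P′ y)

-- Vandermonde's identity for falling factorials.
spread-fall₂ : ∀ a b r x y → spread r (fall₂ a b) x y ≡ fall₂ a b x y * (((a ∸ x) + (b ∸ y)) P′ r)
spread-fall₂ a b zero    x y = sym (*-identityʳ _)
spread-fall₂ a b (suc r) x y = begin
  spread r (fall₂ a b) (suc x) y + spread r (fall₂ a b) x (suc y)
    ≡⟨ cong₂ _+_ (spread-fall₂ a b r (suc x) y) (spread-fall₂ a b r x (suc y)) ⟩
  p * f * g * (((a ∸ suc x) + q) P′ r) + f * (q * g) * ((p + (b ∸ suc y)) P′ r)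
    ≡⟨ cong₂ (λ s t → p * f * g * ((s + q) P′ r) + f * (q * g) * ((p + t) P′ r)) (pred[m∸n]≡m∸[1+n] a x) (pred[m∸n]≡m∸[1+n] b y) ⟨
  p * f * g * ((ℕ.pred p + q) P′ r) + f * (q * g) * ((p + ℕ.pred q) P′ r)
    ≡⟨ factor p q f g ((ℕ.pred p + q) P′ r) ((p + ℕ.pred q) P′ r) ⟩
  f * g * (p * ((ℕ.pred p + q) P′ r) + q * ((p + ℕ.pred q) P′ r))
    ≡⟨ cong (f * g *_) (cong₂ _+_ (pred-left p q) (pred-right p q)) ⟩
  f * g * (p * (ℕ.pred (p + q) P′ r) + q * (ℕ.pred (p + q) P′ r))
    ≡⟨ cong (f * g *_) (trans (sym (*-distribʳ-+ (ℕ.pred (p + q) P′ r) p q)) (sym (P′-suc (p + q) r))) ⟩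
  f * g * ((p + q) P′ suc r) ∎
  where
  open ≡-Reasoning
  p = a ∸ x
  q = b ∸ y
  f = a P′ x
  g = b P′ y
  factor : ∀ p q f g s t → p * f * g * s + f * (q * g) * t ≡ f * g * (p * s + q * t)
  factor = solve-∀
  pred-left : ∀ p q → p * ((ℕ.pred p + q) P′ r) ≡ p * (ℕ.pred (p + q) P′ r)
  pred-left zero    q = refl
  pred-left (suc p) q = refl
  pred-right : ∀ p q → q * ((p + ℕ.pred q) P′ r) ≡ q * (ℕ.pred (p + q) P′ r)
  pred-right p zero    = refl
  pred-right p (suc q) = cong (λ t → suc q * (ℕ.pred t P′ r)) (sym (+-suc p q))

-- Comparison of the values of (shiftˡ shiftʳ) ^ x (shiftˡ + shiftʳ) ^ r at the origin.
infix 4 _≼_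
_≼_ : (g h : ℕ → ℕ → ℕ) → Set
g ≼ h = ∀ x r → spread r g x x ≤ spread r h x x

fall₂-transfer : ∀ {a b} → b ≤ a → fall₂ (suc a) b ≼ fall₂ a (suc b)
fall₂-transfer {a} {b} b≤a x r = begin
  spread r (fall₂ (suc a) b) x x                                   ≡⟨ spread-fall₂ (suc a) b r x x ⟩
  fall₂ (suc a) b x x * (((suc a ∸ x) + (b ∸ x)) P′ r)               ≤⟨ bound (x ≤? b) ⟩
  fall₂ a (suc b) x x * (((a ∸ x) + (suc b ∸ x)) P′ r)               ≡⟨ spread-fall₂ a (suc b) r x x ⟨
  spread r (fall₂ a (suc b)) x x                                   ∎
  where
  open ≤-Reasoning
  bound : Dec (x ≤ b) → fall₂ (suc a) b x x * (((suc a ∸ x) + (b ∸ x)) P′ r) ≤ fall₂ a (suc b) x x * (((a ∸ x) + (suc b ∸ x)) P′ r)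
  bound (no x≰b)  = ≤-trans (≤-reflexive (cong (_* (((suc a ∸ x) + (b ∸ x)) P′ r))
    (trans (cong ((suc a P′ x) *_) (a<x⇒aP′x≡0 (≰⇒> x≰b))) (*-zeroʳ (suc a P′ x))))) z≤n
  bound (yes x≤b) = *-mono-≤ (P′-product-mono x b≤a) (≤-reflexive (cong (_P′ r) same-total))
    where
    same-total : (suc a ∸ x) + (b ∸ x) ≡ (a ∸ x) + (suc b ∸ x)
    same-total = trans (cong (_+ (b ∸ x)) (+-∸-assoc 1 (≤-trans x≤b b≤a)))
      (trans (sym (+-suc (a ∸ x) (b ∸ x))) (cong (a ∸ x +_) (sym (+-∸-assoc 1 x≤b))))

Functional : Set
Functional = (ℕ → ℕ → ℕ) → ℕ

record Positive (F : Functional) : Set where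
  field
    additive : ∀ g h → F (λ x y → g x y + h x y) ≡ F g + F h
    monotone : ∀ {g h} → g ≼ h → F g ≤ F h

open Positive public

positive-≗ : {F F′ : Functional} → F ≗ F′ → Positive F′ → Positive F
positive-≗ F≗F′ pos = record
  { additive = λ g h → trans (F≗F′ _) (trans (additive pos g h) (sym (cong₂ _+_ (F≗F′ g) (F≗F′ h))))
  ; monotone = λ {g} {h} g≼h → subst₂ _≤_ (sym (F≗F′ g)) (sym (F≗F′ h)) (monotone pos g≼h)
  }

positive-0 : Positive (λ _ → 0)
positive-0 = record { additive = λ _ _ → refl ; monotone = λ _ → z≤n }

positive-origin : Positive (λ g → g 0 0)
positive-origin = record { additive = λ _ _ → refl ; monotone = λ g≼h → g≼h 0 0 }

positive-+ : {F F′ : Functional} → Positive F → Positive F′ → Positive (λ g → F g + F′ g)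
positive-+ {F} {F′} pos pos′ = record
  { additive = λ g h → trans (cong₂ _+_ (additive pos g h) (additive pos′ g h)) (+-interchange (F g) (F h) (F′ g) (F′ h))
  ; monotone = λ g≼h → +-mono-≤ (monotone pos g≼h) (monotone pos′ g≼h)
  }

positive-* : {F : Functional} (c : ℕ) → Positive F → Positive (λ g → c * F g)
positive-* zero    pos = positive-0
positive-* (suc c) pos = positive-+ pos (positive-* c pos)

positive-𝟙 : {P : Set} {F : Functional} (d : Dec P) → (P → Positive F) → Positive (λ g → 𝟙 d * F g)
positive-𝟙 (yes p) pos = positive-* 1 (pos p)
positive-𝟙 (no _)  pos = positive-0

positive-∑ : {F : Fin k → Functional} → (∀ i → Positive (F i)) → Positive (λ g → ∑ λ i → F i g)
positive-∑ {zero}  pos = positive-0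
positive-∑ {suc k} pos = positive-+ (pos zero) (positive-∑ (pos ∘ suc))

positive-shift² : {F : Functional} → Positive F → Positive (λ g → F (shiftˡ (shiftʳ g)))
positive-shift² pos = record
  { additive = λ g h → additive pos (shiftˡ (shiftʳ g)) (shiftˡ (shiftʳ h))
  ; monotone = λ {g} {h} g≼h → monotone pos λ x r →
      subst₂ _≤_ (sym (spread-shift r g x x)) (sym (spread-shift r h x x)) (g≼h (suc x) r)
  }

positive-shift+shift : {F : Functional} → Positive F → Positive (λ g → F (shiftˡ g) + F (shiftʳ g))
positive-shift+shift {F} pos = positive-≗ (λ g → sym (additive pos (shiftˡ g) (shiftʳ g))) record
  { additive = λ g h → trans (trans (additive pos _ _) (cong₂ _+_ (additive pos _ _) (additive pos _ _)))
      (trans (+-interchange (F (shiftˡ g)) (F (shiftˡ h)) (F (shiftʳ g)) (F (shiftʳ h))) (sym (cong₂ _+_ (additive pos _ _) (additive pos _ _))))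
  ; monotone = λ {g} {h} g≼h → monotone pos λ x r →
      subst₂ _≤_ (sym (spread-suc r g x x)) (sym (spread-suc r h x x)) (g≼h x (suc r))
  }

module TwoClasses {k : ℕ} (P Q : Fin k) (P≢Q : P ≢ Q) where

  merge : Fin k → Fin k
  merge i = if does (i ≟ Q) then P else i

  merge-P : merge P ≡ P
  merge-P rewrite dec-false (P ≟ Q) P≢Q = refl

  merge-Q : merge Q ≡ P
  merge-Q rewrite dec-true (Q ≟ Q) refl = refl

  merge-other : ∀ {i} → i ≢ Q → merge i ≡ i
  merge-other {i} i≢Q rewrite dec-false (i ≟ Q) i≢Q = refl

  merge≢Q : ∀ i → merge i ≢ Q
  merge≢Q i with i ≟ Q
  ... | yes _   = P≢Q
  ... | no i≢Q  = i≢Q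

  merge-≡⇔ : ∀ {i j} → j ≢ P → j ≢ Q → merge i ≡ j ⇔ i ≡ j
  merge-≡⇔ {i} {j} j≢P j≢Q = mk⇔ to λ { refl → merge-other j≢Q }
    where
    to : merge i ≡ j → i ≡ j
    to e with i ≟ Q
    ... | yes _ = contradiction (sym e) j≢P
    ... | no _  = e

  Other : Fin k → Set
  Other i = i ≢ P × i ≢ Q

  other? : Decidable Other
  other? i = ¬? (i ≟ P) ×-dec ¬? (i ≟ Q)

  ∑-pair-and-others : (f : Fin k → ℕ) → ∑ f ≡ f P + f Q + ∑ λ i → 𝟙 (other? i) * f i
  ∑-pair-and-others f = begin
    ∑ f
      ≡⟨ sum-cong-≗ (λ i → trans (sym (*-identityˡ (f i))) (trans (cong (_* f i) (partition i)) (expand (𝟙 (i ≟ P)) (𝟙 (i ≟ Q)) (𝟙 (other? i)) (f i)))) ⟩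
    ∑ (λ i → (𝟙 (i ≟ P) * f i + 𝟙 (i ≟ Q) * f i) + 𝟙 (other? i) * f i)
      ≡⟨ trans (∑-distrib-+ (λ i → 𝟙 (i ≟ P) * f i + 𝟙 (i ≟ Q) * f i) _) (cong (_+ ∑ λ i → 𝟙 (other? i) * f i) (∑-distrib-+ (λ i → 𝟙 (i ≟ P) * f i) _)) ⟩
    ∑ (λ i → 𝟙 (i ≟ P) * f i) + ∑ (λ i → 𝟙 (i ≟ Q) * f i) + ∑ (λ i → 𝟙 (other? i) * f i)
      ≡⟨ cong (_+ ∑ λ i → 𝟙 (other? i) * f i) (cong₂ _+_ (∑-δ P f) (∑-δ Q f)) ⟩
    f P + f Q + ∑ (λ i → 𝟙 (other? i) * f i) ∎
    where
    open ≡-Reasoning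
    expand : ∀ p q r t → (p + q + r) * t ≡ (p * t + q * t) + r * t
    expand = solve-∀
    partition : ∀ i → 1 ≡ 𝟙 (i ≟ P) + 𝟙 (i ≟ Q) + 𝟙 (other? i)
    partition i with i ≟ P | i ≟ Q
    ... | yes p | yes q = contradiction (trans (sym p) q) P≢Q
    ... | yes _ | no _  = refl
    ... | no _  | yes _ = refl
    ... | no _  | no _  = refl

  tally : Fin k → (ℕ → ℕ → ℕ) → ℕ → ℕ → ℕ
  tally i g x y = g (𝟙 (i ≟ P) + x) (𝟙 (i ≟ Q) + y)

  -- Weighted sum over the colourings continuing a vertex of colour j; the weight ψ does not
  -- distinguish the classes P and Q, and g records how often each of them is used.
  continuations : Vec Bool m → Fin k → (Vec (Fin k) m → ℕ) → Functional
  next : Vec Bool m → (Vec (Fin k) (suc m) → ℕ) → Fin k → Functional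

  continuations []       j ψ g = ψ [] * g 0 0
  continuations (b ∷ bs) j ψ g = ∑ λ i → link (complete k) b j i * next bs ψ i g

  next bs ψ i g = continuations bs i (ψ ∘ (merge i ∷_)) (tally i g)

  ∑ᵛ-continuations : (bs : Vec Bool m) (j : Fin k) (ψ : Vec (Fin k) m → ℕ) (g : ℕ → ℕ → ℕ) →
    ∑ᵛ m (λ κ → hom (complete k) bs (j ∷ κ) * (ψ (map merge κ) * g (occ P κ) (occ Q κ))) ≡ continuations bs j ψ g
  ∑ᵛ-continuations []       j ψ g = *-identityˡ _
  ∑ᵛ-continuations {suc m} (b ∷ bs) j ψ g = sum-cong-≗ λ i → begin
    ∑ᵛ m (λ κ → link K b j i * hom K bs (i ∷ κ) * weight i κ)     ≡⟨ ∑ᵛ-cong m (λ κ → *-assoc (link K b j i) (hom K bs (i ∷ κ)) _) ⟩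
    ∑ᵛ m (λ κ → link K b j i * (hom K bs (i ∷ κ) * weight i κ))   ≡⟨ ∑ᵛ-*ˡ m (link K b j i) (λ κ → hom K bs (i ∷ κ) * weight i κ) ⟩
    link K b j i * ∑ᵛ m (λ κ → hom K bs (i ∷ κ) * weight i κ)     ≡⟨ cong (link K b j i *_) (∑ᵛ-continuations bs i _ _) ⟩
    link K b j i * next bs ψ i g                                  ∎
    where
    open ≡-Reasoning
    K = complete k
    weight : Fin k → Vec (Fin k) m → ℕ
    weight i κ = ψ (merge i ∷ map merge κ) * tally i g (occ P κ) (occ Q κ)

  next-P : (bs : Vec Bool m) (ψ : Vec (Fin k) (suc m) → ℕ) → next bs ψ P ≗ (continuations bs P (ψ ∘ (P ∷_)) ∘ shiftˡ)
  next-P bs ψ g rewrite merge-P | 𝟙-yes (P ≟ P) refl | 𝟙-no (P ≟ Q) P≢Q = refl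

  next-Q : (bs : Vec Bool m) (ψ : Vec (Fin k) (suc m) → ℕ) → next bs ψ Q ≗ (continuations bs Q (ψ ∘ (P ∷_)) ∘ shiftʳ)
  next-Q bs ψ g rewrite merge-Q | 𝟙-yes (Q ≟ Q) refl | 𝟙-no (Q ≟ P) (P≢Q ∘ sym) = refl

  next-other : (bs : Vec Bool m) (ψ : Vec (Fin k) (suc m) → ℕ) {i : Fin k} → Other i →
    next bs ψ i ≗ continuations bs i (ψ ∘ (merge i ∷_))
  next-other bs ψ {i} (i≢P , i≢Q) g rewrite 𝟙-no (i ≟ P) i≢P | 𝟙-no (i ≟ Q) i≢Q = refl

  -- A maximal run of vertices in P ∪ Q alternates between the two classes, so after a vertex in
  -- one of them an odd-length remainder of the run uses the opposite class once more.
  record Coupled (F F′ : Functional) : Set where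
    field
      even odd      : Functional
      even-positive : Positive even
      odd-positive  : Positive odd
      afterP        : ∀ g → F g ≡ even g + odd (shiftʳ g)
      afterQ        : ∀ g → F′ g ≡ even g + odd (shiftˡ g)

  open Coupled

  coupled-refl : {F F′ : Functional} → Positive F → F′ ≗ F → Coupled F F′
  coupled-refl {F} pos F′≗F = record
    { even = F ; odd = λ _ → 0 ; even-positive = pos ; odd-positive = positive-0
    ; afterP = λ g → sym (+-identityʳ (F g)) ; afterQ = λ g → trans (F′≗F g) (sym (+-identityʳ (F g)))
    }

  coupled⇒positive : {F F′ : Functional} → Coupled F F′ → Positive (λ g → F (shiftˡ g) + F′ (shiftʳ g))
  coupled⇒positive {F} {F′} C = positive-≗
    (λ g → trans (cong₂ _+_ (afterP C (shiftˡ g)) (afterQ C (shiftʳ g)))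
      (collect (even C (shiftˡ g)) (odd C (shiftˡ (shiftʳ g))) (even C (shiftʳ g))))
    (positive-+ (positive-shift+shift (even-positive C)) (positive-* 2 (positive-shift² (odd-positive C))))
    where
    collect : ∀ p q r → (p + q) + (r + q) ≡ (p + r) + 2 * q
    collect = solve-∀

  record Alternating (bs : Vec Bool m) : Set where
    field
      after-other : ∀ {i} → Other i → ∀ ψ → Positive (continuations bs i ψ)
      after-pair  : ∀ ψ → Coupled (continuations bs P ψ) (continuations bs Q ψ)

  open Alternating

  next-others : Vec Bool m → (Vec (Fin k) (suc m) → ℕ) → (Fin k → ℕ) → Functional
  next-others bs ψ c g = ∑ λ i → 𝟙 (other? i) * (c i * next bs ψ i g)

  next-others-positive : {bs : Vec Bool m} → Alternating bs → ∀ ψ c → Positive (next-others bs ψ c)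
  next-others-positive {bs = bs} alt ψ c = positive-∑ λ i → positive-𝟙 (other? i) λ other →
    positive-* (c i) (positive-≗ (next-other bs ψ other) (after-other alt other _))

  next-others-cong : (bs : Vec Bool m) (ψ : Vec (Fin k) (suc m) → ℕ) {c d : Fin k → ℕ} →
    (∀ {i} → Other i → c i ≡ d i) → next-others bs ψ c ≗ next-others bs ψ d
  next-others-cong bs ψ {c} {d} c≡d g = sum-cong-≗ λ i → 𝟙*-cong (other? i) λ other → cong (_* next bs ψ i g) (c≡d other)

  next-sum-positive : {bs : Vec Bool m} → Alternating bs → ∀ {c : Fin k → ℕ} → c P ≡ 1 → c Q ≡ 1 → ∀ ψ →
    Positive λ g → ∑ λ i → c i * next bs ψ i g
  next-sum-positive {bs = bs} alt {c} cP≡1 cQ≡1 ψ = positive-≗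
    (λ g → trans (∑-pair-and-others (λ i → c i * next bs ψ i g)) (cong (_+ next-others bs ψ c g) (cong₂ _+_
      (trans (cong₂ _*_ cP≡1 (next-P bs ψ g)) (*-identityˡ _))
      (trans (cong₂ _*_ cQ≡1 (next-Q bs ψ g)) (*-identityˡ _)))))
    (positive-+ (coupled⇒positive (after-pair alt (ψ ∘ (P ∷_)))) (next-others-positive alt ψ c))

  alternating-[] : Alternating []
  alternating-[] = record
    { after-other = λ _ ψ → positive-* (ψ []) positive-origin
    ; after-pair  = λ ψ → coupled-refl (positive-* (ψ []) positive-origin) λ _ → refl
    }

  alternating-false : {bs : Vec Bool m} → Alternating bs → Alternating (false ∷ bs)
  alternating-false alt = record
    { after-other = λ _ → next-sum-positive alt refl refl
    ; after-pair  = λ ψ → coupled-refl (next-sum-positive alt refl refl ψ) λ _ → refl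
    }

  alternating-true : {bs : Vec Bool m} → Alternating bs → Alternating (true ∷ bs)
  alternating-true {bs = bs} alt = record
    { after-other = λ {i} (i≢P , i≢Q) → next-sum-positive alt (𝟙-yes (adj? K i P) i≢P) (𝟙-yes (adj? K i Q) i≢Q)
    ; after-pair  = coupled
    }
    where
    K = complete k
    joined-to-others : ∀ {j} → (j ≡ P ⊎ j ≡ Q) → ∀ {i} → Other i → adjacency K j i ≡ 1
    joined-to-others {j} j∈PQ {i} (i≢P , i≢Q) = 𝟙-yes (adj? K j i) λ { refl → [ i≢P , i≢Q ]′ j∈PQ }
    coupled : ∀ ψ → Coupled (continuations (true ∷ bs) P ψ) (continuations (true ∷ bs) Q ψ)
    coupled ψ = record
      { even          = λ g → others g + odd C (shiftˡ (shiftʳ g))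
      ; odd           = even C
      ; even-positive = positive-+ (next-others-positive alt ψ (λ _ → 1)) (positive-shift² (odd-positive C))
      ; odd-positive  = even-positive C
      ; afterP = λ g → trans (∑-pair-and-others (λ i → adjacency K P i * next bs ψ i g)) (trans
          (cong₂ _+_ (cong₂ _+_ (cong (_* next bs ψ P g) (𝟙-no (adj? K P P) (λ ne → ne refl)))
              (trans (cong₂ _*_ (𝟙-yes (adj? K P Q) P≢Q) (trans (next-Q bs ψ g) (afterQ C (shiftʳ g)))) (*-identityˡ _)))
            (next-others-cong bs ψ (joined-to-others (inj₁ refl)) g))
          (rotate (even C (shiftʳ g)) (odd C (shiftˡ (shiftʳ g))) (others g)))
      ; afterQ = λ g → trans (∑-pair-and-others (λ i → adjacency K Q i * next bs ψ i g)) (trans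
          (cong₂ _+_ (cong₂ _+_
              (trans (cong₂ _*_ (𝟙-yes (adj? K Q P) (P≢Q ∘ sym)) (trans (next-P bs ψ g) (afterP C (shiftˡ g)))) (*-identityˡ _))
              (cong (_* next bs ψ Q g) (𝟙-no (adj? K Q Q) (λ ne → ne refl))))
            (next-others-cong bs ψ (joined-to-others (inj₂ refl)) g))
          (trans (cong (_+ others g) (+-identityʳ _)) (rotate (even C (shiftˡ g)) (odd C (shiftˡ (shiftʳ g))) (others g))))
      }
      where
      C = after-pair alt (ψ ∘ (P ∷_))
      others = next-others bs ψ (λ _ → 1)
      rotate : ∀ p q r → (p + q) + r ≡ (r + q) + p
      rotate = solve-∀

  alternating : (bs : Vec Bool m) → Alternating bs
  alternating []           = alternating-[]
  alternating (true ∷ bs)  = alternating-true (alternating bs)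
  alternating (false ∷ bs) = alternating-false (alternating bs)

  colourings : Vec Bool m → (Vec (Fin k) (suc m) → ℕ) → Functional
  colourings {m} bs ψ g = ∑ᵛ (suc m) λ κ → hom (complete k) bs κ * (ψ (map merge κ) * g (occ P κ) (occ Q κ))

  colourings-positive : (bs : Vec Bool m) (ψ : Vec (Fin k) (suc m) → ℕ) → Positive (colourings bs ψ)
  colourings-positive bs ψ = positive-≗
    (λ g → sum-cong-≗ λ i → trans (∑ᵛ-continuations bs i (ψ ∘ (merge i ∷_)) (tally i g)) (sym (*-identityˡ _)))
    (next-sum-positive (alternating bs) {λ _ → 1} refl refl ψ)

  otherLifts : (Fin k → ℕ) → Vec (Fin k) m → ℕ
  otherLifts s []      = 1
  otherLifts s (j ∷ κ) = (if does (j ≟ P) then 1 else (s j ∸ occ j κ)) * otherLifts s κ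

  otherLifts-cong : {s t : Fin k → ℕ} → (∀ {i} → Other i → s i ≡ t i) →
    (κ : Vec (Fin k) m) → otherLifts s (map merge κ) ≡ otherLifts t (map merge κ)
  otherLifts-cong s≡t []      = refl
  otherLifts-cong s≡t (j ∷ κ) with merge j ≟ P
  ... | yes _  = cong (1 *_) (otherLifts-cong s≡t κ)
  ... | no ≢P  = cong₂ _*_ (cong (_∸ occ (merge j) (map merge κ)) (s≡t (≢P , merge≢Q j))) (otherLifts-cong s≡t κ)

  occ-merge : ∀ {j} → Other j → (κ : Vec (Fin k) m) → occ j (map merge κ) ≡ occ j κ
  occ-merge other []      = refl
  occ-merge {j = j} other@(j≢P , j≢Q) (i ∷ κ) = cong₂ _+_ (𝟙-cong (merge i ≟ j) (i ≟ j) to from) (occ-merge other κ)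
    where open Equivalence (merge-≡⇔ {i} j≢P j≢Q)

  lifts-factor : (s : Fin k → ℕ) (κ : Vec (Fin k) m) →
    lifts s κ ≡ otherLifts s (map merge κ) * fall₂ (s P) (s Q) (occ P κ) (occ Q κ)
  lifts-factor s []      = refl
  lifts-factor s (j ∷ κ) with j ≟ P | j ≟ Q
  ... | yes p    | yes q    = contradiction (trans (sym p) q) P≢Q
  ... | yes refl | no _     rewrite dec-true (P ≟ P) refl =
    trans (cong ((s P ∸ occ P κ) *_) (lifts-factor s κ)) (pull (s P ∸ occ P κ) (otherLifts s (map merge κ)) (s P P′ occ P κ) (s Q P′ occ Q κ))
    where
    pull : ∀ p o f g → p * (o * (f * g)) ≡ 1 * o * (p * f * g)
    pull = solve-∀
  ... | no _     | yes refl rewrite dec-true (P ≟ P) refl =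
    trans (cong ((s Q ∸ occ Q κ) *_) (lifts-factor s κ)) (pull (s Q ∸ occ Q κ) (otherLifts s (map merge κ)) (s P P′ occ P κ) (s Q P′ occ Q κ))
    where
    pull : ∀ p o f g → p * (o * (f * g)) ≡ 1 * o * (f * (p * g))
    pull = solve-∀
  ... | no j≢P   | no j≢Q   rewrite dec-false (j ≟ P) j≢P =
    trans (cong₂ _*_ (cong (s j ∸_) (sym (occ-merge (j≢P , j≢Q) κ))) (lifts-factor s κ)) (sym (*-assoc (s j ∸ occ j (map merge κ)) _ _))

multipartiteEmbeddings : (Fin k → ℕ) → Vec Bool m → ℕ
multipartiteEmbeddings {k} {m} s bs = ∑ᵛ (suc m) λ κ → lifts s κ * hom (complete k) bs κ

multipartiteEmbeddings-cong : (bs : Vec Bool m) (s t : Fin k → ℕ) → s ≗ t → multipartiteEmbeddings s bs ≡ multipartiteEmbeddings t bs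
multipartiteEmbeddings-cong {m} {k} bs s t s≗t = ∑ᵛ-cong (suc m) λ κ → cong (_* hom (complete k) bs κ) (lifts-cong s≗t κ)

enlarge : (Fin k → ℕ) → Fin k → Fin k → ℕ
enlarge s i j = s j + 𝟙 (j ≟ i)

enlarge-at : (s : Fin k → ℕ) (i : Fin k) → enlarge s i i ≡ suc (s i)
enlarge-at s i = trans (cong (s i +_) (𝟙-yes (i ≟ i) refl)) (+-comm (s i) 1)

enlarge-off : (s : Fin k → ℕ) {i j : Fin k} → j ≢ i → enlarge s i j ≡ s j
enlarge-off s {i} {j} j≢i = trans (cong (s j +_) (𝟙-no (j ≟ i) j≢i)) (+-identityʳ (s j))

∑-enlarge : (s : Fin k → ℕ) (i : Fin k) → ∑ (enlarge s i) ≡ suc (∑ s)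
∑-enlarge s i = trans (∑-distrib-+ s (λ j → 𝟙 (j ≟ i))) (trans (cong (∑ s +_) one) (+-comm (∑ s) 1))
  where
  one : count (λ j → j ≟ i) ≡ 1
  one = trans (sum-cong-≗ λ j → sym (*-identityʳ (𝟙 (j ≟ i)))) (∑-δ i λ _ → 1)

multipartiteEmbeddings-transfer : (bs : Vec Bool m) (r : Fin k → ℕ) {P Q : Fin k} → P ≢ Q → r Q ≤ r P →
  multipartiteEmbeddings (enlarge r P) bs ≤ multipartiteEmbeddings (enlarge r Q) bs
multipartiteEmbeddings-transfer {m} {k} bs r {P} {Q} P≢Q rQ≤rP = begin
  multipartiteEmbeddings (enlarge r P) bs                  ≡⟨ as-colourings (enlarge r P) (λ (i≢P , _) → enlarge-off r i≢P) ⟩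
  F (fall₂ (enlarge r P P) (enlarge r P Q))                ≡⟨ cong₂ (λ p q → F (fall₂ p q)) (enlarge-at r P) (enlarge-off r (P≢Q ∘ sym)) ⟩
  F (fall₂ (suc (r P)) (r Q))                              ≤⟨ monotone (colourings-positive bs (otherLifts r)) (fall₂-transfer rQ≤rP) ⟩
  F (fall₂ (r P) (suc (r Q)))                              ≡⟨ cong₂ (λ p q → F (fall₂ p q)) (enlarge-off r P≢Q) (enlarge-at r Q) ⟨
  F (fall₂ (enlarge r Q P) (enlarge r Q Q))                ≡⟨ as-colourings (enlarge r Q) (λ (_ , i≢Q) → enlarge-off r i≢Q) ⟨
  multipartiteEmbeddings (enlarge r Q) bs                  ∎
  where
  open TwoClasses P Q P≢Q
  open ≤-Reasoning
  F : Functional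
  F = colourings bs (otherLifts r)
  as-colourings : ∀ s → (∀ {i} → Other i → s i ≡ r i) → multipartiteEmbeddings s bs ≡ F (fall₂ (s P) (s Q))
  as-colourings s s≡r = ∑ᵛ-cong (suc m) λ κ → trans (*-comm (lifts s κ) (hom (complete k) bs κ)) (cong (hom (complete k) bs κ *_)
    (trans (lifts-factor s κ) (cong (_* fall₂ (s P) (s Q) (occ P κ) (occ Q κ)) (otherLifts-cong s≡r κ))))

surplus-and-deficit : {s t : Fin k → ℕ} → ∑ s ≡ ∑ t → 0 < ∑ (λ i → s i ∸ t i) → (∃[ P ] t P < s P) × (∃[ Q ] s Q < t Q)
surplus-and-deficit {s = s} {t} ∑s≡∑t 0<surplus = (P , tP<sP) , deficit
  where
  surplus = ∑-pos⇒∃ (λ i → s i ∸ t i) 0<surplus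
  P = proj₁ surplus
  tP<sP : t P < s P
  tP<sP = m∸n≢0⇒n<m λ s∸t≡0 → <-irrefl (sym s∸t≡0) (proj₂ surplus)
  deficit : ∃[ Q ] s Q < t Q
  deficit with any? (λ i → s i <? t i)
  ... | yes found = found
  ... | no none   = contradiction tP<sP (<-irrefl (∑-≡⇒≗ (λ i → ≮⇒≥ λ s<t → none (i , s<t)) (sym ∑s≡∑t) P))

no-surplus⇒≗ : {s t : Fin k → ℕ} → ∑ s ≡ ∑ t → ∑ (λ i → s i ∸ t i) ≡ 0 → s ≗ t
no-surplus⇒≗ {s = s} {t} ∑s≡∑t ∑≡0 = ∑-≡⇒≗ (λ i → m∸n≡0⇒m≤n (n≤0⇒n≡0 (≤-trans (term≤∑ (λ i → s i ∸ t i) i) (≤-reflexive ∑≡0)))) ∑s≡∑t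

surplus-after-transfer : (r t : Fin k → ℕ) {P Q : Fin k} → P ≢ Q → t P ≤ r P → r Q < t Q →
  suc (∑ λ i → enlarge r Q i ∸ t i) ≡ ∑ λ i → enlarge r P i ∸ t i
surplus-after-transfer r t {P} {Q} P≢Q tP≤rP rQ<tQ = trans (sym (∑-enlarge surplus P)) (sum-cong-≗ λ i → at i (i ≟ P) (i ≟ Q))
  where
  surplus : Fin _ → ℕ
  surplus i = enlarge r Q i ∸ t i
  at : ∀ i → Dec (i ≡ P) → Dec (i ≡ Q) → enlarge surplus P i ≡ enlarge r P i ∸ t i
  at i (yes refl) _ = begin
    enlarge surplus i i                       ≡⟨ enlarge-at surplus i ⟩
    suc (enlarge r Q i ∸ t i)                 ≡⟨ cong (λ x → suc (x ∸ t i)) (enlarge-off r P≢Q) ⟩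
    suc (r i ∸ t i)                           ≡⟨ +-∸-assoc 1 tP≤rP ⟨
    suc (r i) ∸ t i                           ≡⟨ cong (_∸ t i) (enlarge-at r i) ⟨
    enlarge r i i ∸ t i                       ∎
    where open ≡-Reasoning
  at i (no i≢P) (yes refl) = begin
    enlarge surplus P i                       ≡⟨ enlarge-off surplus i≢P ⟩
    enlarge r i i ∸ t i                       ≡⟨ cong (_∸ t i) (enlarge-at r i) ⟩
    suc (r i) ∸ t i                           ≡⟨ m≤n⇒m∸n≡0 rQ<tQ ⟩
    0                                         ≡⟨ m≤n⇒m∸n≡0 (<⇒≤ rQ<tQ) ⟨
    r i ∸ t i                                 ≡⟨ cong (_∸ t i) (enlarge-off r i≢P) ⟨
    enlarge r P i ∸ t i                       ∎
    where open ≡-Reasoning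
  at i (no i≢P) (no i≢Q) = trans (enlarge-off surplus i≢P) (cong (_∸ t i) (trans (enlarge-off r i≢Q) (sym (enlarge-off r i≢P))))

multipartiteEmbeddings-balanced : (bs : Vec Bool m) (t : Fin k → ℕ) → (∀ i j → t i ≤ suc (t j)) →
  (s : Fin k → ℕ) → ∑ s ≡ ∑ t → multipartiteEmbeddings s bs ≤ multipartiteEmbeddings t bs
multipartiteEmbeddings-balanced {k = k} bs t balanced s ∑s≡∑t = by-surplus _ s ∑s≡∑t refl
  where
  by-surplus : ∀ d s → ∑ s ≡ ∑ t → ∑ (λ i → s i ∸ t i) ≡ d → multipartiteEmbeddings s bs ≤ multipartiteEmbeddings t bs
  by-surplus zero    s ∑s≡∑t surplus≡ = ≤-reflexive (multipartiteEmbeddings-cong bs s t (no-surplus⇒≗ ∑s≡∑t surplus≡))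
  by-surplus (suc d) s ∑s≡∑t surplus≡ with surplus-and-deficit ∑s≡∑t (≤-trans (s≤s z≤n) (≤-reflexive (sym surplus≡)))
  ... | (P , tP<sP) , (Q , sQ<tQ) = begin
    multipartiteEmbeddings s bs                 ≡⟨ multipartiteEmbeddings-cong bs s (enlarge r P) s≗r+P ⟩
    multipartiteEmbeddings (enlarge r P) bs     ≤⟨ multipartiteEmbeddings-transfer bs r P≢Q rQ≤rP ⟩
    multipartiteEmbeddings (enlarge r Q) bs     ≤⟨ by-surplus d (enlarge r Q) ∑≡ (suc-injectiveℕ (trans (surplus-after-transfer r t P≢Q tP≤rP rQ<tQ)
                                                     (trans (sum-cong-≗ λ i → cong (_∸ t i) (sym (s≗r+P i))) surplus≡))) ⟩
    multipartiteEmbeddings t bs                 ∎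
    where
    open ≤-Reasoning
    P≢Q : P ≢ Q
    P≢Q refl = <-asym tP<sP sQ<tQ
    r : Fin k → ℕ
    r i = s i ∸ 𝟙 (i ≟ P)
    s≗r+P : s ≗ enlarge r P
    s≗r+P i = sym (m∸n+n≡m (enough i))
      where
      enough : ∀ i → 𝟙 (i ≟ P) ≤ s i
      enough i with i ≟ P
      ... | yes refl = ≤-trans (s≤s z≤n) tP<sP
      ... | no _     = z≤n
    sP≡1+rP : s P ≡ suc (r P)
    sP≡1+rP = trans (s≗r+P P) (enlarge-at r P)
    sQ≡rQ : s Q ≡ r Q
    sQ≡rQ = trans (s≗r+P Q) (enlarge-off r (P≢Q ∘ sym))
    tP≤rP : t P ≤ r P
    tP≤rP = ≤-pred (≤-trans tP<sP (≤-reflexive sP≡1+rP))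
    rQ<tQ : r Q < t Q
    rQ<tQ = subst (_< t Q) sQ≡rQ sQ<tQ
    rQ≤rP : r Q ≤ r P
    rQ≤rP = ≤-trans (≤-pred (≤-trans rQ<tQ (balanced Q P))) tP≤rP
    ∑≡ : ∑ (enlarge r Q) ≡ ∑ t
    ∑≡ = trans (∑-enlarge r Q) (trans (sym (∑-enlarge r P)) (trans (sum-cong-≗ λ i → sym (s≗r+P i)) ∑s≡∑t))

-- Turán graphs

turánColour : ∀ n κ → Fin n → Fin (suc κ)
turánColour n κ v = toℕ v mod suc κ

toℕ-turánColour : ∀ n κ v → toℕ (turánColour n κ v) ≡ toℕ v % suc κ
toℕ-turánColour n κ v = toℕ-fromℕ< (m%n<n (toℕ v) (suc κ))

turánColour-≡⇔ : ∀ n κ u v → turánColour n κ u ≡ turánColour n κ v ⇔ toℕ u % suc κ ≡ toℕ v % suc κ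
turánColour-≡⇔ n κ u v = mk⇔
  (λ e → trans (sym (toℕ-turánColour n κ u)) (trans (cong toℕ e) (toℕ-turánColour n κ v)))
  (λ e → toℕ-injective (trans (toℕ-turánColour n κ u) (trans e (sym (toℕ-turánColour n κ v)))))

classSize-turán : ∀ n κ j → classSize (turánColour n κ) j ≡ partSize n κ j
classSize-turán n κ j = sym (begin
  length (filter inPart? (allFin n))            ≡⟨ length-filter inPart? (allFin n) ⟩
  ∑ᴸ (𝟙 ∘ inPart?) (allFin n)                   ≡⟨ ∑ᴸ-tabulate (𝟙 ∘ inPart?) id ⟩
  count inPart?                                 ≡⟨ count-cong inPart? (λ v → turánColour n κ v ≟ j)
                                                     (λ {v} e → toℕ-injective (trans (toℕ-turánColour n κ v) e)) (λ {v} e → trans (sym (toℕ-turánColour n κ v)) (cong toℕ e)) ⟩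
  classSize (turánColour n κ) j                 ∎)
  where
  open ≡-Reasoning
  inPart? : Decidable (λ (v : Fin n) → toℕ v % suc κ ≡ toℕ j)
  inPart? v = toℕ v % suc κ ≟ℕ toℕ j

partSize-upper : ∀ n κ r → suc κ * partSize n κ r ≤ n + κ
partSize-upper n κ r with turán-balanced n κ r
... | inj₁ e rewrite e = ≤-trans (≤-reflexive (*-comm (suc κ) (n / suc κ))) (≤-trans (m/n*n≤m n (suc κ)) (m≤m+n n κ))
... | inj₂ e rewrite e = ≤-trans (≤-reflexive (*-comm (suc κ) ((n + κ) / suc κ))) (m/n*n≤m (n + κ) (suc κ))

partSize-lower : ∀ n κ r → n / suc κ ≤ partSize n κ r
partSize-lower n κ r with turán-balanced n κ r
... | inj₁ e rewrite e = ≤-refl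
... | inj₂ e rewrite e = /-monoˡ-≤ (suc κ) (m≤m+n n κ)

partSize-balanced : ∀ n κ i j → partSize n κ i ≤ suc (partSize n κ j)
partSize-balanced n κ i j = ≤-trans (≤-pred (*-cancelˡ-< (suc κ) _ _ below)) (s≤s (partSize-lower n κ j))
  where
  open ≤-Reasoning
  q = n / suc κ
  regroup : ∀ κ q → suc (κ + q * suc κ + κ + 1) ≡ suc κ * suc (suc q)
  regroup = solve-∀
  below : suc κ * partSize n κ i < suc κ * suc (suc q)
  below = begin-strict
    suc κ * partSize n κ i                        ≤⟨ partSize-upper n κ i ⟩
    n + κ                                         ≡⟨ cong (_+ κ) (m≡m%n+[m/n]*n n (suc κ)) ⟩
    n % suc κ + q * suc κ + κ                     ≤⟨ +-monoˡ-≤ κ (+-monoˡ-≤ (q * suc κ) (≤-pred (m%n<n n (suc κ)))) ⟩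
    κ + q * suc κ + κ                             <⟨ s≤s (m≤m+n (κ + q * suc κ + κ) 1) ⟩
    suc (κ + q * suc κ + κ + 1)                   ≡⟨ regroup κ q ⟩
    suc κ * suc (suc q)                           ∎

embeddings-colourable : ∀ κ (G : Graph n) (bs : Vec Bool m) → Colorable G (suc κ) → embeddings G bs ≤ embeddings (turán n (suc κ)) bs
embeddings-colourable {n} {m} κ G bs (col , proper) = begin
  embeddings G bs
    ≤⟨ ∑ᵛ-mono (suc m) (λ x → *-monoʳ-≤ (distinct x) (hom-mono G K col proper bs x)) ⟩
  ∑ᵛ (suc m) (λ x → distinct x * hom K bs (map col x))
    ≡⟨ ∑ᵛ-by-colour col (suc m) (hom K bs) ⟩
  multipartiteEmbeddings (classSize col) bs
    ≤⟨ multipartiteEmbeddings-balanced bs (classSize T) balanced (classSize col) (trans (∑-count-fibres col) (sym (∑-count-fibres T))) ⟩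
  multipartiteEmbeddings (classSize T) bs
    ≡⟨ ∑ᵛ-by-colour T (suc m) (hom K bs) ⟨
  ∑ᵛ (suc m) (λ x → distinct x * hom K bs (map T x))
    ≤⟨ ∑ᵛ-mono (suc m) (λ x → *-monoʳ-≤ (distinct x) (hom-reflect (turán n (suc κ)) K T (λ u v → _∘ Equivalence.from (turánColour-≡⇔ n κ u v)) bs x)) ⟩
  embeddings (turán n (suc κ)) bs ∎
  where
  open ≤-Reasoning
  K = complete (suc κ)
  T = turánColour n κ
  balanced : ∀ i j → classSize T i ≤ suc (classSize T j)
  balanced i j = subst₂ (λ p q → p ≤ suc q) (sym (classSize-turán n κ i)) (sym (classSize-turán n κ j)) (partSize-balanced n κ i j)

turán-deg : ∀ n κ v → κ * n ≤ suc κ * deg (turán (suc n) (suc κ)) v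
turán-deg n κ v = +-cancelʳ-≤ (suc n + κ) _ _ (begin
  κ * n + (suc n + κ)                                     ≡⟨ regroup κ n ⟩
  suc κ * suc n                                           ≡⟨ cong (suc κ *_) neighbours-and-class ⟨
  suc κ * (deg T v + classSize col (col v))               ≡⟨ *-distribˡ-+ (suc κ) (deg T v) (classSize col (col v)) ⟩
  suc κ * deg T v + suc κ * classSize col (col v)         ≡⟨ cong (λ s → suc κ * deg T v + suc κ * s) (classSize-turán (suc n) κ (col v)) ⟩
  suc κ * deg T v + suc κ * partSize (suc n) κ (col v)    ≤⟨ +-monoʳ-≤ (suc κ * deg T v) (partSize-upper (suc n) κ (col v)) ⟩
  suc κ * deg T v + (suc n + κ)                           ∎)
  where
  open ≤-Reasoning
  T = turán (suc n) (suc κ)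
  col = turánColour (suc n) κ
  regroup : ∀ κ n → κ * n + (suc n + κ) ≡ suc κ * suc n
  regroup = solve-∀
  neighbours-and-class : deg T v + classSize col (col v) ≡ suc n
  neighbours-and-class = trans
    (cong (deg T v +_) (count-cong (λ u → col u ≟ col v) (λ u → ¬? (adj? T v u))
      (λ {u} e ne → ne (sym (Equivalence.to (turánColour-≡⇔ (suc n) κ u v) e)))
      (λ {u} → Equivalence.from (turánColour-≡⇔ (suc n) κ u v) ∘ sym ∘ decidable-stable (toℕ v % suc κ ≟ℕ toℕ u % suc κ))))
    (count-complement (adj? T v))

turán-free : (F : Graph m) {κ : ℕ} → χ[ F ]≡ suc (suc κ) → ∀ n → turán n (suc κ) IsFree F
turán-free F {κ} (_ , minimal) n (S , copy) with copy⇒embedding F (turán n (suc κ)) S copy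
... | φ , (_ , preserves) = 1+n≰n (minimal (suc κ) (turánColour n κ ∘ φ ,
  λ u v uv e → preserves u v uv (Equivalence.to (turánColour-≡⇔ n κ (φ u) (φ v)) e)))

-- Deletion of a vertex

deleteVertex : Graph (suc n) → Fin (suc n) → Graph n
deleteVertex G v = record
  { Adj    = λ x y → Adj G (punchIn v x) (punchIn v y)
  ; adj?   = λ x y → adj? G (punchIn v x) (punchIn v y)
  ; symm   = symm G
  ; irrefl = irrefl G
  }

deleteVertex-free : (F : Graph m) (G : Graph (suc n)) → G IsFree F → ∀ v → deleteVertex G v IsFree F
deleteVertex-free F G free v (S , copy) with copy⇒embedding F (deleteVertex G v) S copy
... | φ , (injective , preserves) = free⇒¬embedding F G free (punchIn v ∘ φ)
  ((λ e → injective (punchIn-injective v _ _ e)) , preserves)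

embeddingsThrough : Graph n → Vec Bool m → Fin n → ℕ
embeddingsThrough {m = m} G bs v = ∑ᵛ (suc m) λ x → distinct x * hom G bs x * occ v x

∑ᵛ-absent : ∀ m (v : Fin (suc n)) (f : Vec (Fin (suc n)) m → ℕ) → ∑ᵛ m (λ x → absent v x * f x) ≡ ∑ᵛ m (λ y → f (map (punchIn v) y))
∑ᵛ-absent zero    v f = +-identityʳ _
∑ᵛ-absent (suc m) v f = begin
  ∑ (λ x → ∑ᵛ m λ xs → absent v (x ∷ xs) * f (x ∷ xs))
    ≡⟨ sum-remove {i = v} (λ x → ∑ᵛ m λ xs → absent v (x ∷ xs) * f (x ∷ xs)) ⟩
  ∑ᵛ m (λ xs → absent v (v ∷ xs) * f (v ∷ xs)) + ∑ (λ y → ∑ᵛ m λ xs → absent v (punchIn v y ∷ xs) * f (punchIn v y ∷ xs))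
    ≡⟨ cong₂ _+_ (∑ᵛ-zero m λ xs → cong (_* f (v ∷ xs)) (present xs)) (sum-cong-≗ λ y → ∑ᵛ-cong m λ xs → cong (_* f (punchIn v y ∷ xs)) (skip y xs)) ⟩
  ∑ (λ y → ∑ᵛ m λ xs → absent v xs * f (punchIn v y ∷ xs))
    ≡⟨ sum-cong-≗ (λ y → ∑ᵛ-absent m v λ xs → f (punchIn v y ∷ xs)) ⟩
  ∑ (λ y → ∑ᵛ m λ ys → f (punchIn v y ∷ map (punchIn v) ys)) ∎
  where
  open ≡-Reasoning
  present : ∀ xs → absent v (v ∷ xs) ≡ 0
  present xs = cong (λ i → 𝟙 (i + occ v xs ≟ℕ 0)) (𝟙-yes (v ≟ v) refl)
  skip : ∀ y xs → absent v (punchIn v y ∷ xs) ≡ absent v xs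
  skip y xs = cong (λ i → 𝟙 (i + occ v xs ≟ℕ 0)) (𝟙-no (punchIn v y ≟ v) (punchInᵢ≢i v y))

embeddings-deleteVertex : (G : Graph (suc n)) (bs : Vec Bool m) (v : Fin (suc n)) →
  embeddings G bs ≡ embeddings (deleteVertex G v) bs + embeddingsThrough G bs v
embeddings-deleteVertex {m = m} G bs v = begin
  embeddings G bs
    ≡⟨ ∑ᵛ-cong (suc m) (λ x → trans (cong (_* hom G bs x) (sym (distinct-absent-or-once v x))) (expand (distinct x) (absent v x) (occ v x) (hom G bs x))) ⟩
  ∑ᵛ (suc m) (λ x → absent v x * (distinct x * hom G bs x) + distinct x * hom G bs x * occ v x)
    ≡⟨ ∑ᵛ-+ (suc m) (λ x → absent v x * (distinct x * hom G bs x)) (λ x → distinct x * hom G bs x * occ v x) ⟩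
  ∑ᵛ (suc m) (λ x → absent v x * (distinct x * hom G bs x)) + embeddingsThrough G bs v
    ≡⟨ cong (_+ embeddingsThrough G bs v) (trans (∑ᵛ-absent (suc m) v (λ x → distinct x * hom G bs x)) (∑ᵛ-cong (suc m) avoiding)) ⟩
  embeddings (deleteVertex G v) bs + embeddingsThrough G bs v ∎
  where
  open ≡-Reasoning
  D = deleteVertex G v
  expand : ∀ d a o h → d * (a + o) * h ≡ a * (d * h) + d * h * o
  expand = solve-∀
  avoiding : ∀ y → distinct (map (punchIn v) y) * hom G bs (map (punchIn v) y) ≡ distinct y * hom D bs y
  avoiding y = cong₂ _*_ (distinct-map (punchIn v) (punchIn-injective v _ _) y)
    (≤-antisym (hom-reflect D G (punchIn v) (λ _ _ → id) bs y) (hom-mono D G (punchIn v) (λ _ _ → id) bs y))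

toℕ-punchIn-fromℕ : ∀ n (i : Fin n) → toℕ (punchIn (fromℕ n) i) ≡ toℕ i
toℕ-punchIn-fromℕ (suc n) zero    = refl
toℕ-punchIn-fromℕ (suc n) (suc i) = cong suc (toℕ-punchIn-fromℕ n i)

turánIncrement : ∀ n κ → Vec Bool m → ℕ
turánIncrement n κ bs = embeddingsThrough (turán (suc n) (suc κ)) bs (fromℕ n)

embeddings-turán-suc : ∀ n κ (bs : Vec Bool m) → embeddings (turán (suc n) (suc κ)) bs ≡ embeddings (turán n (suc κ)) bs + turánIncrement n κ bs
embeddings-turán-suc n κ bs = trans (embeddings-deleteVertex (turán (suc n) (suc κ)) bs (fromℕ n))
  (cong (_+ turánIncrement n κ bs) (≤-antisym
    (embeddings-mono D T (λ u v → subst₂ DifferentParts (toℕ-punchIn-fromℕ n u) (toℕ-punchIn-fromℕ n v)) bs)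
    (embeddings-mono T D (λ u v → subst₂ DifferentParts (sym (toℕ-punchIn-fromℕ n u)) (sym (toℕ-punchIn-fromℕ n v))) bs)))
  where
  T = turán n (suc κ)
  D = deleteVertex (turán (suc n) (suc κ)) (fromℕ n)
  DifferentParts : ℕ → ℕ → Set
  DifferentParts a b = a % suc κ ≢ b % suc κ

-- Homomorphisms through a vertex

transfer : Graph n → Bool → (Fin n → ℕ) → Fin n → ℕ
transfer G b y v = ∑ λ u → link G b v u * y u

transfer-adjoint : (G : Graph n) (b : Bool) (x y : Fin n → ℕ) → ∑ (λ v → x v * transfer G b y v) ≡ ∑ (λ v → transfer G b x v * y v)
transfer-adjoint G b x y = trans (∑-adjoint (link G b) x y)
  (sum-cong-≗ λ u → cong (_* y u) (sum-cong-≗ λ v → cong (_* x v) (link-sym G b v u)))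

transfer≤∑ : (G : Graph n) (b : Bool) (y : Fin n → ℕ) (v : Fin n) → transfer G b y v ≤ ∑ y
transfer≤∑ G b y v = ∑-mono λ u → ≤-trans (*-monoˡ-≤ (y u) (link≤1 G b v u)) (≤-reflexive (*-identityˡ (y u)))

transfer≤ : (G : Graph n) (b : Bool) (y : Fin n → ℕ) (c : ℕ) → (∀ v → y v ≤ c) → ∀ v → transfer G b y v ≤ n * c
transfer≤ G b y c y≤c v = ≤-trans (transfer≤∑ G b y v) (∑≤n*c c y≤c)

transfer-const : (G : Graph n) (c : ℕ) (v : Fin n) → transfer G true (λ _ → c) v ≡ deg G v * c
transfer-const G c v = ∑-*ʳ c (adjacency G v)

homsFrom : Graph n → Vec Bool m → Fin n → ℕ
homsFrom G []       _ = 1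
homsFrom G (b ∷ bs)   = transfer G b (homsFrom G bs)

∑ᵛ-hom : (G : Graph n) (bs : Vec Bool m) (v : Fin n) → ∑ᵛ m (λ xs → hom G bs (v ∷ xs)) ≡ homsFrom G bs v
∑ᵛ-hom G []       v = refl
∑ᵛ-hom {m = suc m} G (b ∷ bs) v = sum-cong-≗ λ u →
  trans (∑ᵛ-*ˡ m (link G b v u) λ us → hom G bs (u ∷ us)) (cong (link G b v u *_) (∑ᵛ-hom G bs u))

homsFrom≤ : (G : Graph n) (bs : Vec Bool m) (v : Fin n) → homsFrom G bs v ≤ n ^ m
homsFrom≤ G []       v = ≤-refl
homsFrom≤ G (b ∷ bs) v = transfer≤ G b (homsFrom G bs) _ (homsFrom≤ G bs) v

homsThrough : Graph n → Vec Bool m → Fin n → ℕ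
homsThrough {m = m} G bs z = ∑ᵛ (suc m) λ x → hom G bs x * occ z x

∑-homsThrough : (G : Graph n) (bs : Vec Bool m) → ∑ (homsThrough G bs) ≡ suc m * ∑ (homsFrom G bs)
∑-homsThrough {n} {m} G bs = begin
  ∑ (λ z → ∑ᵛ (suc m) λ x → hom G bs x * occ z x)       ≡⟨ ∑ᵛ-∑ (suc m) (λ x z → hom G bs x * occ z x) ⟨
  ∑ᵛ (suc m) (λ x → ∑ λ z → hom G bs x * occ z x)
    ≡⟨ ∑ᵛ-cong (suc m) (λ x → trans (∑-*ˡ (hom G bs x) λ z → occ z x) (trans (cong (hom G bs x *_) (∑-occ x)) (*-comm (hom G bs x) (suc m)))) ⟩
  ∑ᵛ (suc m) (λ x → suc m * hom G bs x)                 ≡⟨ ∑ᵛ-*ˡ (suc m) (suc m) (hom G bs) ⟩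
  suc m * ∑ᵛ (suc m) (hom G bs)                         ≡⟨ cong (suc m *_) (sum-cong-≗ (∑ᵛ-hom G bs)) ⟩
  suc m * ∑ (homsFrom G bs)                             ∎
  where open ≡-Reasoning

-- The homomorphisms through z, summed over the position of z; y weighs the part before the
-- current position.
weightedHomsThrough : Graph n → Fin n → (Fin n → ℕ) → Vec Bool m → ℕ
weightedHomsThrough G z y []       = y z
weightedHomsThrough G z y (b ∷ bs) = y z * homsFrom G (b ∷ bs) z + weightedHomsThrough G z (transfer G b y) bs

homsThroughFrom : Graph n → Fin n → Vec Bool m → Fin n → ℕ
homsThroughFrom {m = m} G z bs v = ∑ᵛ m λ xs → hom G bs (v ∷ xs) * occ z (v ∷ xs)

homsThroughFrom-∷ : (G : Graph n) (z : Fin n) (b : Bool) (bs : Vec Bool m) (v : Fin n) →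
  homsThroughFrom G z (b ∷ bs) v ≡ 𝟙 (v ≟ z) * homsFrom G (b ∷ bs) v + transfer G b (homsThroughFrom G z bs) v
homsThroughFrom-∷ {m = m} G z b bs v = begin
  ∑ (λ u → ∑ᵛ m λ us → link G b v u * hom G bs (u ∷ us) * (𝟙 (v ≟ z) + occ z (u ∷ us)))
    ≡⟨ sum-cong-≗ (λ u → ∑ᵛ-cong m λ us → expand (link G b v u) (hom G bs (u ∷ us)) (𝟙 (v ≟ z)) (occ z (u ∷ us))) ⟩
  ∑ (λ u → ∑ᵛ m λ us → 𝟙 (v ≟ z) * (link G b v u * hom G bs (u ∷ us)) + link G b v u * (hom G bs (u ∷ us) * occ z (u ∷ us)))
    ≡⟨ sum-cong-≗ (λ u → trans (∑ᵛ-+ m (λ us → 𝟙 (v ≟ z) * (link G b v u * hom G bs (u ∷ us))) _)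
         (cong₂ _+_ (∑ᵛ-*ˡ m (𝟙 (v ≟ z)) (λ us → link G b v u * hom G bs (u ∷ us))) (∑ᵛ-*ˡ m (link G b v u) λ us → hom G bs (u ∷ us) * occ z (u ∷ us)))) ⟩
  ∑ (λ u → 𝟙 (v ≟ z) * ∑ᵛ m (λ us → link G b v u * hom G bs (u ∷ us)) + link G b v u * homsThroughFrom G z bs u)
    ≡⟨ ∑-distrib-+ (λ u → 𝟙 (v ≟ z) * ∑ᵛ m (λ us → link G b v u * hom G bs (u ∷ us))) _ ⟩
  ∑ (λ u → 𝟙 (v ≟ z) * ∑ᵛ m (λ us → link G b v u * hom G bs (u ∷ us))) + transfer G b (homsThroughFrom G z bs) v
    ≡⟨ cong (_+ transfer G b (homsThroughFrom G z bs) v)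
         (trans (∑-*ˡ (𝟙 (v ≟ z)) λ u → ∑ᵛ m (λ us → link G b v u * hom G bs (u ∷ us))) (cong (𝟙 (v ≟ z) *_) (∑ᵛ-hom G (b ∷ bs) v))) ⟩
  𝟙 (v ≟ z) * homsFrom G (b ∷ bs) v + transfer G b (homsThroughFrom G z bs) v ∎
  where
  open ≡-Reasoning
  expand : ∀ l h i o → l * h * (i + o) ≡ i * (l * h) + l * (h * o)
  expand = solve-∀

∑-homsThroughFrom : (G : Graph n) (z : Fin n) (y : Fin n → ℕ) (bs : Vec Bool m) →
  ∑ (λ v → y v * homsThroughFrom G z bs v) ≡ weightedHomsThrough G z y bs
∑-homsThroughFrom G z y [] = trans (sum-cong-≗ λ v → simplify (y v) (𝟙 (v ≟ z))) (∑-δ z y)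
  where
  simplify : ∀ p q → p * (1 * (q + 0)) ≡ q * p
  simplify = solve-∀
∑-homsThroughFrom G z y (b ∷ bs) = begin
  ∑ (λ v → y v * homsThroughFrom G z (b ∷ bs) v)
    ≡⟨ sum-cong-≗ (λ v → trans (cong (y v *_) (homsThroughFrom-∷ G z b bs v)) (expand (y v) (𝟙 (v ≟ z)) (homsFrom G (b ∷ bs) v) (transfer G b (homsThroughFrom G z bs) v))) ⟩
  ∑ (λ v → 𝟙 (v ≟ z) * (y v * homsFrom G (b ∷ bs) v) + y v * transfer G b (homsThroughFrom G z bs) v)
    ≡⟨ ∑-distrib-+ (λ v → 𝟙 (v ≟ z) * (y v * homsFrom G (b ∷ bs) v)) _ ⟩
  ∑ (λ v → 𝟙 (v ≟ z) * (y v * homsFrom G (b ∷ bs) v)) + ∑ (λ v → y v * transfer G b (homsThroughFrom G z bs) v)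
    ≡⟨ cong₂ _+_ (∑-δ z λ v → y v * homsFrom G (b ∷ bs) v) (transfer-adjoint G b y (homsThroughFrom G z bs)) ⟩
  y z * homsFrom G (b ∷ bs) z + ∑ (λ u → transfer G b y u * homsThroughFrom G z bs u)
    ≡⟨ cong (y z * homsFrom G (b ∷ bs) z +_) (∑-homsThroughFrom G z (transfer G b y) bs) ⟩
  weightedHomsThrough G z y (b ∷ bs) ∎
  where
  open ≡-Reasoning
  expand : ∀ p q r s → p * (q * r + s) ≡ q * (p * r) + p * s
  expand = solve-∀

homsThrough≡weighted : (G : Graph n) (bs : Vec Bool m) (z : Fin n) → homsThrough G bs z ≡ weightedHomsThrough G z (λ _ → 1) bs
homsThrough≡weighted G bs z = trans (sum-cong-≗ λ v → sym (*-identityˡ (homsThroughFrom G z bs v))) (∑-homsThroughFrom G z (λ _ → 1) bs)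

embeddingsThrough≤homsThrough : (G : Graph n) (bs : Vec Bool m) (z : Fin n) → embeddingsThrough G bs z ≤ homsThrough G bs z
embeddingsThrough≤homsThrough {m = m} G bs z = ∑ᵛ-mono (suc m) λ x → *-monoˡ-≤ (occ z x)
  (≤-trans (*-monoˡ-≤ (hom G bs x) (distinct≤1 x)) (≤-reflexive (*-identityˡ _)))

collisions : Vec (Fin n) m → ℕ
collisions []       = 0
collisions (x ∷ xs) = occ x xs + collisions xs

1≤distinct+collisions : (x : Vec (Fin n) m) → 1 ≤ distinct x + collisions x
1≤distinct+collisions []       = ≤-refl
1≤distinct+collisions (x ∷ xs) with occ x xs
... | zero  = ≤-trans (1≤distinct+collisions xs) (+-monoˡ-≤ _ (m≤m+n (distinct xs) 0))
... | suc _ = s≤s z≤n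

∑ᵛ-occ : ∀ m (z : Fin n) → n * ∑ᵛ m (occ z) ≡ m * n ^ m
∑ᵛ-occ {n} zero    z = *-zeroʳ n
∑ᵛ-occ {n} (suc m) z = begin
  n * ∑ (λ x → ∑ᵛ m λ xs → 𝟙 (x ≟ z) + occ z xs)
    ≡⟨ cong (n *_) (trans (sum-cong-≗ λ x → ∑ᵛ-+ m (λ _ → 𝟙 (x ≟ z)) (occ z)) (∑-distrib-+ (λ x → ∑ᵛ m λ _ → 𝟙 (x ≟ z)) _)) ⟩
  n * (∑ (λ x → ∑ᵛ m λ _ → 𝟙 (x ≟ z)) + ∑ {n} (λ _ → ∑ᵛ m (occ z)))
    ≡⟨ cong (n *_) (cong₂ _+_ (trans (sum-cong-≗ λ x → trans (∑ᵛ-const m (𝟙 (x ≟ z))) (*-comm (n ^ m) (𝟙 (x ≟ z)))) (∑-δ z λ _ → n ^ m)) (∑-const n _)) ⟩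
  n * (n ^ m + n * ∑ᵛ m (occ z))   ≡⟨ cong (λ t → n * (n ^ m + t)) (∑ᵛ-occ m z) ⟩
  n * (n ^ m + m * n ^ m)          ≡⟨ x∙yz≈y∙xz n (suc m) (n ^ m) ⟩
  suc m * (n * n ^ m)              ∎
  where open ≡-Reasoning

∑ᵛ-collisions≤ : ∀ m → n * ∑ᵛ {n} m collisions ≤ m * m * n ^ m
∑ᵛ-collisions≤ {n} zero    = ≤-reflexive (*-zeroʳ n)
∑ᵛ-collisions≤ {n} (suc m) = begin
  n * ∑ {n} (λ x → ∑ᵛ m λ xs → occ x xs + collisions xs)
    ≡⟨ cong (n *_) (trans (sum-cong-≗ {n} λ x → ∑ᵛ-+ m (occ x) collisions) (∑-distrib-+ {n} (λ x → ∑ᵛ m (occ x)) (λ _ → ∑ᵛ m collisions))) ⟩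
  n * (∑ {n} (λ x → ∑ᵛ m (occ x)) + ∑ {n} (λ _ → ∑ᵛ m collisions))
    ≡⟨ cong (n *_) (cong₂ _+_ (trans (sym (∑ᵛ-∑ m λ xs x → occ x xs)) (trans (∑ᵛ-cong m ∑-occ) (∑ᵛ-const m m))) (∑-const n _)) ⟩
  n * (n ^ m * m + n * ∑ᵛ m collisions)  ≤⟨ *-monoʳ-≤ n (+-monoʳ-≤ (n ^ m * m) (∑ᵛ-collisions≤ m)) ⟩
  n * (n ^ m * m + m * m * n ^ m)        ≤⟨ m≤m+n _ (suc m * (n * n ^ m)) ⟩
  n * (n ^ m * m + m * m * n ^ m) + suc m * (n * n ^ m)  ≡⟨ collect n m (n ^ m) ⟩
  suc m * suc m * (n * n ^ m)            ∎
  where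
  open ≤-Reasoning
  collect : ∀ n m p → n * (p * m + m * m * p) + suc m * (n * p) ≡ suc m * suc m * (n * p)
  collect = solve-∀

∑-collisions*occ : (z : Fin n) (xs : Vec (Fin n) m) →
  ∑ (λ x → collisions (x ∷ xs) * occ z (x ∷ xs)) ≡ suc m * occ z xs + collisions xs + n * (collisions xs * occ z xs)
∑-collisions*occ {n} {m} z xs = begin
  ∑ (λ x → (occ x xs + c) * (𝟙 (x ≟ z) + o))                            ≡⟨ sum-cong-≗ (λ x → expand (occ x xs) c (𝟙 (x ≟ z)) o) ⟩
  ∑ (λ x → 𝟙 (x ≟ z) * (occ x xs + c) + (o * occ x xs + c * o))         ≡⟨ ∑-distrib-+ (λ x → 𝟙 (x ≟ z) * (occ x xs + c)) _ ⟩
  ∑ (λ x → 𝟙 (x ≟ z) * (occ x xs + c)) + ∑ (λ x → o * occ x xs + c * o) ≡⟨ cong₂ _+_ (∑-δ z λ x → occ x xs + c) (∑-distrib-+ (λ x → o * occ x xs) _) ⟩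
  o + c + (∑ (λ x → o * occ x xs) + ∑ {n} (λ _ → c * o))
    ≡⟨ cong (o + c +_) (cong₂ _+_ (trans (∑-*ˡ o λ x → occ x xs) (cong (o *_) (∑-occ xs))) (∑-const n _)) ⟩
  o + c + (o * m + n * (c * o))                                         ≡⟨ collect o c m n ⟩
  suc m * o + c + n * (c * o)                                           ∎
  where
  open ≡-Reasoning
  o = occ z xs
  c = collisions xs
  expand : ∀ a c i o → (a + c) * (i + o) ≡ i * (a + c) + (o * a + c * o)
  expand = solve-∀
  collect : ∀ o c m n → o + c + (o * m + n * (c * o)) ≡ suc m * o + c + n * (c * o)
  collect = solve-∀

∑ᵛ-collisions*occ≤ : ∀ m (z : Fin n) → n * (n * ∑ᵛ m (λ x → collisions x * occ z x)) ≤ m * m * m * n ^ m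
∑ᵛ-collisions*occ≤ {n} zero    z = ≤-reflexive (trans (cong (n *_) (*-zeroʳ n)) (*-zeroʳ n))
∑ᵛ-collisions*occ≤ {n} (suc m) z = begin
  n * (n * ∑ (λ x → ∑ᵛ m λ xs → collisions (x ∷ xs) * occ z (x ∷ xs)))
    ≡⟨ cong (λ t → n * (n * t)) (trans (sym (∑ᵛ-∑ m λ xs x → collisions (x ∷ xs) * occ z (x ∷ xs))) (∑ᵛ-cong m (∑-collisions*occ z))) ⟩
  n * (n * ∑ᵛ m (λ xs → suc m * occ z xs + collisions xs + n * (collisions xs * occ z xs)))
    ≡⟨ cong (λ t → n * (n * t)) (trans (∑ᵛ-+ m (λ xs → suc m * occ z xs + collisions xs) _)
         (cong₂ _+_ (trans (∑ᵛ-+ m (λ xs → suc m * occ z xs) _) (cong (_+ ∑ᵛ m collisions) (∑ᵛ-*ˡ m (suc m) (occ z)))) (∑ᵛ-*ˡ m n λ xs → collisions xs * occ z xs))) ⟩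
  n * (n * (suc m * O + C + n * B))                              ≡⟨ expand n (suc m) O C B ⟩
  n * (suc m * (n * O) + n * C + n * (n * B))
    ≤⟨ *-monoʳ-≤ n (+-mono-≤ (+-mono-≤ (≤-reflexive (cong (suc m *_) (∑ᵛ-occ m z))) (∑ᵛ-collisions≤ m)) (∑ᵛ-collisions*occ≤ m z)) ⟩
  n * (suc m * (m * p) + m * m * p + m * m * m * p)              ≤⟨ m≤m+n _ (suc (m * m + 2 * m) * (n * p)) ⟩
  n * (suc m * (m * p) + m * m * p + m * m * m * p) + suc (m * m + 2 * m) * (n * p)  ≡⟨ collect n m p ⟩
  suc m * suc m * suc m * (n * p)                                ∎
  where
  open ≤-Reasoning
  p = n ^ m
  O = ∑ᵛ m (occ z)
  C = ∑ᵛ {n} m collisions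
  B = ∑ᵛ m (λ xs → collisions xs * occ z xs)
  expand : ∀ n s o c b → n * (n * (s * o + c + n * b)) ≡ n * (s * (n * o) + n * c + n * (n * b))
  expand = solve-∀
  collect : ∀ n m p → n * (suc m * (m * p) + m * m * p + m * m * m * p) + suc (m * m + 2 * m) * (n * p) ≡ suc m * suc m * suc m * (n * p)
  collect = solve-∀

homsThrough≤embeddingsThrough+collisions : (G : Graph n) (bs : Vec Bool m) (z : Fin n) →
  homsThrough G bs z ≤ embeddingsThrough G bs z + ∑ᵛ (suc m) (λ x → collisions x * occ z x)
homsThrough≤embeddingsThrough+collisions {m = m} G bs z = ≤-trans (∑ᵛ-mono (suc m) bound)
  (≤-reflexive (∑ᵛ-+ (suc m) (λ x → distinct x * hom G bs x * occ z x) (λ x → collisions x * occ z x)))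
  where
  open ≤-Reasoning
  expand : ∀ d c h o → (d + c) * (h * o) ≡ d * h * o + h * (c * o)
  expand = solve-∀
  bound : ∀ x → hom G bs x * occ z x ≤ distinct x * hom G bs x * occ z x + collisions x * occ z x
  bound x = begin
    h * o                              ≡⟨ *-identityˡ _ ⟨
    1 * (h * o)                        ≤⟨ *-monoˡ-≤ (h * o) (1≤distinct+collisions x) ⟩
    (distinct x + c) * (h * o)         ≡⟨ expand (distinct x) c h o ⟩
    distinct x * h * o + h * (c * o)   ≤⟨ +-monoʳ-≤ _ (*-monoˡ-≤ (c * o) (hom≤1 G bs x)) ⟩
    distinct x * h * o + 1 * (c * o)   ≡⟨ cong (distinct x * h * o +_) (*-identityˡ _) ⟩
    distinct x * h * o + c * o         ∎
    where
    h = hom G bs x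
    o = occ z x
    c = collisions x

module LargeMinDegree {n : ℕ} (G : Graph (suc n)) (κ : ℕ) (minDegree : ∀ v → κ * n ≤ suc κ * deg G v) where

  -- c ≥ (κ / (κ + 1)) ^ e * n ^ d
  AtLeast : ℕ → ℕ → ℕ → Set
  AtLeast e d c = κ ^ e * n ^ d ≤ suc κ ^ e * c

  atLeast-* : ∀ e d e′ d′ {c c′} → AtLeast e d c → AtLeast e′ d′ c′ → AtLeast (e + e′) (d + d′) (c * c′)
  atLeast-* e d e′ d′ {c} {c′} h h′ rewrite ^-distribˡ-+-* κ e e′ | ^-distribˡ-+-* n d d′ | ^-distribˡ-+-* (suc κ) e e′ =
    subst₂ _≤_ (interchange (κ ^ e) (n ^ d) (κ ^ e′) (n ^ d′)) (interchange (suc κ ^ e) c (suc κ ^ e′) c′) (*-mono-≤ h h′)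

  atLeast-transfer-true : ∀ e d y → (∀ v → AtLeast e d (y v)) → ∀ v → AtLeast (suc e) (suc d) (transfer G true y v)
  atLeast-transfer-true e d y y≥ v = begin
    κ * κ ^ e * (n * n ^ d)                            ≡⟨ interchange κ (κ ^ e) n (n ^ d) ⟩
    κ * n * (κ ^ e * n ^ d)                            ≤⟨ *-monoˡ-≤ (κ ^ e * n ^ d) (minDegree v) ⟩
    suc κ * deg G v * (κ ^ e * n ^ d)                  ≡⟨ *-assoc (suc κ) (deg G v) _ ⟩
    suc κ * (deg G v * (κ ^ e * n ^ d))                ≡⟨ cong (suc κ *_) (*-distribʳ-sum (κ ^ e * n ^ d) (adjacency G v)) ⟩
    suc κ * ∑ (λ u → adjacency G v u * (κ ^ e * n ^ d))        ≤⟨ *-monoʳ-≤ (suc κ) (∑-mono λ u → *-monoʳ-≤ (adjacency G v u) (y≥ u)) ⟩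
    suc κ * ∑ (λ u → adjacency G v u * (suc κ ^ e * y u))
      ≡⟨ cong (suc κ *_) (trans (sum-cong-≗ λ u → x∙yz≈y∙xz (adjacency G v u) (suc κ ^ e) (y u)) (∑-*ˡ (suc κ ^ e) λ u → adjacency G v u * y u)) ⟩
    suc κ * (suc κ ^ e * transfer G true y v)          ≡⟨ *-assoc (suc κ) (suc κ ^ e) _ ⟨
    suc κ * suc κ ^ e * transfer G true y v            ∎
    where open ≤-Reasoning

  atLeast-transfer-false : ∀ e d y → (∀ v → AtLeast e d (y v)) → ∀ v → AtLeast e (suc d) (transfer G false y v)
  atLeast-transfer-false e d y y≥ v = begin
    κ ^ e * (n * n ^ d)                   ≤⟨ *-monoʳ-≤ (κ ^ e) (*-monoˡ-≤ (n ^ d) (n≤1+n n)) ⟩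
    κ ^ e * (suc n * n ^ d)               ≡⟨ x∙yz≈y∙xz (κ ^ e) (suc n) (n ^ d) ⟩
    suc n * (κ ^ e * n ^ d)               ≡⟨ ∑-const (suc n) (κ ^ e * n ^ d) ⟨
    ∑ {suc n} (λ u → κ ^ e * n ^ d)       ≤⟨ ∑-mono (λ u → ≤-trans (y≥ u) (≤-reflexive (cong (suc κ ^ e *_) (sym (*-identityˡ (y u)))))) ⟩
    ∑ (λ u → suc κ ^ e * (1 * y u))       ≡⟨ ∑-*ˡ (suc κ ^ e) (λ u → 1 * y u) ⟩
    suc κ ^ e * transfer G false y v      ∎
    where open ≤-Reasoning

  homsFrom-atLeast : (bs : Vec Bool m) (v : Fin (suc n)) → AtLeast (edgeCount bs) m (homsFrom G bs v)
  homsFrom-atLeast []           v = ≤-refl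
  homsFrom-atLeast {suc m} (true ∷ bs)  v = atLeast-transfer-true (edgeCount bs) m (homsFrom G bs) (homsFrom-atLeast bs) v
  homsFrom-atLeast {suc m} (false ∷ bs) v = atLeast-transfer-false (edgeCount bs) m (homsFrom G bs) (homsFrom-atLeast bs) v

  weightedHomsThrough-lower : ∀ e d y (bs : Vec Bool m) z → (∀ v → AtLeast e d (y v)) →
    suc m * (κ ^ (e + edgeCount bs) * n ^ (d + m)) ≤ suc κ ^ (e + edgeCount bs) * weightedHomsThrough G z y bs
  weightedHomsThrough-lower e d y [] z y≥ rewrite +-identityʳ e | +-identityʳ d | +-identityʳ (κ ^ e * n ^ d) = y≥ z
  weightedHomsThrough-lower {suc m} e d y (b ∷ bs) z y≥ = ≤-trans
    (+-mono-≤ (atLeast-* e d (edgeCount (b ∷ bs)) (suc m) (y≥ z) (homsFrom-atLeast (b ∷ bs) z)) (later b))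
    (≤-reflexive (sym (*-distribˡ-+ (suc κ ^ (e + edgeCount (b ∷ bs))) (y z * homsFrom G (b ∷ bs) z) _)))
    where
    later : ∀ b → suc m * (κ ^ (e + edgeCount (b ∷ bs)) * n ^ (d + suc m)) ≤
      suc κ ^ (e + edgeCount (b ∷ bs)) * weightedHomsThrough G z (transfer G b y) bs
    later true  rewrite +-suc e (edgeCount bs) | +-suc d m =
      weightedHomsThrough-lower (suc e) (suc d) (transfer G true y) bs z (atLeast-transfer-true e d y y≥)
    later false rewrite +-suc d m =
      weightedHomsThrough-lower e (suc d) (transfer G false y) bs z (atLeast-transfer-false e d y y≥)

  homsThrough-lower : (bs : Vec Bool m) (z : Fin (suc n)) → suc m * (κ ^ edgeCount bs * n ^ m) ≤ suc κ ^ edgeCount bs * homsThrough G bs z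
  homsThrough-lower bs z rewrite homsThrough≡weighted G bs z = weightedHomsThrough-lower 0 0 (λ _ → 1) bs z (λ _ → ≤-refl)

-- Complete multipartite subgraphs of dense graphs

record Blowup (G : Graph n) (j t : ℕ) : Set where
  field
    part           : Fin j → Fin t → Fin n
    part-injective : ∀ i → Injective _≡_ _≡_ (part i)
    joined         : ∀ {i i′} → i ≢ i′ → ∀ x y → Adj G (part i x) (part i′ y)

open Blowup public

module _ {n : ℕ} {G : Graph n} where

  Inside : ∀ {j t} → Blowup G j t → (Fin j → Fin n → Set) → Set
  Inside B W = ∀ i x → W i (part B i x)

  emptyBlowup : ∀ {t} → Blowup G 0 t
  emptyBlowup = record { part = λ () ; part-injective = λ () ; joined = λ { {()} } }

  subBlowup : ∀ {j t s} (B : Blowup G j t) {U : Fin j → Fin t → Set} → (∀ i → Selection (U i) s) → Blowup G j s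
  subBlowup B σ = record
    { part           = λ i → part B i ∘ select (σ i)
    ; part-injective = λ i → select-injective (σ i) ∘ part-injective B i
    ; joined         = λ i≢i′ x y → joined B i≢i′ (select (σ _) x) (select (σ _) y)
    }

  addPart : ∀ {j t} {P : Fin n → Set} (S : Selection P t) (B : Blowup G j t) → (∀ x i y → Adj G (select S x) (part B i y)) → Blowup G (suc j) t
  addPart {j} {t} S B adjacent = record { part = part′ ; part-injective = injective ; joined = λ {i} {i′} → joined′ i i′ }
    where
    part′ : Fin (suc j) → Fin t → Fin n
    part′ zero    = select S
    part′ (suc i) = part B i
    injective : ∀ i → Injective _≡_ _≡_ (part′ i)
    injective zero    = select-injective S
    injective (suc i) = part-injective B i
    joined′ : ∀ i i′ → i ≢ i′ → ∀ x y → Adj G (part′ i x) (part′ i′ y)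
    joined′ zero    zero     i≢i′ x y = contradiction refl i≢i′
    joined′ zero    (suc i′) i≢i′ x y = adjacent x i′ y
    joined′ (suc i) zero     i≢i′ x y = symm G (adjacent y i x)
    joined′ (suc i) (suc i′) i≢i′ x y = joined B (i≢i′ ∘ cong suc) x y

homogeneous : ∀ m {q : Fin m → Fin n → Set} (q? : ∀ i → Decidable (q i)) {U : Fin n → Set} (U? : Decidable U) t → t * 2 ^ m ≤ count U? →
  Σ[ S ∈ Selection U t ] (∀ i x y → q i (select S x) → q i (select S y))
homogeneous zero    q? U? t le = selection U? t (subst (_≤ count U?) (*-identityʳ t) le) , λ ()
homogeneous {n} (suc m) {q} q? {U} U? t le = by-majority (t * 2 ^ m ≤? count inside?)
  where
  Homogeneous : Set
  Homogeneous = Σ[ S ∈ Selection U t ] (∀ i x y → q i (select S x) → q i (select S y))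
  inside? outside? : Decidable _
  inside? v  = U? v ×-dec q? zero v
  outside? v = U? v ×-dec ¬? (q? zero v)
  refine : {V : Fin n → Set} (V? : Decidable V) → (∀ {v} → V v → U v) → (∀ {v w} → V v → V w → q zero v → q zero w) →
    t * 2 ^ m ≤ count V? → Homogeneous
  refine V? V⊆U agree le′ with homogeneous m (q? ∘ suc) V? t le′
  ... | S , same = record { select = select S ; select-injective = select-injective S ; select-member = V⊆U ∘ select-member S } ,
    λ { zero x y → agree (select-member S x) (select-member S y) ; (suc i) → same i }
  double : ∀ t p → t * (2 * p) ≡ t * p + t * p
  double = solve-∀
  by-majority : Dec (t * 2 ^ m ≤ count inside?) → Homogeneous
  by-majority (yes many) = refine inside? proj₁ (λ _ (_ , qw) _ → qw) many
  by-majority (no few)   = refine outside? proj₁ (λ (_ , ¬qv) _ qv → contradiction qv ¬qv) (+-cancelˡ-≤ (t * 2 ^ m) _ _ (begin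
    t * 2 ^ m + t * 2 ^ m              ≡⟨ double t (2 ^ m) ⟨
    t * 2 ^ suc m                      ≤⟨ le ⟩
    count U?                           ≡⟨ count-split U? (q? zero) ⟩
    count inside? + count outside?     ≤⟨ +-monoˡ-≤ (count outside?) (<⇒≤ (≰⇒> few)) ⟩
    t * 2 ^ m + count outside?         ∎))
    where open ≤-Reasoning

-- Every vertex of positive weight sees more than a proportion (K - 1) / K of the total weight,
-- with a margin of n M / L.
record Dense (G : Graph n) (x : Fin n → ℕ) (K L M : ℕ) : Set where
  field
    bounded  : ∀ v → x v ≤ M
    positive : 0 < ∑ x
    degrees  : ∀ v → 0 < x v → L * (K * ∑ x) + n * M ≤ L * (K * transfer G true x v + ∑ x)

open Dense public

∑≤M*support : (M : ℕ) (x : Fin n → ℕ) → (∀ v → x v ≤ M) → ∑ x ≤ M * count (λ v → 0 <? x v)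
∑≤M*support M x x≤M = ≤-trans (∑-mono λ v → bound (0 <? x v)) (≤-reflexive (∑-*ˡ M λ v → 𝟙 (0 <? x v)))
  where
  bound : ∀ {v} (d : Dec (0 < x v)) → x v ≤ M * 𝟙 d
  bound (yes _)   = ≤-trans (x≤M _) (≤-reflexive (sym (*-identityʳ M)))
  bound (no x≯0)  = ≤-trans (≮⇒≥ x≯0) z≤n

module _ {n : ℕ} {G : Graph n} {x : Fin n → ℕ} {K L M : ℕ} (dense : Dense G x K L M) where

  dense⇒0<M : 0 < M
  dense⇒0<M = let v , 0<xv = ∑-pos⇒∃ x (positive dense) in ≤-trans 0<xv (bounded dense v)

  dense⇒large-support : n ≤ L * count (λ v → 0 <? x v)
  dense⇒large-support = *-cancelˡ-≤ M {{>-nonZero dense⇒0<M}} (begin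
    M * n              ≡⟨ *-comm M n ⟩
    n * M              ≤⟨ +-cancelˡ-≤ (L * (K * ∑ x)) _ _ margin ⟩
    L * (M * support)  ≡⟨ x∙yz≈y∙xz L M support ⟩
    M * (L * support)  ∎)
    where
    open ≤-Reasoning
    support = count (λ v → 0 <? x v)
    margin : L * (K * ∑ x) + n * M ≤ L * (K * ∑ x) + L * (M * support)
    margin = let v , 0<xv = ∑-pos⇒∃ x (positive dense) in begin
      L * (K * ∑ x) + n * M                      ≤⟨ degrees dense v 0<xv ⟩
      L * (K * transfer G true x v + ∑ x)        ≤⟨ *-monoʳ-≤ L (+-mono-≤ (*-monoʳ-≤ K (transfer≤∑ G true x v)) (∑≤M*support M x (bounded dense))) ⟩
      L * (K * ∑ x + M * support)                ≡⟨ *-distribˡ-+ L (K * ∑ x) _ ⟩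
      L * (K * ∑ x) + L * (M * support)          ∎

∑-with-small-term : ∀ {j} (c : Fin j → ℕ) T t i → (∀ i → c i ≤ T) → c i ≤ t → ∑ c + T ≤ j * T + t
∑-with-small-term {suc j} c T t i c≤T ci≤t = begin
  ∑ c + T                                  ≡⟨ cong (_+ T) (sum-remove {i = i} c) ⟩
  c i + ∑ (λ i′ → c (punchIn i i′)) + T    ≤⟨ +-monoˡ-≤ T (+-mono-≤ ci≤t (∑≤n*c {j} T λ i′ → c≤T (punchIn i i′))) ⟩
  t + j * T + T                            ≡⟨ rotate t (j * T) T ⟩
  suc j * T + t                            ∎
  where
  open ≤-Reasoning
  rotate : ∀ a b c → a + b + c ≡ c + b + a
  rotate = solve-∀

-- A blowup with j parts of size T = 2LKt in the support is extended by a part consisting of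
-- vertices with at least t neighbours in each of the parts; such vertices carry much weight.
module ExtendBlowup {n : ℕ} {G : Graph n} {x : Fin n → ℕ} {K L M : ℕ} (1≤L : 1 ≤ L) (1≤K : 1 ≤ K) (dense : Dense G x K L M)
  {j t : ℕ} (1≤t : 1 ≤ t) (1≤j : 1 ≤ j) (j≤K : j ≤ K)
  (B : Blowup G j (2 * (L * K * t))) (B⊆support : Inside B (λ _ v → 0 < x v)) where

  T X : ℕ
  T = 2 * (L * K * t)
  X = ∑ x

  hits : Fin j → Fin n → ℕ
  hits i u = count λ y → adj? G u (part B i y)

  hits≤T : ∀ i u → hits i u ≤ T
  hits≤T i u = count≤n λ y → adj? G u (part B i y)

  Rich : Fin n → Set
  Rich u = 0 < x u × (∀ i → t ≤ hits i u)

  rich? : Decidable Rich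
  rich? u = (0 <? x u) ×-dec all? (λ i → t ≤? hits i u)

  hitWeight richWeight : ℕ
  hitWeight  = ∑ λ u → x u * ∑ λ i → hits i u
  richWeight = ∑ λ u → x u * 𝟙 (rich? u)

  hitWeight≡∑degrees : hitWeight ≡ ∑ λ i → ∑ λ y → transfer G true x (part B i y)
  hitWeight≡∑degrees = begin
    ∑ (λ u → x u * ∑ λ i → hits i u)                              ≡⟨ sum-cong-≗ (λ u → *-distribˡ-sum (x u) λ i → hits i u) ⟩
    ∑ (λ u → ∑ λ i → x u * hits i u)                              ≡⟨ ∑-comm (λ u i → x u * hits i u) ⟩
    ∑ (λ i → ∑ λ u → x u * hits i u)
      ≡⟨ sum-cong-≗ (λ i → sum-cong-≗ λ u → *-distribˡ-sum (x u) λ y → adjacency G u (part B i y)) ⟩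
    ∑ (λ i → ∑ λ u → ∑ λ y → x u * adjacency G u (part B i y))    ≡⟨ sum-cong-≗ (λ i → ∑-comm λ u y → x u * adjacency G u (part B i y)) ⟩
    ∑ (λ i → ∑ λ y → ∑ λ u → x u * adjacency G u (part B i y))    ≡⟨ sum-cong-≗ (λ i → sum-cong-≗ λ y → sum-cong-≗ λ u →
                                                                       trans (*-comm (x u) _) (cong (_* x u) (link-sym G true u (part B i y)))) ⟩
    ∑ (λ i → ∑ λ y → transfer G true x (part B i y))              ∎
    where open ≡-Reasoning

  open ≤-Reasoning

  hitWeight-lower : j * T * (L * (K * X) + n * M) ≤ L * K * hitWeight + j * T * (L * X)
  hitWeight-lower = begin
    j * T * (L * (K * X) + n * M)                                     ≡⟨ trans (*-assoc j T _) (sym (∑∑-const (L * (K * X) + n * M))) ⟩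
    ∑ {j} (λ i → ∑ {T} λ y → L * (K * X) + n * M)                     ≤⟨ ∑-mono (λ i → ∑-mono λ y → degrees dense (part B i y) (B⊆support i y)) ⟩
    ∑ (λ i → ∑ λ y → L * (K * d i y + X))
      ≡⟨ sum-cong-≗ (λ i → trans (sum-cong-≗ λ y → expand L K (d i y) X) (∑-distrib-+ (λ y → L * K * d i y) _)) ⟩
    ∑ (λ i → ∑ (λ y → L * K * d i y) + ∑ {T} (λ _ → L * X))           ≡⟨ ∑-distrib-+ (λ i → ∑ λ y → L * K * d i y) _ ⟩
    ∑ (λ i → ∑ λ y → L * K * d i y) + ∑ {j} (λ i → ∑ {T} λ _ → L * X)
      ≡⟨ cong₂ _+_ (trans (sum-cong-≗ λ i → ∑-*ˡ (L * K) (d i)) (∑-*ˡ (L * K) λ i → ∑ (d i))) (trans (∑∑-const (L * X)) (sym (*-assoc j T _))) ⟩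
    L * K * ∑ (λ i → ∑ (d i)) + j * T * (L * X)                       ≡⟨ cong (λ h → L * K * h + j * T * (L * X)) hitWeight≡∑degrees ⟨
    L * K * hitWeight + j * T * (L * X)                               ∎
    where
    d : Fin j → Fin T → ℕ
    d i y = transfer G true x (part B i y)
    expand : ∀ l k d x → l * (k * d + x) ≡ l * k * d + l * x
    expand = solve-∀
    ∑∑-const : ∀ c → ∑ {j} (λ i → ∑ {T} λ y → c) ≡ j * (T * c)
    ∑∑-const c = trans (sum-cong-≗ {j} λ _ → ∑-const T c) (∑-const j _)

  hits-upper : ∀ u → 0 < x u → (d : Dec (Rich u)) → ∑ (λ i → hits i u) + T ≤ (j * T + t) + T * 𝟙 d
  hits-upper u 0<xu (yes _)   = +-mono-≤ (≤-trans (∑≤n*c T λ i → hits≤T i u) (m≤m+n (j * T) t)) (≤-reflexive (sym (*-identityʳ T)))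
  hits-upper u 0<xu (no poor) with any? (λ i → hits i u <? t)
  ... | yes (i , few) = ≤-trans (∑-with-small-term (λ i → hits i u) T t i (λ i → hits≤T i u) (<⇒≤ few)) (m≤m+n _ _)
  ... | no none       = contradiction (0<xu , λ i → ≮⇒≥ λ few → none (i , few)) poor

  hitWeight-upper : hitWeight + T * X ≤ (j * T + t) * X + T * richWeight
  hitWeight-upper = begin
    hitWeight + T * X                                              ≡⟨ cong (hitWeight +_) (*-distribˡ-sum T x) ⟩
    hitWeight + ∑ (λ u → T * x u)                                  ≡⟨ ∑-distrib-+ (λ u → x u * ∑ λ i → hits i u) _ ⟨
    ∑ (λ u → x u * ∑ (λ i → hits i u) + T * x u)                   ≤⟨ ∑-mono pointwise ⟩
    ∑ (λ u → (j * T + t) * x u + T * (x u * 𝟙 (rich? u)))          ≡⟨ ∑-linear (j * T + t) T x (λ u → x u * 𝟙 (rich? u)) ⟩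
    (j * T + t) * X + T * richWeight                               ∎
    where
    factorˡ : ∀ x c t → x * c + t * x ≡ x * (c + t)
    factorˡ = solve-∀
    factorʳ : ∀ x c t b → x * (c + t * b) ≡ c * x + t * (x * b)
    factorʳ = solve-∀
    weighted : ∀ u → Dec (0 < x u) → x u * (∑ (λ i → hits i u) + T) ≤ x u * ((j * T + t) + T * 𝟙 (rich? u))
    weighted u (yes 0<xu) = *-monoʳ-≤ (x u) (hits-upper u 0<xu (rich? u))
    weighted u (no x≯0)   = ≤-trans (≤-reflexive (cong (_* (∑ (λ i → hits i u) + T)) (n≤0⇒n≡0 (≮⇒≥ x≯0)))) z≤n
    pointwise : ∀ u → x u * ∑ (λ i → hits i u) + T * x u ≤ (j * T + t) * x u + T * (x u * 𝟙 (rich? u))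
    pointwise u = begin
      x u * ∑ (λ i → hits i u) + T * x u                ≡⟨ factorˡ (x u) (∑ λ i → hits i u) T ⟩
      x u * (∑ (λ i → hits i u) + T)                    ≤⟨ weighted u (0 <? x u) ⟩
      x u * ((j * T + t) + T * 𝟙 (rich? u))             ≡⟨ factorʳ (x u) (j * T + t) T (𝟙 (rich? u)) ⟩
      (j * T + t) * x u + T * (x u * 𝟙 (rich? u))       ∎

  margin≤weights : T * (n * M) ≤ L * K * t * X + L * K * T * richWeight
  margin≤weights = +-cancelʳ-≤ common _ _ (begin
    T * (n * M) + common
      ≤⟨ +-monoˡ-≤ common (≤-trans (≤-reflexive (sym (*-identityˡ _))) (*-monoˡ-≤ (T * (n * M)) 1≤j)) ⟩
    j * (T * (n * M)) + common                                        ≡⟨ regroup₁ j T (n * M) (L * (K * X)) (L * K) X ⟩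
    j * T * (L * (K * X) + n * M) + L * K * (T * X)                   ≤⟨ +-monoˡ-≤ _ hitWeight-lower ⟩
    L * K * hitWeight + j * T * (L * X) + L * K * (T * X)             ≡⟨ regroup₂ (L * K) hitWeight j T L X ⟩
    L * K * (hitWeight + T * X) + j * (T * (L * X))                   ≤⟨ +-mono-≤ (*-monoʳ-≤ (L * K) hitWeight-upper) (*-monoˡ-≤ (T * (L * X)) j≤K) ⟩
    L * K * ((j * T + t) * X + T * richWeight) + K * (T * (L * X))    ≡⟨ regroup₃ L K j T t X richWeight ⟩
    L * K * t * X + L * K * T * richWeight + common                   ∎)
    where
    common = j * T * (L * (K * X)) + L * K * (T * X)
    regroup₁ : ∀ j T m q p X → j * (T * m) + (j * T * q + p * (T * X)) ≡ j * T * (q + m) + p * (T * X)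
    regroup₁ = solve-∀
    regroup₂ : ∀ p C j T L X → p * C + j * T * (L * X) + p * (T * X) ≡ p * (C + T * X) + j * (T * (L * X))
    regroup₂ = solve-∀
    regroup₃ : ∀ L K j T t X Y → L * K * ((j * T + t) * X + T * Y) + K * (T * (L * X)) ≡
      L * K * t * X + L * K * T * Y + (j * T * (L * (K * X)) + L * K * (T * X))
    regroup₃ = solve-∀

  richWeight-lower : n * M ≤ 2 * (L * K) * richWeight
  richWeight-lower = *-cancelˡ-≤ (L * K * t) {{>-nonZero (*-mono-≤ (*-mono-≤ 1≤L 1≤K) 1≤t)}} (+-cancelˡ-≤ (L * K * t * (n * M)) _ _ (begin
    L * K * t * (n * M) + L * K * t * (n * M)                   ≡⟨ double (L * K * t) (n * M) ⟩
    T * (n * M)                                                 ≤⟨ margin≤weights ⟩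
    L * K * t * X + L * K * T * richWeight                      ≤⟨ +-monoˡ-≤ _ (*-monoʳ-≤ (L * K * t) (∑≤n*c M (bounded dense))) ⟩
    L * K * t * (n * M) + L * K * T * richWeight                ≡⟨ cong (L * K * t * (n * M) +_) (regroup (L * K) t richWeight) ⟩
    L * K * t * (n * M) + L * K * t * (2 * (L * K) * richWeight)  ∎))
    where
    double : ∀ p q → p * q + p * q ≡ 2 * p * q
    double = solve-∀
    regroup : ∀ p t y → p * (2 * (p * t)) * y ≡ p * t * (2 * p * y)
    regroup = solve-∀

  many-rich : n ≤ 2 * (L * K) * count rich?
  many-rich = *-cancelˡ-≤ M {{>-nonZero (dense⇒0<M dense)}} (begin
    M * n                             ≡⟨ *-comm M n ⟩
    n * M                             ≤⟨ richWeight-lower ⟩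
    2 * (L * K) * richWeight          ≤⟨ *-monoʳ-≤ (2 * (L * K)) (∑-mono λ u → *-monoˡ-≤ (𝟙 (rich? u)) (bounded dense u)) ⟩
    2 * (L * K) * ∑ (λ u → M * 𝟙 (rich? u))  ≡⟨ cong (2 * (L * K) *_) (∑-*ˡ M λ u → 𝟙 (rich? u)) ⟩
    2 * (L * K) * (M * count rich?)   ≡⟨ x∙yz≈y∙xz (2 * (L * K)) M (count rich?) ⟩
    M * (2 * (L * K) * count rich?)   ∎)

  extended : 2 * (L * K) * (t * 2 ^ (j * T)) ≤ n → Σ[ B′ ∈ Blowup G (suc j) t ] Inside B′ (λ _ v → 0 < x v)
  extended large = addPart (proj₁ uniform) B′ adjacent , λ { zero y → proj₁ (select-member (proj₁ uniform) y) ; (suc i) y → B⊆support i _ }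
    where
    sees? : (e : Fin (j * T)) → Decidable λ u → let i , y = remQuot T e in Adj G u (part B i y)
    sees? e u = let i , y = remQuot T e in adj? G u (part B i y)
    uniform : Σ[ S ∈ Selection Rich t ] (∀ e y z → let i , w = remQuot T e in Adj G (select S y) (part B i w) → Adj G (select S z) (part B i w))
    uniform =
      homogeneous (j * T) sees? rich? t (*-cancelˡ-≤ (2 * (L * K)) {{>-nonZero (*-mono-≤ (s≤s (z≤n {1})) (*-mono-≤ 1≤L 1≤K))}} (≤-trans large many-rich))
    first : Fin t
    first = fromℕ< 1≤t
    u₀ = select (proj₁ uniform) first
    neighbours : ∀ i → Selection (λ y → Adj G u₀ (part B i y)) t
    neighbours i = selection (λ y → adj? G u₀ (part B i y)) t (proj₂ (select-member (proj₁ uniform) first) i)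
    B′ : Blowup G j t
    B′ = subBlowup B neighbours
    adjacent : ∀ y i z → Adj G (select (proj₁ uniform) y) (part B′ i z)
    adjacent y i z = subst (λ (i , w) → Adj G u₀ (part B i w) → Adj G (select (proj₁ uniform) y) (part B i w))
      (remQuot-combine i w) (proj₂ uniform (combine i w) first y) (select-member (neighbours i) z)
      where w = select (neighbours i) z

dense⇒blowup : ∀ K L → 1 ≤ L → ∀ j → j ≤ K → ∀ t → 1 ≤ t → ∃[ n₀ ] (∀ {n} (G : Graph n) x M → n₀ ≤ n →
  Dense G x K L M → Σ[ B ∈ Blowup G (suc j) t ] Inside B (λ _ v → 0 < x v))
dense⇒blowup K L 1≤L zero    _   t 1≤t = L * t , λ G x M large dense →
  let S = selection (λ v → 0 <? x v) t (*-cancelˡ-≤ L {{>-nonZero 1≤L}} (≤-trans large (dense⇒large-support dense)))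
  in addPart S emptyBlowup (λ _ ()) , λ { zero → select-member S }
dense⇒blowup K L 1≤L (suc j) j<K t 1≤t =
  let n₁ , smaller = dense⇒blowup K L 1≤L j (<⇒≤ j<K) (2 * (L * K * t)) (*-mono-≤ (s≤s (z≤n {1})) (*-mono-≤ (*-mono-≤ 1≤L 1≤K) 1≤t))
      n₂ = 2 * (L * K) * (t * 2 ^ (suc j * (2 * (L * K * t))))
  in n₁ + n₂ , λ G x M large dense →
       let B , B⊆support = smaller G x M (≤-trans (m≤m+n n₁ n₂) large) dense
       in ExtendBlowup.extended 1≤L 1≤K dense 1≤t (s≤s z≤n) j<K B B⊆support (≤-trans (m≤n+m n₂ n₁) large)
  where
  1≤K : 1 ≤ K
  1≤K = ≤-trans (s≤s z≤n) j<K

-- Colour-critical edges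

record CriticalColouring {f} (F : Graph f) (k : ℕ) : Set where
  field
    e₁ e₂         : Fin f
    edge          : Adj F e₁ e₂
    colour        : Fin f → Fin k
    monochromatic : colour e₁ ≡ colour e₂
    proper        : ∀ i j → Adj (deleteEdge F e₁ e₂) i j → colour i ≢ colour j

criticalColouring : ∀ {f} (F : Graph f) {k : ℕ} → HasColorCriticalEdge F → χ[ F ]≡ suc k → CriticalColouring F k
criticalColouring F {k} (u , v , uv , c , d , (_ , c-minimal) , ((col , proper) , _) , d<c) (colourable , minimal) = record
  { e₁ = u ; e₂ = v ; edge = uv ; colour = colour ; monochromatic = monochromatic ; proper = proper′ }
  where
  d≤k : d ≤ k
  d≤k = ≤-pred (≤-trans d<c (c-minimal (suc k) colourable))
  colour : Fin _ → Fin k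
  colour i = inject≤ (col i) d≤k
  proper′ : ∀ i j → Adj (deleteEdge F u v) i j → colour i ≢ colour j
  proper′ i j ij e = proper i j ij (inject≤-injective d≤k d≤k (col i) (col j) e)
  monochromatic : colour u ≡ colour v
  monochromatic = decidable-stable (colour u ≟ colour v) λ u≢v → 1+n≰n (minimal k (colour , proper-on-F u≢v))
    where
    proper-on-F : colour u ≢ colour v → ∀ i j → Adj F i j → colour i ≢ colour j
    proper-on-F u≢v i j ij with ((i ≟ u) ×-dec (j ≟ v)) ⊎-dec ((i ≟ v) ×-dec (j ≟ u))
    ... | yes (inj₁ (refl , refl)) = u≢v
    ... | yes (inj₂ (refl , refl)) = u≢v ∘ sym
    ... | no other                 = proper′ i j (ij , other)

module _ {f k : ℕ} {F : Graph f} (C : CriticalColouring F k) where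

  open CriticalColouring C

  permuteColours : (π : Fin k → Fin k) → Injective _≡_ _≡_ π → CriticalColouring F k
  permuteColours π π-injective = record
    { e₁ = e₁ ; e₂ = e₂ ; edge = edge ; colour = π ∘ colour ; monochromatic = cong π monochromatic ; proper = λ i j ij → proper i j ij ∘ π-injective }

  edge-in-part⇒embedding : {G : Graph n} (B : Blowup G k f) → Adj G (part B (colour e₁) e₁) (part B (colour e₁) e₂) → ∃[ φ ] IsEmbedding F G φ
  edge-in-part⇒embedding {G = G} B xy = φ , injective , preserves
    where
    φ : Fin f → Fin _
    φ w = part B (colour w) w
    injective : Injective _≡_ _≡_ φ
    injective {w} {w′} e with colour w ≟ colour w′
    ... | yes same     = part-injective B (colour w′) (trans (cong (λ c → part B c w) (sym same)) e)
    ... | no different = contradiction (subst (Adj G (φ w)) (sym e) (joined B different w w′)) (irrefl G)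
    critical : Adj G (φ e₁) (φ e₂)
    critical = subst (λ c → Adj G (φ e₁) (part B c e₂)) monochromatic xy
    preserves : ∀ w w′ → Adj F w w′ → Adj G (φ w) (φ w′)
    preserves w w′ ww′ with ((w ≟ e₁) ×-dec (w′ ≟ e₂)) ⊎-dec ((w ≟ e₂) ×-dec (w′ ≟ e₁))
    ... | yes (inj₁ (refl , refl)) = critical
    ... | yes (inj₂ (refl , refl)) = symm G critical
    ... | no other                 = joined B (proper w w′ (ww′ , other)) w w′

module ReplaceVertex {n j t : ℕ} {G : Graph n} (B : Blowup G j t) (i : Fin j) (a : Fin t) (x : Fin n)
  (adjacent : ∀ i′ → i′ ≢ i → ∀ y → Adj G x (part B i′ y)) (fresh : ∀ y → part B i y ≢ x) where

  part′ : Fin j → Fin t → Fin n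
  part′ i′ y = if does ((i′ ≟ i) ×-dec (y ≟ a)) then x else part B i′ y

  data Replaced (i′ : Fin j) (y : Fin t) : Set where
    new : i′ ≡ i → y ≡ a → part′ i′ y ≡ x → Replaced i′ y
    old : ¬ (i′ ≡ i × y ≡ a) → part′ i′ y ≡ part B i′ y → Replaced i′ y

  replaced? : ∀ i′ y → Replaced i′ y
  replaced? i′ y = by-cases ((i′ ≟ i) ×-dec (y ≟ a)) refl
    where
    by-cases : (d : Dec (i′ ≡ i × y ≡ a)) → part′ i′ y ≡ (if does d then x else part B i′ y) → Replaced i′ y
    by-cases (yes (i′≡i , y≡a)) = new i′≡i y≡a
    by-cases (no other)         = old other

  part′-new : part′ i a ≡ x
  part′-new with replaced? i a
  ... | new _ _ e   = e
  ... | old other _ = contradiction (refl , refl) other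

  part′-old : ∀ {i′ y} → ¬ (i′ ≡ i × y ≡ a) → part′ i′ y ≡ part B i′ y
  part′-old {i′} {y} other with replaced? i′ y
  ... | new i′≡i y≡a _ = contradiction (i′≡i , y≡a) other
  ... | old _ e        = e

  replaceVertex : Blowup G j t
  replaceVertex = record { part = part′ ; part-injective = λ i′ {y} {z} → injective i′ y z ; joined = λ {i₁} {i₂} → joined′ i₁ i₂ }
    where
    injective : ∀ i′ y z → part′ i′ y ≡ part′ i′ z → y ≡ z
    injective i′ y z e with replaced? i′ y | replaced? i′ z
    ... | new _ y≡a _     | new _ z≡a _     = trans y≡a (sym z≡a)
    ... | new refl _ y↦x  | old _ z↦z       = contradiction (trans (sym z↦z) (trans (sym e) y↦x)) (fresh z)
    ... | old _ y↦y       | new refl _ z↦x  = contradiction (trans (sym y↦y) (trans e z↦x)) (fresh y)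
    ... | old _ y↦y       | old _ z↦z       = part-injective B i′ (trans (sym y↦y) (trans e z↦z))
    joined′ : ∀ i₁ i₂ → i₁ ≢ i₂ → ∀ y z → Adj G (part′ i₁ y) (part′ i₂ z)
    joined′ i₁ i₂ i₁≢i₂ y z with replaced? i₁ y | replaced? i₂ z
    ... | new refl _ _    | new refl _ _    = contradiction refl i₁≢i₂
    ... | new refl _ y↦x  | old _ z↦z       = subst₂ (Adj G) (sym y↦x) (sym z↦z) (adjacent i₂ (i₁≢i₂ ∘ sym) z)
    ... | old _ y↦y       | new refl _ z↦x  = subst₂ (Adj G) (sym y↦y) (sym z↦x) (symm G (adjacent i₁ i₁≢i₂ y))
    ... | old _ y↦y       | old _ z↦z       = subst₂ (Adj G) (sym y↦y) (sym z↦z) (joined B i₁≢i₂ y z)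

transpose-injective : (i j : Fin n) → Injective _≡_ _≡_ (transpose i j)
transpose-injective i j e = trans (sym (transpose-inverse j i)) (trans (cong (transpose j i) e) (transpose-inverse j i))

transpose-iˡ : (i j : Fin n) → transpose i j i ≡ j
transpose-iˡ i j rewrite dec-true (i ≟ i) refl = refl

dropFirst : {G : Graph n} {j t : ℕ} → Blowup G j (suc t) → Blowup G j t
dropFirst B = subBlowup B {λ _ _ → ⊤} λ _ → record { select = suc ; select-injective = suc-injective ; select-member = λ _ → tt }

module _ {f k : ℕ} {F : Graph f} (C : CriticalColouring F k) {n : ℕ} {G : Graph n} where

  open CriticalColouring C using (e₁; e₂; edge; colour)

  edge⇒embedding : (i : Fin k) (B : Blowup G k f) {x y : Fin n} → Adj G x y →
    (∀ j → j ≢ i → ∀ w → Adj G x (part B j w)) → (∀ j → j ≢ i → ∀ w → Adj G y (part B j w)) →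
    (∀ w → part B i w ≢ x) → (∀ w → part B i w ≢ y) → ∃[ φ ] IsEmbedding F G φ
  edge⇒embedding i B {x} {y} xy xB yB x∉ y∉ = edge-in-part⇒embedding C′ R₂.replaceVertex
    (subst (λ c → Adj G (R₂.part′ c e₁) (R₂.part′ c e₂)) (sym (transpose-iˡ (colour e₁) i)) (subst₂ (Adj G) (sym at-e₁) (sym R₂.part′-new) xy))
    where
    C′ : CriticalColouring F k
    C′ = permuteColours C (transpose (colour e₁) i) (transpose-injective (colour e₁) i)
    module R₁ = ReplaceVertex B i e₁ x xB x∉
    y∉R₁ : ∀ w → R₁.part′ i w ≢ y
    y∉R₁ w e with R₁.replaced? i w
    ... | R₁.new _ _ w↦x = irrefl G (subst (Adj G x) (trans (sym e) w↦x) xy)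
    ... | R₁.old _ w↦w   = y∉ w (trans (sym w↦w) e)
    yR₁ : ∀ j → j ≢ i → ∀ w → Adj G y (R₁.part′ j w)
    yR₁ j j≢i w = subst (Adj G y) (sym (R₁.part′-old (j≢i ∘ proj₁))) (yB j j≢i w)
    module R₂ = ReplaceVertex R₁.replaceVertex i e₂ y yR₁ y∉R₁
    e₁≢e₂ : e₁ ≢ e₂
    e₁≢e₂ e = irrefl F (subst (Adj F e₁) (sym e) edge)
    at-e₁ : R₂.part′ i e₁ ≡ x
    at-e₁ = trans (R₂.part′-old (e₁≢e₂ ∘ proj₂)) R₁.part′-new

  apex⇒embedding : (B : Blowup G k (suc f)) (x : Fin n) → (∀ j w → Adj G x (part B j w)) → ∃[ φ ] IsEmbedding F G φ
  apex⇒embedding B x xB = edge⇒embedding (colour e₁) (dropFirst B) (xB (colour e₁) zero)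
    (λ j _ w → xB j (suc w)) (λ j j≢ w → joined B (j≢ ∘ sym) zero (suc w))
    (λ w e → irrefl G (subst (Adj G x) e (xB (colour e₁) (suc w))))
    (λ w e → 0≢1+n (sym (cong toℕ (part-injective B (colour e₁) e))))

  blowup⇒embedding : Blowup G (suc k) (suc f) → ∃[ φ ] IsEmbedding F G φ
  blowup⇒embedding B = apex⇒embedding others (part B zero zero) λ j w → joined B (λ ()) zero w
    where
    others : Blowup G k (suc f)
    others = record { part = part B ∘ suc ; part-injective = part-injective B ∘ suc ; joined = λ i≢i′ → joined B (i≢i′ ∘ suc-injective) }

-- The weighted Turán bound

energy : Graph n → (Fin n → ℕ) → ℕ
energy G x = ∑ λ u → x u * transfer G true x u

remove : (Fin n → ℕ) → Fin n → Fin n → ℕ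
remove x v u = if does (u ≟ v) then 0 else x u

module _ {n : ℕ} (x : Fin n → ℕ) (v : Fin n) where

  remove-+ : ∀ u → x u ≡ remove x v u + 𝟙 (u ≟ v) * x v
  remove-+ u with u ≟ v
  ... | yes refl = sym (*-identityˡ _)
  ... | no _     = sym (+-identityʳ _)

  remove≤ : ∀ u → remove x v u ≤ x u
  remove≤ u = ≤-trans (m≤m+n (remove x v u) _) (≤-reflexive (sym (remove-+ u)))

  ∑-remove : ∑ x ≡ ∑ (remove x v) + x v
  ∑-remove = trans (sum-cong-≗ remove-+) (trans (∑-distrib-+ (remove x v) _) (cong (∑ (remove x v) +_) (∑-δ v λ _ → x v)))

  support-remove : 0 < x v → suc (count λ u → 0 <? remove x v u) ≤ count λ u → 0 <? x u
  support-remove 0<xv = begin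
    suc (count λ u → 0 <? remove x v u)                              ≡⟨ +-comm 1 _ ⟩
    count (λ u → 0 <? remove x v u) + 1                              ≡⟨ cong (count (λ u → 0 <? remove x v u) +_) (∑-δ v λ _ → 1) ⟨
    count (λ u → 0 <? remove x v u) + ∑ (λ u → 𝟙 (u ≟ v) * 1)        ≡⟨ ∑-distrib-+ (λ u → 𝟙 (0 <? remove x v u)) _ ⟨
    ∑ (λ u → 𝟙 (0 <? remove x v u) + 𝟙 (u ≟ v) * 1)                  ≤⟨ ∑-mono pointwise ⟩
    count (λ u → 0 <? x u)                                           ∎
    where
    open ≤-Reasoning
    pointwise : ∀ u → 𝟙 (0 <? remove x v u) + 𝟙 (u ≟ v) * 1 ≤ 𝟙 (0 <? x u)
    pointwise u with u ≟ v
    ... | yes refl = ≤-reflexive (sym (𝟙-yes (0 <? x u) 0<xv))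
    ... | no _     = ≤-reflexive (+-identityʳ _)

  module _ (G : Graph n) where

    transfer-remove : ∀ u → transfer G true x u ≡ transfer G true (remove x v) u + adjacency G u v * x v
    transfer-remove u = begin
      ∑ (λ w → adjacency G u w * x w)
        ≡⟨ sum-cong-≗ (λ w → trans (cong (adjacency G u w *_) (remove-+ w)) (expand (adjacency G u w) (remove x v w) (𝟙 (w ≟ v)) (x v))) ⟩
      ∑ (λ w → adjacency G u w * remove x v w + 𝟙 (w ≟ v) * (adjacency G u w * x v))
        ≡⟨ ∑-distrib-+ (λ w → adjacency G u w * remove x v w) _ ⟩
      transfer G true (remove x v) u + ∑ (λ w → 𝟙 (w ≟ v) * (adjacency G u w * x v))
        ≡⟨ cong (transfer G true (remove x v) u +_) (∑-δ v λ w → adjacency G u w * x v) ⟩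
      transfer G true (remove x v) u + adjacency G u v * x v ∎
      where
      open ≡-Reasoning
      expand : ∀ a p q y → a * (p + q * y) ≡ a * p + q * (a * y)
      expand = solve-∀

    transfer-remove-self : transfer G true (remove x v) v ≡ transfer G true x v
    transfer-remove-self = sym (trans (transfer-remove v)
      (trans (cong (λ a → transfer G true (remove x v) v + a * x v) (𝟙-no (adj? G v v) (irrefl G))) (+-identityʳ _)))

    energy-remove : energy G x ≡ energy G (remove x v) + (x v * transfer G true x v + x v * transfer G true x v)
    energy-remove = begin
      ∑ (λ u → x u * d u)
        ≡⟨ sum-cong-≗ (λ u → trans (cong (_* d u) (remove-+ u)) (trans (*-distribʳ-+ (d u) (x′ u) (𝟙 (u ≟ v) * y)) (cong₂ _+_ (cong (x′ u *_) (transfer-remove u)) (*-assoc (𝟙 (u ≟ v)) y _)))) ⟩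
      ∑ (λ u → x′ u * (d′ u + adjacency G u v * y) + 𝟙 (u ≟ v) * (y * d u))
        ≡⟨ trans (∑-distrib-+ (λ u → x′ u * (d′ u + adjacency G u v * y)) _) (cong₂ _+_ (trans (sum-cong-≗ λ u → expand (x′ u) (d′ u) (adjacency G u v) y) (∑-distrib-+ (λ u → x′ u * d′ u) _)) (∑-δ v λ u → y * d u)) ⟩
      energy G x′ + ∑ (λ u → y * (adjacency G u v * x′ u)) + y * d v
        ≡⟨ cong (λ t → energy G x′ + t + y * d v) (trans (∑-*ˡ y λ u → adjacency G u v * x′ u)
             (cong (y *_) (trans (sum-cong-≗ λ u → cong (_* x′ u) (link-sym G true u v)) transfer-remove-self))) ⟩
      energy G x′ + y * d v + y * d v
        ≡⟨ +-assoc (energy G x′) _ _ ⟩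
      energy G x′ + (y * d v + y * d v) ∎
      where
      open ≡-Reasoning
      y = x v
      x′ d d′ : Fin n → ℕ
      x′ = remove x v
      d  = transfer G true x
      d′ = transfer G true x′
      expand : ∀ p w a y → p * (w + a * y) ≡ p * w + y * (a * p)
      expand = solve-∀

-- If the energy exceeds ((K - 1) / K) (∑ x)² by a margin, then successively removing vertices of
-- too small weighted degree ends in a dense weighting: the margin shrinks slowly enough.
module DensePart {n : ℕ} (G : Graph n) (N K M : ℕ) (1≤N : 1 ≤ N) (large : 2 * (N * K) ≤ n) where

  L τ : ℕ
  L = 4 * N
  τ = n * (M * M)

  Excess : ℕ → (Fin n → ℕ) → Set
  Excess s x = N * (K * (∑ x * ∑ x)) + s * τ < N * (K * energy G x + ∑ x * ∑ x)

  removal-cost : ∀ {y} → y ≤ M → L * N * K * (y * y) + 2 * (y * N) * (n * M) ≤ L * τ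
  removal-cost {y} y≤M = begin
    L * N * K * (y * y) + 2 * (y * N) * (n * M)
      ≤⟨ +-mono-≤ (*-monoʳ-≤ (L * N * K) (*-mono-≤ y≤M y≤M)) (*-monoˡ-≤ (n * M) (*-monoʳ-≤ 2 (*-monoˡ-≤ N y≤M))) ⟩
    L * N * K * (M * M) + 2 * (M * N) * (n * M)             ≡⟨ regroup N K M n ⟩
    2 * N * (2 * (N * K)) * (M * M) + 2 * N * n * (M * M)   ≤⟨ +-monoˡ-≤ _ (*-monoˡ-≤ (M * M) (*-monoʳ-≤ (2 * N) large)) ⟩
    2 * N * n * (M * M) + 2 * N * n * (M * M)               ≡⟨ double N M n ⟩
    L * τ                                                   ∎
    where
    open ≤-Reasoning
    regroup : ∀ N K M n → 4 * N * N * K * (M * M) + 2 * (M * N) * (n * M) ≡ 2 * N * (2 * (N * K)) * (M * M) + 2 * N * n * (M * M)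
    regroup = solve-∀
    double : ∀ N M n → 2 * N * n * (M * M) + 2 * N * n * (M * M) ≡ 4 * N * (n * (M * M))
    double = solve-∀

  -- The excess before and after a vertex of weight y and weighted degree d is removed from
  -- a weighting of total weight X + y; E is the energy afterwards.
  excess-after-removal : ∀ X y d E s → y ≤ M → L * (K * d + (X + y)) < L * (K * (X + y)) + n * M →
    N * (K * ((X + y) * (X + y))) + suc s * τ < N * (K * (E + (y * d + y * d)) + (X + y) * (X + y)) →
    N * (K * (X * X)) + s * τ < N * (K * E + X * X)
  excess-after-removal X y d E s y≤M low excess = *-cancelˡ-< L _ _ (+-cancelʳ-< (R + C) _ _ (begin-strict
    L * (N * (K * (X * X)) + s * τ) + (R + C)
      ≤⟨ +-monoʳ-≤ (L * (N * (K * (X * X)) + s * τ)) (+-monoˡ-≤ C (removal-cost y≤M)) ⟩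
    L * (N * (K * (X * X)) + s * τ) + (L * τ + C)
      ≤⟨ +-monoʳ-≤ (L * (N * (K * (X * X)) + s * τ)) (+-monoˡ-≤ C (m≤m+n (L * τ) (L * N * (y * y)))) ⟩
    L * (N * (K * (X * X)) + s * τ) + (L * τ + L * N * (y * y) + C)                      ≡⟨ regroup-before L N K X y s τ ⟩
    L * (N * (K * ((X + y) * (X + y))) + suc s * τ) + 2 * (y * N) * (L * (X + y))        <⟨ +-monoˡ-< _ (*-monoʳ-< L {{>-nonZero 1≤L}} excess) ⟩
    L * (N * (K * (E + (y * d + y * d)) + (X + y) * (X + y))) + 2 * (y * N) * (L * (X + y))   ≡⟨ regroup-degree L N K X y d E ⟩
    L * (N * (K * E + (X + y) * (X + y))) + 2 * (y * N) * (L * (K * d + (X + y)))        ≤⟨ +-monoʳ-≤ _ (*-monoʳ-≤ (2 * (y * N)) (<⇒≤ low)) ⟩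
    L * (N * (K * E + (X + y) * (X + y))) + 2 * (y * N) * (L * (K * (X + y)) + n * M)    ≡⟨ regroup-after L N K X y E (n * M) ⟩
    L * (N * (K * E + X * X)) + (R + C)                                                  ∎))
    where
    open ≤-Reasoning
    R = L * N * K * (y * y) + 2 * (y * N) * (n * M)
    C = L * N * K * (2 * (X * y) + y * y) + L * N * (2 * (X * y)) + L * N * (y * y)
    1≤L : 1 ≤ L
    1≤L = *-mono-≤ (s≤s (z≤n {3})) 1≤N
    regroup-before : ∀ L N K X y s τ →
      L * (N * (K * (X * X)) + s * τ) + (L * τ + L * N * (y * y) + (L * N * K * (2 * (X * y) + y * y) + L * N * (2 * (X * y)) + L * N * (y * y)))
      ≡ L * (N * (K * ((X + y) * (X + y))) + suc s * τ) + 2 * (y * N) * (L * (X + y))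
    regroup-before = solve-∀
    regroup-degree : ∀ L N K X y d E → L * (N * (K * (E + (y * d + y * d)) + (X + y) * (X + y))) + 2 * (y * N) * (L * (X + y))
      ≡ L * (N * (K * E + (X + y) * (X + y))) + 2 * (y * N) * (L * (K * d + (X + y)))
    regroup-degree = solve-∀
    regroup-after : ∀ L N K X y E z → L * (N * (K * E + (X + y) * (X + y))) + 2 * (y * N) * (L * (K * (X + y)) + z)
      ≡ L * (N * (K * E + X * X)) + (L * N * K * (y * y) + 2 * (y * N) * z + (L * N * K * (2 * (X * y) + y * y) + L * N * (2 * (X * y)) + L * N * (y * y)))
    regroup-after = solve-∀

  excess⇒positive : ∀ s x → Excess s x → 0 < ∑ x
  excess⇒positive s x excess with 0 <? ∑ x
  ... | yes 0<X = 0<X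
  ... | no X≯0  = contradiction (≤-trans (≤-reflexive vanishes) z≤n) (<⇒≱ excess)
    where
    X≡0 : ∑ x ≡ 0
    X≡0 = n≤0⇒n≡0 (≮⇒≥ X≯0)
    x≡0 : ∀ u → x u ≡ 0
    x≡0 u = n≤0⇒n≡0 (≤-trans (term≤∑ x u) (≤-reflexive X≡0))
    vanishes : N * (K * energy G x + ∑ x * ∑ x) ≡ 0
    vanishes = trans (cong₂ (λ e t → N * (K * e + t * t)) (∑-zero λ u → cong (_* transfer G true x u) (x≡0 u)) X≡0)
      (trans (cong (N *_) (trans (+-identityʳ _) (*-zeroʳ K))) (*-zeroʳ N))

  dense-part : ∀ s x → (∀ v → x v ≤ M) → count (λ u → 0 <? x u) ≤ s → Excess s x → ∃[ x′ ] Dense G x′ K L M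
  dense-part s x x≤M support≤s excess
    with any? (λ v → (0 <? x v) ×-dec (L * (K * transfer G true x v + ∑ x) <? L * (K * ∑ x) + n * M))
  ... | no none = x , record
    { bounded = x≤M ; positive = excess⇒positive s x excess ; degrees = λ v 0<xv → ≮⇒≥ λ low → none (v , 0<xv , low) }
  dense-part zero    x x≤M support≤s excess | yes (v , 0<xv , low) =
    contradiction support≤s (<⇒≱ (≤-trans (s≤s z≤n) (support-remove x v 0<xv)))
  dense-part (suc s) x x≤M support≤s excess | yes (v , 0<xv , low) =
    dense-part s (remove x v) (λ u → ≤-trans (remove≤ x v u) (x≤M u)) (≤-pred (≤-trans (support-remove x v 0<xv) support≤s))
      (excess-after-removal (∑ (remove x v)) (x v) (transfer G true x v) (energy G (remove x v)) s (x≤M v)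
        (subst (λ X → L * (K * transfer G true x v + X) < L * (K * X) + n * M) (∑-remove x v) low)
        (subst₂ (λ X E → N * (K * (X * X)) + suc s * τ < N * (K * E + X * X)) (∑-remove x v) (energy-remove x v G) excess))

weighted-turán : ∀ {f} {F : Graph f} → CriticalColouring F k → ∀ N → ∃[ n₀ ] (∀ {n} (G : Graph n) → n₀ ≤ n → G IsFree F →
  ∀ M x → (∀ v → x v ≤ M) → N * (k * energy G x + ∑ x * ∑ x) ≤ N * (k * (∑ x * ∑ x)) + n * (n * (M * M)))
weighted-turán C zero = 0 , λ G _ _ M x _ → z≤n
weighted-turán {k} {f} {F} C (suc N) = n₁ + 2 * (suc N * k) , bound
  where
  blowups = dense⇒blowup k (4 * suc N) (s≤s z≤n) k ≤-refl (suc f) (s≤s z≤n)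
  n₁ = proj₁ blowups
  bound : ∀ {n} (G : Graph n) → n₁ + 2 * (suc N * k) ≤ n → G IsFree F → ∀ M x → (∀ v → x v ≤ M) →
    suc N * (k * energy G x + ∑ x * ∑ x) ≤ suc N * (k * (∑ x * ∑ x)) + n * (n * (M * M))
  bound {n} G large free M x x≤M = ≮⇒≥ λ excess →
    let x′ , dense = DensePart.dense-part G (suc N) k M (s≤s z≤n) (≤-trans (m≤n+m _ n₁) large) n x x≤M (count≤n λ u → 0 <? x u) excess
        B , _      = proj₂ blowups G x′ M (≤-trans (m≤m+n n₁ _) large) dense
        φ , e      = blowup⇒embedding C B
    in free⇒¬embedding F G free φ e

-- Large minimum degree

module _ (G : Graph n) {W : Fin n → Set} (W? : Decidable W) where

  neighboursIn nonNeighboursIn : Fin n → ℕ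
  neighboursIn v    = count λ u → W? u ×-dec adj? G v u
  nonNeighboursIn v = count λ u → W? u ×-dec ¬? (adj? G v u)

  CommonNeighbour : ∀ {r} → (Fin r → Fin n) → Fin n → Set
  CommonNeighbour a u = W u × (∀ x → Adj G (a x) u)

  commonNeighbour? : ∀ {r} (a : Fin r → Fin n) → Decidable (CommonNeighbour a)
  commonNeighbour? a u = W? u ×-dec all? λ x → adj? G (a x) u

  count-commonNeighbours : ∀ {r} (a : Fin r → Fin n) → count W? ≤ count (commonNeighbour? a) + ∑ λ x → nonNeighboursIn (a x)
  count-commonNeighbours a = begin
    count W?
      ≤⟨ ∑-mono (λ u → bound u (W? u)) ⟩
    ∑ (λ u → 𝟙 (commonNeighbour? a u) + ∑ λ x → 𝟙 (W? u ×-dec ¬? (adj? G (a x) u)))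
      ≡⟨ ∑-distrib-+ (λ u → 𝟙 (commonNeighbour? a u)) _ ⟩
    count (commonNeighbour? a) + ∑ (λ u → ∑ λ x → 𝟙 (W? u ×-dec ¬? (adj? G (a x) u)))
      ≡⟨ cong (count (commonNeighbour? a) +_) (∑-comm λ u x → 𝟙 (W? u ×-dec ¬? (adj? G (a x) u))) ⟩
    count (commonNeighbour? a) + ∑ (λ x → nonNeighboursIn (a x)) ∎
    where
    open ≤-Reasoning
    bound : ∀ u (d : Dec (W u)) → 𝟙 d ≤ 𝟙 (d ×-dec all? λ x → adj? G (a x) u) + ∑ λ x → 𝟙 (d ×-dec ¬? (adj? G (a x) u))
    bound u (no _)  = z≤n
    bound u (yes _) with any? (λ x → ¬? (adj? G (a x) u))
    ... | yes (x , xu∉) =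
      ≤-trans (≤-reflexive (sym (𝟙-yes (¬? (adj? G (a x) u)) xu∉))) (≤-trans (term≤∑ (λ x → 𝟙 (¬? (adj? G (a x) u))) x) (m≤n+m _ _))
    ... | no none       =
      ≤-trans (≤-reflexive (sym (𝟙-yes (all? λ x → adj? G (a x) u) λ x → decidable-stable (adj? G (a x) u) λ xu∉ → none (x , xu∉)))) (m≤m+n _ _)

-- If vertices of distinct sets W i have few non-neighbours in each other's sets, the parts of
-- a complete multipartite subgraph can be chosen one after the other.
greedy-blowup : (G : Graph n) {N : ℕ} → 1 ≤ N → ∀ q p j {W : Fin j → Fin n → Set} (W? : ∀ i → Decidable (W i)) →
  (∀ {i i′} → i ≢ i′ → ∀ w → W i w → N * nonNeighboursIn G (W? i′) w ≤ q) →
  (∀ i → q * (j * p) + N * p ≤ N * count (W? i)) → Σ[ B ∈ Blowup G j p ] Inside B W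
greedy-blowup G 1≤N q p zero    W? few many = emptyBlowup , λ ()
greedy-blowup {n} G {N} 1≤N q p (suc j) {W} W? few many = addPart first B (λ x i y → proj₂ (B⊆W′ i y) x) , λ
  { zero    x → select-member first x
  ; (suc i) y → proj₁ (B⊆W′ i y)
  }
  where
  open ≤-Reasoning
  first : Selection (W zero) p
  first = selection (W? zero) p (*-cancelˡ-≤ N {{>-nonZero 1≤N}} (≤-trans (m≤n+m _ _) (many zero)))
  a = select first
  W′ : Fin j → Fin n → Set
  W′ i = CommonNeighbour G (W? (suc i)) a
  W′? : ∀ i → Decidable (W′ i)
  W′? i = commonNeighbour? G (W? (suc i)) a
  regroup : ∀ q j p z → q * (j * p) + z + p * q ≡ q * (suc j * p) + z
  regroup = solve-∀
  many′ : ∀ i → q * (j * p) + N * p ≤ N * count (W′? i)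
  many′ i = +-cancelʳ-≤ (p * q) _ _ (begin
    q * (j * p) + N * p + p * q                                                      ≡⟨ regroup q j p (N * p) ⟩
    q * (suc j * p) + N * p                                                          ≤⟨ many (suc i) ⟩
    N * count (W? (suc i))                                                           ≤⟨ *-monoʳ-≤ N (count-commonNeighbours G (W? (suc i)) a) ⟩
    N * (count (W′? i) + ∑ (λ x → nonNeighboursIn G (W? (suc i)) (a x)))             ≡⟨ *-distribˡ-+ N (count (W′? i)) _ ⟩
    N * count (W′? i) + N * ∑ (λ x → nonNeighboursIn G (W? (suc i)) (a x))
      ≡⟨ cong (N * count (W′? i) +_) (*-distribˡ-sum N λ x → nonNeighboursIn G (W? (suc i)) (a x)) ⟩
    N * count (W′? i) + ∑ (λ x → N * nonNeighboursIn G (W? (suc i)) (a x))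
      ≤⟨ +-monoʳ-≤ (N * count (W′? i)) (∑≤n*c q λ x → few (λ ()) (a x) (select-member first x)) ⟩
    N * count (W′? i) + p * q                                                        ∎)
  few′ : ∀ {i i′} → i ≢ i′ → ∀ w → W′ i w → N * nonNeighboursIn G (W′? i′) w ≤ q
  few′ {i} {i′} i≢i′ w (w∈W , _) = ≤-trans
    (*-monoʳ-≤ N (count-mono (λ u → W′? i′ u ×-dec ¬? (adj? G w u)) (λ u → W? (suc i′) u ×-dec ¬? (adj? G w u)) λ ((u∈W , _) , wu∉) → u∈W , wu∉))
    (few (i≢i′ ∘ suc-injective) w w∈W)
  rest : Σ[ B ∈ Blowup G j p ] Inside B W′
  rest = greedy-blowup G 1≤N q p j W′? few′ many′
  B = proj₁ rest
  B⊆W′ = proj₂ rest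

module _ (G : Graph n) {k : ℕ} (i : Fin k) (u v : Fin n) where

  Compatible : Fin k → Fin n → Set
  Compatible j w = (j ≡ i → w ≢ u × w ≢ v) × (j ≢ i → Adj G u w × Adj G v w)

  compatible? : ∀ j → Decidable (Compatible j)
  compatible? j w = ((j ≟ i) →-dec (¬? (w ≟ u) ×-dec ¬? (w ≟ v))) ×-dec (¬? (j ≟ i) →-dec (adj? G u w ×-dec adj? G v w))

  compatible-blowup⇒embedding : ∀ {f} {F : Graph f} → CriticalColouring F k → (B : Blowup G k f) → Inside B Compatible →
    Adj G u v → ∃[ φ ] IsEmbedding F G φ
  compatible-blowup⇒embedding C B inside uv = edge⇒embedding C i B uv
    (λ j j≢i w → proj₁ (proj₂ (inside j w) j≢i)) (λ j j≢i w → proj₂ (proj₂ (inside j w) j≢i))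
    (λ w → proj₁ (proj₁ (inside i w) refl)) (λ w → proj₂ (proj₁ (inside i w) refl))

  module _ (a : Fin m → Fin n) {W : Fin m → Set} (W? : Decidable W) where

    count-compatible-same : Injective _≡_ _≡_ a → count W? ≤ count (λ y → W? y ×-dec compatible? i (a y)) + 2
    count-compatible-same injective = ≤-trans
      (count-cover₃ W? (λ y → W? y ×-dec compatible? i (a y)) (λ y → a y ≟ u) (λ y → a y ≟ v) λ {y} → classify y)
      (+-monoʳ-≤ _ (+-mono-≤ (count-fibre≤1 a injective u) (count-fibre≤1 a injective v)))
      where
      classify : ∀ y → W y → (W y × Compatible i (a y)) ⊎ a y ≡ u ⊎ a y ≡ v
      classify y y∈ with a y ≟ u | a y ≟ v
      ... | yes y≡u | _       = inj₂ (inj₁ y≡u)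
      ... | no _    | yes y≡v = inj₂ (inj₂ y≡v)
      ... | no y≢u  | no y≢v  = inj₁ (y∈ , (λ _ → y≢u , y≢v) , λ i≢i → contradiction refl i≢i)

    count-compatible-other : ∀ {j} → j ≢ i → count W? ≤ count (λ y → W? y ×-dec compatible? j (a y)) +
      (count (λ y → W? y ×-dec ¬? (adj? G u (a y))) + count (λ y → W? y ×-dec ¬? (adj? G v (a y))))
    count-compatible-other {j} j≢i = count-cover₃ W? (λ y → W? y ×-dec compatible? j (a y))
      (λ y → W? y ×-dec ¬? (adj? G u (a y))) (λ y → W? y ×-dec ¬? (adj? G v (a y))) λ {y} → classify y
      where
      classify : ∀ y → W y → (W y × Compatible j (a y)) ⊎ (W y × ¬ Adj G u (a y)) ⊎ (W y × ¬ Adj G v (a y))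
      classify y y∈ with adj? G u (a y) | adj? G v (a y)
      ... | no uy∉ | _      = inj₂ (inj₁ (y∈ , uy∉))
      ... | yes _  | no vy∉ = inj₂ (inj₂ (y∈ , vy∉))
      ... | yes uy | yes vy = inj₁ (y∈ , (λ j≡i → contradiction j≡i j≢i) , λ _ → uy , vy)

-- Every degree is at least (1 - 1 / k) n - n / (k N).
NearTuránDegrees : ℕ → ℕ → Graph n → Set
NearTuránDegrees {n} k N G = ∀ v → N * (k * n) ≤ N * (k * deg G v + n) + n

-- The constant 62 adds up the vertices lost in the choice of a complete multipartite subgraph below.
precision : ℕ → ℕ → ℕ
precision κ f = 62 * (suc κ * suc κ * suc f)

-- The vertices missing few vertices of the blowup 𝔸 form independent clusters, one for each part
-- of 𝔸; all but few vertices belong to them. Then every vertex has few neighbours in some cluster,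
-- and two vertices with few neighbours in the same cluster are not adjacent.
module Clusters {f κ : ℕ} {F : Graph f} (C : CriticalColouring F (suc κ)) (N t : ℕ)
  (N-large : precision κ f ≤ N) (t-large : N * suc f ≤ t)
  {n : ℕ} (G : Graph n) (free : G IsFree F) (n-large : N * suc f ≤ n)
  (minDegree : NearTuránDegrees (suc κ) N G) (𝔸 : Blowup G (suc κ) t) where

  open ≤-Reasoning

  K p : ℕ
  K = suc κ
  p = suc f

  K≤KKp : K ≤ K * K * p
  K≤KKp = begin
    K              ≡⟨ *-identityʳ K ⟨
    K * 1          ≤⟨ *-monoʳ-≤ K (*-mono-≤ (s≤s (z≤n {κ})) (s≤s (z≤n {f}))) ⟩
    K * (K * p)    ≡⟨ *-assoc K K p ⟨
    K * K * p      ∎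

  62≤N : 62 ≤ N
  62≤N = ≤-trans (*-monoʳ-≤ 62 (≤-trans (s≤s (z≤n {κ})) K≤KKp)) N-large

  1≤N : 1 ≤ N
  1≤N = ≤-trans (s≤s z≤n) 62≤N

  instance
    N≢0 : NonZero N
    N≢0 = >-nonZero 1≤N

  6p≤t : 6 * p ≤ t
  6p≤t = ≤-trans (*-monoˡ-≤ p (≤-trans (m≤m+n 6 56) 62≤N)) t-large

  ¬embedding : ¬ (∃[ φ ] IsEmbedding F G φ)
  ¬embedding (φ , e) = free⇒¬embedding F G free φ e

  nonNeighbours : Fin n → ℕ
  nonNeighbours v = count λ u → ¬? (adj? G v u)

  nonNeighbours≤ : ∀ v → N * (K * nonNeighbours v) ≤ N * n + n
  nonNeighbours≤ v = +-cancelˡ-≤ (N * (K * deg G v)) _ _ (begin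
    N * (K * deg G v) + N * (K * nonNeighbours v)     ≡⟨ factor N K (deg G v) (nonNeighbours v) ⟩
    N * (K * (deg G v + nonNeighbours v))             ≡⟨ cong (λ z → N * (K * z)) (count-complement (adj? G v)) ⟩
    N * (K * n)                                       ≤⟨ minDegree v ⟩
    N * (K * deg G v + n) + n                         ≡⟨ expand N (K * deg G v) n ⟩
    N * (K * deg G v) + (N * n + n)                   ∎)
    where
    factor : ∀ N K d e → N * (K * d) + N * (K * e) ≡ N * (K * (d + e))
    factor = solve-∀
    expand : ∀ N z n → N * (z + n) + n ≡ N * z + (N * n + n)
    expand = solve-∀

  hits misses : Fin K → Fin n → ℕ
  hits i v   = count λ y → adj? G v (part 𝔸 i y)
  misses i v = count λ y → ¬? (adj? G v (part 𝔸 i y))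

  allMisses : Fin n → ℕ
  allMisses v = ∑ λ i → misses i v

  ∑-allMisses : N * ∑ allMisses ≤ t * (N * n + n)
  ∑-allMisses = *-cancelˡ-≤ K (begin
    K * (N * ∑ allMisses)                                                  ≡⟨ cong (λ z → K * (N * z)) by-blowup-vertex ⟩
    K * (N * ∑ (λ i → ∑ λ y → nonNeighbours (part 𝔸 i y)))                 ≡⟨ trans (x∙yz≈y∙xz K N _) (sym (*-assoc N K _)) ⟩
    N * K * ∑ (λ i → ∑ λ y → nonNeighbours (part 𝔸 i y))
      ≡⟨ trans (*-distribˡ-sum (N * K) λ i → ∑ λ y → nonNeighbours (part 𝔸 i y)) (sum-cong-≗ λ i → *-distribˡ-sum (N * K) λ y → nonNeighbours (part 𝔸 i y)) ⟩
    ∑ (λ i → ∑ λ y → N * K * nonNeighbours (part 𝔸 i y))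
      ≤⟨ ∑-mono (λ i → ∑-mono λ y → ≤-trans (≤-reflexive (*-assoc N K _)) (nonNeighbours≤ (part 𝔸 i y))) ⟩
    ∑ {K} (λ i → ∑ {t} λ y → N * n + n)                                    ≡⟨ trans (sum-cong-≗ {K} λ i → ∑-const t (N * n + n)) (∑-const K _) ⟩
    K * (t * (N * n + n))                                                  ∎)
    where
    by-blowup-vertex : ∑ allMisses ≡ ∑ λ i → ∑ λ y → nonNeighbours (part 𝔸 i y)
    by-blowup-vertex = trans (∑-comm λ v i → misses i v) (sum-cong-≗ λ i → trans (∑-comm λ v y → 𝟙 (¬? (adj? G v (part 𝔸 i y))))
      (sum-cong-≗ λ y → count-cong (λ v → ¬? (adj? G v (part 𝔸 i y))) (λ v → ¬? (adj? G (part 𝔸 i y) v)) (_∘ symm G) (_∘ symm G)))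

  rarely-hit-part : ∀ v → ∃[ i ] hits i v < p
  rarely-hit-part v with any? (λ i → hits i v <? p)
  ... | yes found = found
  ... | no none   = contradiction
    (apex⇒embedding C (subBlowup 𝔸 neighbours) v λ i y → select-member (neighbours i) y) ¬embedding
    where
    neighbours : ∀ i → Selection (λ y → Adj G v (part 𝔸 i y)) p
    neighbours i = selection (λ y → adj? G v (part 𝔸 i y)) p (≮⇒≥ λ few → none (i , few))

  label : Fin n → Fin K
  label v = proj₁ (rarely-hit-part v)

  t≤misses+p : ∀ v → t ≤ misses (label v) v + p
  t≤misses+p v = begin
    t                                        ≡⟨ count-complement (λ y → adj? G v (part 𝔸 (label v) y)) ⟨
    hits (label v) v + misses (label v) v    ≤⟨ +-monoˡ-≤ (misses (label v) v) (<⇒≤ (proj₂ (rarely-hit-part v))) ⟩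
    p + misses (label v) v                   ≡⟨ +-comm p _ ⟩
    misses (label v) v + p                   ∎

  Typical : Fin n → Set
  Typical v = 4 * allMisses v ≤ 5 * t

  typical? : Decidable Typical
  typical? v = 4 * allMisses v ≤? 5 * t

  atypical : ℕ
  atypical = count λ v → ¬? (typical? v)

  allMisses-lower : ∀ v (d : Dec (Typical v)) → 4 * t + t * 𝟙 (¬? d) ≤ 4 * allMisses v + 4 * p
  allMisses-lower v (yes _) = begin
    4 * t + t * 0                        ≡⟨ trans (cong (4 * t +_) (*-zeroʳ t)) (+-identityʳ _) ⟩
    4 * t                                ≤⟨ *-monoʳ-≤ 4 (≤-trans (t≤misses+p v) (+-monoˡ-≤ p (term≤∑ (λ i → misses i v) _))) ⟩
    4 * (allMisses v + p)                ≡⟨ *-distribˡ-+ 4 (allMisses v) p ⟩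
    4 * allMisses v + 4 * p              ∎
  allMisses-lower v (no many) = begin
    4 * t + t * 1                        ≡⟨ collect t ⟩
    5 * t                                ≤⟨ <⇒≤ (≰⇒> many) ⟩
    4 * allMisses v                      ≤⟨ m≤m+n _ _ ⟩
    4 * allMisses v + 4 * p              ∎
    where
    collect : ∀ t → 4 * t + t * 1 ≡ 5 * t
    collect = solve-∀

  ∑-allMisses-lower : n * (4 * t) + t * atypical ≤ 4 * ∑ allMisses + n * (4 * p)
  ∑-allMisses-lower = begin
    n * (4 * t) + t * atypical
      ≡⟨ cong₂ _+_ (sym (∑-const n (4 * t))) (*-distribˡ-sum t λ v → 𝟙 (¬? (typical? v))) ⟩
    ∑ {n} (λ _ → 4 * t) + ∑ (λ v → t * 𝟙 (¬? (typical? v)))               ≡⟨ ∑-distrib-+ {n} (λ _ → 4 * t) _ ⟨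
    ∑ (λ v → 4 * t + t * 𝟙 (¬? (typical? v)))                             ≤⟨ ∑-mono (λ v → allMisses-lower v (typical? v)) ⟩
    ∑ (λ v → 4 * allMisses v + 4 * p)
      ≡⟨ trans (∑-distrib-+ (λ v → 4 * allMisses v) _) (cong₂ _+_ (∑-*ˡ 4 allMisses) (∑-const n (4 * p))) ⟩
    4 * ∑ allMisses + n * (4 * p)                                         ∎

  atypical≤ : N * atypical ≤ 8 * n
  atypical≤ = *-cancelˡ-≤ t {{>-nonZero (≤-trans (s≤s z≤n) 6p≤t)}} (+-cancelˡ-≤ (N * (4 * (n * t))) _ _ (begin
    N * (4 * (n * t)) + t * (N * atypical)               ≡⟨ regroup₁ N n t atypical ⟩
    N * (n * (4 * t) + t * atypical)                     ≤⟨ *-monoʳ-≤ N ∑-allMisses-lower ⟩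
    N * (4 * ∑ allMisses + n * (4 * p))                  ≡⟨ regroup₂ N (∑ allMisses) n p ⟩
    4 * (N * ∑ allMisses) + 4 * (n * (N * p))            ≤⟨ +-mono-≤ (*-monoʳ-≤ 4 ∑-allMisses) (*-monoʳ-≤ 4 (*-monoʳ-≤ n t-large)) ⟩
    4 * (t * (N * n + n)) + 4 * (n * t)                  ≡⟨ regroup₃ N n t ⟩
    N * (4 * (n * t)) + t * (8 * n)                      ∎))
    where
    regroup₁ : ∀ N n t β → N * (4 * (n * t)) + t * (N * β) ≡ N * (n * (4 * t) + t * β)
    regroup₁ = solve-∀
    regroup₂ : ∀ N m n p → N * (4 * m + n * (4 * p)) ≡ 4 * (N * m) + 4 * (n * (N * p))
    regroup₂ = solve-∀
    regroup₃ : ∀ N n t → 4 * (t * (N * n + n)) + 4 * (n * t) ≡ N * (4 * (n * t)) + t * (8 * n)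
    regroup₃ = solve-∀

  Cluster : Fin K → Fin n → Set
  Cluster i v = Typical v × label v ≡ i

  cluster? : ∀ i → Decidable (Cluster i)
  cluster? i v = typical? v ×-dec (label v ≟ i)

  cluster-disjoint : ∀ {i j v} → i ≢ j → Cluster i v → ¬ Cluster j v
  cluster-disjoint i≢j (_ , ≡i) (_ , ≡j) = i≢j (trans (sym ≡i) ≡j)

  few-misses : ∀ {i j v} → i ≢ j → Cluster i v → 4 * misses j v ≤ t + 4 * p
  few-misses {i} {j} {v} i≢j (typical , refl) = +-cancelʳ-≤ (4 * t) _ _ (begin
    4 * misses j v + 4 * t                     ≤⟨ +-monoʳ-≤ (4 * misses j v) (*-monoʳ-≤ 4 (t≤misses+p v)) ⟩
    4 * misses j v + 4 * (misses i v + p)      ≡⟨ regroup (misses j v) (misses i v) p ⟩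
    4 * (misses i v + misses j v) + 4 * p      ≤⟨ +-monoˡ-≤ (4 * p) (≤-trans (*-monoʳ-≤ 4 (two-terms≤∑ (λ i → misses i v) i≢j)) typical) ⟩
    5 * t + 4 * p                              ≡⟨ split t p ⟩
    t + 4 * p + 4 * t                          ∎)
    where
    regroup : ∀ x y p → 4 * x + 4 * (y + p) ≡ 4 * (y + x) + 4 * p
    regroup = solve-∀
    split : ∀ t p → 5 * t + 4 * p ≡ t + 4 * p + 4 * t
    split = solve-∀

  cluster-independent : ∀ {i u v} → Cluster i u → Cluster i v → ¬ Adj G u v
  cluster-independent {i} {u} {v} u∈ v∈ uv = ¬embedding (compatible-blowup⇒embedding G i u v C
    (subBlowup 𝔸 compatible) (λ j y → proj₂ (select-member (compatible j) y)) uv)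
    where
    compatibles : Fin K → ℕ
    compatibles j = count λ y → yes tt ×-dec compatible? G i u v j (part 𝔸 j y)
    everything : count {t} (λ _ → yes tt) ≡ t
    everything = count-all {t} (λ _ → yes tt) λ _ → tt
    few₀ : ∀ f → f + 2 ≤ 6 * suc f
    few₀ f = ≤-trans (m≤m+n (f + 2) (5 * f + 4)) (≤-reflexive (regroup f))
      where
      regroup : ∀ f → f + 2 + (5 * f + 4) ≡ 6 * suc f
      regroup = solve-∀
    collect₁ : ∀ p t → 4 * p + (8 * p + 2 * t) ≡ 2 * (6 * p) + 2 * t
    collect₁ = solve-∀
    collect₂ : ∀ t → 2 * t + 2 * t ≡ 4 * t
    collect₂ = solve-∀
    collect₃ : ∀ t p → (t + 4 * p) + (t + 4 * p) ≡ 8 * p + 2 * t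
    collect₃ = solve-∀
    expand : ∀ x y z → 4 * (x + (y + z)) ≡ 4 * x + (4 * y + 4 * z)
    expand = solve-∀
    enough : ∀ j → Dec (j ≡ i) → f ≤ compatibles j
    enough j (yes refl) = +-cancelʳ-≤ 2 _ _ (begin
      f + 2                          ≤⟨ few₀ f ⟩
      6 * p                          ≤⟨ 6p≤t ⟩
      t                              ≡⟨ everything ⟨
      count {t} (λ _ → yes tt)       ≤⟨ count-compatible-same G i u v (part 𝔸 i) (λ _ → yes tt) (part-injective 𝔸 i) ⟩
      compatibles i + 2              ∎)
    enough j (no j≢i) = ≤-trans (n≤1+n f) (*-cancelˡ-≤ 4 (+-cancelʳ-≤ (8 * p + 2 * t) _ _ (begin
      4 * p + (8 * p + 2 * t)                                      ≡⟨ collect₁ p t ⟩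
      2 * (6 * p) + 2 * t                                          ≤⟨ +-monoˡ-≤ (2 * t) (*-monoʳ-≤ 2 6p≤t) ⟩
      2 * t + 2 * t                                                ≡⟨ collect₂ t ⟩
      4 * t                                                        ≡⟨ cong (4 *_) everything ⟨
      4 * count {t} (λ _ → yes tt)                                 ≤⟨ *-monoʳ-≤ 4 (count-compatible-other G i u v (part 𝔸 j) (λ _ → yes tt) j≢i) ⟩
      4 * (compatibles j + (misses j u + misses j v))              ≡⟨ expand (compatibles j) (misses j u) (misses j v) ⟩
      4 * compatibles j + (4 * misses j u + 4 * misses j v)
        ≤⟨ +-monoʳ-≤ (4 * compatibles j) (+-mono-≤ (few-misses (j≢i ∘ sym) u∈) (few-misses (j≢i ∘ sym) v∈)) ⟩
      4 * compatibles j + ((t + 4 * p) + (t + 4 * p))              ≡⟨ cong (4 * compatibles j +_) (collect₃ t p) ⟩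
      4 * compatibles j + (8 * p + 2 * t)                          ∎)))
    compatible : ∀ j → Selection (λ y → ⊤ × Compatible G i u v j (part 𝔸 j y)) f
    compatible j = selection (λ y → yes tt ×-dec compatible? G i u v j (part 𝔸 j y)) f (enough j (j ≟ i))

  clusterSize : Fin K → ℕ
  clusterSize i = count (cluster? i)

  clusterSize-upper : ∀ i → N * (K * clusterSize i) ≤ N * n + n
  clusterSize-upper i with any? (cluster? i)
  ... | yes (v , v∈) =
    ≤-trans (*-monoʳ-≤ N (*-monoʳ-≤ K (count-mono (cluster? i) (λ u → ¬? (adj? G v u)) (cluster-independent v∈)))) (nonNeighbours≤ v)
  ... | no empty     =
    ≤-trans (≤-reflexive (trans (cong (λ z → N * (K * z)) (count-none (cluster? i) λ v v∈ → empty (v , v∈))) (trans (cong (N *_) (*-zeroʳ K)) (*-zeroʳ N)))) z≤n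

  ∑-clusterSize+atypical : ∑ clusterSize + atypical ≡ n
  ∑-clusterSize+atypical = begin-equality
    ∑ clusterSize + atypical                                                  ≡⟨ cong (_+ atypical) (∑-comm λ i v → 𝟙 (cluster? i v)) ⟩
    ∑ (λ v → ∑ λ i → 𝟙 (cluster? i v)) + atypical
      ≡⟨ cong (_+ atypical) (sum-cong-≗ λ v → trans (sum-cong-≗ λ i → 𝟙-× (typical? v) (label v ≟ i)) (∑-*ˡ (𝟙 (typical? v)) λ i → 𝟙 (label v ≟ i))) ⟩
    ∑ (λ v → 𝟙 (typical? v) * ∑ λ i → 𝟙 (label v ≟ i)) + atypical
      ≡⟨ cong (_+ atypical) (sum-cong-≗ λ v → trans (cong (𝟙 (typical? v) *_) (∑-𝟙-≟ (label v))) (*-identityʳ _)) ⟩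
    count typical? + atypical                                                 ≡⟨ count-complement typical? ⟩
    n                                                                         ∎

  clusterSize-lower : ∀ i → N * n ≤ N * (K * clusterSize i) + 9 * (K * n)
  clusterSize-lower i = +-cancelʳ-≤ (κ * (N * n)) _ _ (begin
    N * n + κ * (N * n)                                                ≡⟨ factor N n κ ⟩
    N * (K * n)                                                        ≡⟨ cong (λ z → N * (K * z)) ∑-clusterSize+atypical ⟨
    N * (K * (∑ clusterSize + atypical))                               ≡⟨ cong (λ z → N * (K * (z + atypical))) (sum-remove {i = i} clusterSize) ⟩
    N * (K * (clusterSize i + others + atypical))                      ≡⟨ expand N K (clusterSize i) others atypical ⟩
    N * (K * clusterSize i) + N * (K * others) + K * (N * atypical)
      ≤⟨ +-mono-≤ (+-monoʳ-≤ (N * (K * clusterSize i)) others≤) (*-monoʳ-≤ K atypical≤) ⟩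
    N * (K * clusterSize i) + κ * (N * n + n) + K * (8 * n)            ≤⟨ m≤m+n _ n ⟩
    N * (K * clusterSize i) + κ * (N * n + n) + K * (8 * n) + n        ≡⟨ regroup (N * (K * clusterSize i)) κ (N * n) n ⟩
    N * (K * clusterSize i) + 9 * (K * n) + κ * (N * n)                ∎)
    where
    others = ∑ λ j → clusterSize (punchIn i j)
    factor : ∀ N n κ → N * n + κ * (N * n) ≡ N * (suc κ * n)
    factor = solve-∀
    expand : ∀ N K x o b → N * (K * (x + o + b)) ≡ N * (K * x) + N * (K * o) + K * (N * b)
    expand = solve-∀
    regroup : ∀ x κ y n → x + κ * (y + n) + suc κ * (8 * n) + n ≡ x + 9 * (suc κ * n) + κ * y
    regroup = solve-∀
    others≤ : N * (K * others) ≤ κ * (N * n + n)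
    others≤ = begin
      N * (K * others)                                          ≡⟨ *-assoc N K others ⟨
      N * K * others                                            ≡⟨ *-distribˡ-sum (N * K) (λ j → clusterSize (punchIn i j)) ⟩
      ∑ {κ} (λ j → N * K * clusterSize (punchIn i j))
        ≤⟨ ∑≤n*c {κ} (N * n + n) (λ j → ≤-trans (≤-reflexive (*-assoc N K _)) (clusterSize-upper (punchIn i j))) ⟩
      κ * (N * n + n)                                           ∎

  few-neighbours⇒few-nonNeighbours : ∀ u {i j} q → i ≢ j → N * neighboursIn G (cluster? i) u ≤ q * n →
    N * nonNeighboursIn G (cluster? j) u ≤ (10 + q) * n
  few-neighbours⇒few-nonNeighbours u {i} {j} q i≢j few = *-cancelˡ-≤ K (+-cancelˡ-≤ (N * (K * clusterSize i)) _ _ (begin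
    N * (K * clusterSize i) + K * (N * missed)                ≡⟨ cong (λ z → N * (K * z) + K * (N * missed)) (count-split (cluster? i) (adj? G u)) ⟩
    N * (K * (seen + unseen)) + K * (N * missed)              ≡⟨ regroup₁ N K seen unseen missed ⟩
    K * (N * seen) + N * (K * (unseen + missed))
      ≤⟨ +-mono-≤ (*-monoʳ-≤ K few) (≤-trans (*-monoʳ-≤ N (*-monoʳ-≤ K disjoint)) (nonNeighbours≤ u)) ⟩
    K * (q * n) + (N * n + n)                                 ≤⟨ +-monoʳ-≤ (K * (q * n)) (+-mono-≤ (clusterSize-lower i) (m≤m+n n (κ * n))) ⟩
    K * (q * n) + (N * (K * clusterSize i) + 9 * (K * n) + K * n)   ≡⟨ regroup₂ K q n (N * (K * clusterSize i)) ⟩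
    N * (K * clusterSize i) + K * ((10 + q) * n)              ∎))
    where
    seen   = neighboursIn G (cluster? i) u
    unseen = nonNeighboursIn G (cluster? i) u
    missed = nonNeighboursIn G (cluster? j) u
    disjoint : unseen + missed ≤ nonNeighbours u
    disjoint = count-disjoint (λ w → cluster? i w ×-dec ¬? (adj? G u w)) (λ w → cluster? j w ×-dec ¬? (adj? G u w)) (λ w → ¬? (adj? G u w))
      (λ (w∈i , _) (w∈j , _) → cluster-disjoint i≢j w∈i w∈j) proj₂ proj₂
    regroup₁ : ∀ N K x y r → N * (K * (x + y)) + K * (N * r) ≡ K * (N * x) + N * (K * (y + r))
    regroup₁ = solve-∀
    regroup₂ : ∀ K q n z → K * (q * n) + (z + 9 * (K * n) + K * n) ≡ z + K * ((10 + q) * n)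
    regroup₂ = solve-∀

  clusters-nearly-joined : ∀ {i j} → i ≢ j → ∀ w → Cluster i w → N * nonNeighboursIn G (cluster? j) w ≤ 10 * n
  clusters-nearly-joined {i} i≢j w w∈ = few-neighbours⇒few-nonNeighbours w 0 i≢j
    (≤-reflexive (trans (cong (N *_) (count-none (λ u → cluster? i u ×-dec adj? G w u) λ u (u∈ , wu) → cluster-independent w∈ u∈ wu)) (*-zeroʳ N)))

  blowup-in-clusters : {P : Fin K → Fin n → Set} (P? : ∀ i → Decidable (P i)) →
    (∀ i → 10 * n * (K * p) + N * p ≤ N * count (λ w → cluster? i w ×-dec P? i w)) →
    Σ[ B ∈ Blowup G K p ] Inside B (λ i w → Cluster i w × P i w)
  blowup-in-clusters P? many = greedy-blowup G 1≤N (10 * n) p K (λ i w → cluster? i w ×-dec P? i w)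
    (λ {i} {j} i≢j w (w∈ , _) → ≤-trans
      (*-monoʳ-≤ N (count-mono (λ u → (cluster? j u ×-dec P? j u) ×-dec ¬? (adj? G w u)) (λ u → cluster? j u ×-dec ¬? (adj? G w u)) λ ((u∈ , _) , wu∉) → u∈ , wu∉))
      (clusters-nearly-joined i≢j w w∈))
    many

  Q : ℕ
  Q = 11 * (K * p)

  RarelySeen : Fin K → Fin n → Set
  RarelySeen i u = N * neighboursIn G (cluster? i) u ≤ Q * n

  rarely-seen-cluster : ∀ u → ∃[ i ] RarelySeen i u
  rarely-seen-cluster u with any? (λ i → N * neighboursIn G (cluster? i) u ≤? Q * n)
  ... | yes found = found
  ... | no none   = let B , inside = blowup-in-clusters (λ i → adj? G u) many in
    contradiction (apex⇒embedding C B u λ i y → proj₂ (inside i y)) ¬embedding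
    where
    collect : ∀ n z → 10 * n * z + n * z ≡ 11 * z * n
    collect = solve-∀
    many : ∀ i → 10 * n * (K * p) + N * p ≤ N * neighboursIn G (cluster? i) u
    many i = begin
      10 * n * (K * p) + N * p            ≤⟨ +-monoʳ-≤ (10 * n * (K * p)) n-large ⟩
      10 * n * (K * p) + n                ≡⟨ cong (10 * n * (K * p) +_) (*-identityʳ n) ⟨
      10 * n * (K * p) + n * 1            ≤⟨ +-monoʳ-≤ (10 * n * (K * p)) (*-monoʳ-≤ n (*-mono-≤ (s≤s (z≤n {κ})) (s≤s (z≤n {f})))) ⟩
      10 * n * (K * p) + n * (K * p)      ≡⟨ collect n (K * p) ⟩
      Q * n                               ≤⟨ <⇒≤ (≰⇒> λ rare → none (i , rare)) ⟩
      N * neighboursIn G (cluster? i) u   ∎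

  compatible-loss : ∀ {i u v} → RarelySeen i u → RarelySeen i v → ∀ j →
    N * clusterSize j ≤ N * count (λ w → cluster? j w ×-dec compatible? G i u v j w) + 2 * ((10 + Q) * n)
  compatible-loss {i} {u} {v} u-rare v-rare j = by-cases (j ≟ i)
    where
    compatibles = count λ w → cluster? j w ×-dec compatible? G i u v j w
    by-cases : Dec (j ≡ i) → N * clusterSize j ≤ N * compatibles + 2 * ((10 + Q) * n)
    by-cases (yes refl) = begin
      N * clusterSize i                                  ≤⟨ *-monoʳ-≤ N (count-compatible-same G i u v id (cluster? i) id) ⟩
      N * (compatibles + 2)                              ≡⟨ trans (*-distribˡ-+ N compatibles 2) (cong (N * compatibles +_) (*-comm N 2)) ⟩
      N * compatibles + 2 * N
        ≤⟨ +-monoʳ-≤ (N * compatibles) (*-monoʳ-≤ 2 (≤-trans (m≤m*n N p) (≤-trans n-large (m≤m+n n ((9 + Q) * n))))) ⟩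
      N * compatibles + 2 * ((10 + Q) * n)               ∎
    by-cases (no j≢i) = begin
      N * clusterSize j                                  ≤⟨ *-monoʳ-≤ N (count-compatible-other G i u v id (cluster? j) j≢i) ⟩
      N * (compatibles + (missedᵤ + missedᵥ))            ≡⟨ expand N compatibles missedᵤ missedᵥ ⟩
      N * compatibles + (N * missedᵤ + N * missedᵥ)
        ≤⟨ +-monoʳ-≤ (N * compatibles) (+-mono-≤ (few-neighbours⇒few-nonNeighbours u Q (j≢i ∘ sym) u-rare) (few-neighbours⇒few-nonNeighbours v Q (j≢i ∘ sym) v-rare)) ⟩
      N * compatibles + ((10 + Q) * n + (10 + Q) * n)    ≡⟨ cong (λ z → N * compatibles + ((10 + Q) * n + z)) (+-identityʳ _) ⟨
      N * compatibles + 2 * ((10 + Q) * n)               ∎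
      where
      missedᵤ = nonNeighboursIn G (cluster? j) u
      missedᵥ = nonNeighboursIn G (cluster? j) v
      expand : ∀ N x y z → N * (x + (y + z)) ≡ N * x + (N * y + N * z)
      expand = solve-∀

  rarely-seen-independent : ∀ {i u v} → RarelySeen i u → RarelySeen i v → ¬ Adj G u v
  rarely-seen-independent {i} {u} {v} u-rare v-rare uv = let B , inside = blowup-in-clusters (compatible? G i u v) many in
    ¬embedding (compatible-blowup⇒embedding G i u v C (dropFirst B) (λ j y → proj₂ (inside j (suc y))) uv)
    where
    regroup₁ : ∀ K p n → K * (10 * n * (K * p) + n) + (K * (2 * ((10 + 11 * (K * p)) * n)) + 9 * (K * n)) ≡ (32 * (K * K * p) + 30 * K) * n
    regroup₁ = solve-∀
    regroup₂ : ∀ K x y z → K * (x + y) + z ≡ K * x + (K * y + z)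
    regroup₂ = solve-∀
    many : ∀ j → 10 * n * (K * p) + N * p ≤ N * count (λ w → cluster? j w ×-dec compatible? G i u v j w)
    many j = *-cancelˡ-≤ K (+-cancelʳ-≤ loss _ _ (begin
      K * (10 * n * (K * p) + N * p) + loss                            ≤⟨ +-monoˡ-≤ loss (*-monoʳ-≤ K (+-monoʳ-≤ (10 * n * (K * p)) n-large)) ⟩
      K * (10 * n * (K * p) + n) + loss                                ≡⟨ regroup₁ K p n ⟩
      (32 * (K * K * p) + 30 * K) * n                                  ≤⟨ *-monoˡ-≤ n (+-monoʳ-≤ (32 * (K * K * p)) (*-monoʳ-≤ 30 K≤KKp)) ⟩
      (32 * (K * K * p) + 30 * (K * K * p)) * n                        ≡⟨ cong (_* n) (*-distribʳ-+ (K * K * p) 32 30) ⟨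
      62 * (K * K * p) * n                                             ≤⟨ *-monoˡ-≤ n N-large ⟩
      N * n                                                            ≤⟨ clusterSize-lower j ⟩
      N * (K * clusterSize j) + 9 * (K * n)                            ≡⟨ cong (_+ 9 * (K * n)) (x∙yz≈y∙xz N K (clusterSize j)) ⟩
      K * (N * clusterSize j) + 9 * (K * n)                            ≤⟨ +-monoˡ-≤ (9 * (K * n)) (*-monoʳ-≤ K (compatible-loss u-rare v-rare j)) ⟩
      K * (N * compatibles + 2 * ((10 + Q) * n)) + 9 * (K * n)         ≡⟨ regroup₂ K (N * compatibles) (2 * ((10 + Q) * n)) (9 * (K * n)) ⟩
      K * (N * compatibles) + loss                                     ∎))
      where
      loss = K * (2 * ((10 + Q) * n)) + 9 * (K * n)
      compatibles = count λ w → cluster? j w ×-dec compatible? G i u v j w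

  colouring : Colorable G K
  colouring = (λ v → proj₁ (rarely-seen-cluster v)) , λ u v uv same → rarely-seen-independent
    (subst (λ i → RarelySeen i u) same (proj₂ (rarely-seen-cluster u))) (proj₂ (rarely-seen-cluster v)) uv

nearTuránDegrees⇒dense : ∀ κ N {G : Graph n} → 1 ≤ n → 1 ≤ N → 2 * κ ≤ N → NearTuránDegrees (suc κ) N G → Dense G (λ _ → 1) κ (2 * suc κ) 1
nearTuránDegrees⇒dense {n} κ N {G} 1≤n 1≤N 2κ≤N minDegree = record
  { bounded  = λ _ → ≤-refl
  ; positive = subst (0 <_) (sym (∑-one n)) 1≤n
  ; degrees  = λ v _ → subst₂ (λ X d → 2 * suc κ * (κ * X) + n * 1 ≤ 2 * suc κ * (κ * d + X))
      (sym (∑-one n)) (sym (trans (transfer-const G 1 v) (*-identityʳ (deg G v)))) (bound v)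
  }
  where
  open ≤-Reasoning
  regroup₁ : ∀ κ n → 2 * suc κ * (κ * n) + n * 1 ≡ 2 * κ * (suc κ * n) + n
  regroup₁ = solve-∀
  regroup₂ : ∀ κ d n → 2 * κ * (suc κ * d + n) + n + n ≡ 2 * suc κ * (κ * d + n)
  regroup₂ = solve-∀
  expand : ∀ c N z n → c * (N * z + n) ≡ N * (c * z) + c * n
  expand = solve-∀
  scaled : ∀ v → N * (2 * κ * (suc κ * n)) ≤ N * (2 * κ * (suc κ * deg G v + n) + n)
  scaled v = begin
    N * (2 * κ * (suc κ * n))                                    ≡⟨ x∙yz≈y∙xz N (2 * κ) (suc κ * n) ⟩
    2 * κ * (N * (suc κ * n))                                    ≤⟨ *-monoʳ-≤ (2 * κ) (minDegree v) ⟩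
    2 * κ * (N * (suc κ * deg G v + n) + n)                      ≡⟨ expand (2 * κ) N (suc κ * deg G v + n) n ⟩
    N * (2 * κ * (suc κ * deg G v + n)) + 2 * κ * n              ≤⟨ +-monoʳ-≤ (N * (2 * κ * (suc κ * deg G v + n))) (*-monoˡ-≤ n 2κ≤N) ⟩
    N * (2 * κ * (suc κ * deg G v + n)) + N * n                  ≡⟨ *-distribˡ-+ N _ n ⟨
    N * (2 * κ * (suc κ * deg G v + n) + n)                      ∎
  bound : ∀ v → 2 * suc κ * (κ * n) + n * 1 ≤ 2 * suc κ * (κ * deg G v + n)
  bound v = begin
    2 * suc κ * (κ * n) + n * 1                          ≡⟨ regroup₁ κ n ⟩
    2 * κ * (suc κ * n) + n                              ≤⟨ +-monoˡ-≤ n (*-cancelˡ-≤ N {{>-nonZero 1≤N}} (scaled v)) ⟩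
    2 * κ * (suc κ * deg G v + n) + n + n                ≡⟨ regroup₂ κ (deg G v) n ⟩
    2 * suc κ * (κ * deg G v + n)                        ∎

nearTuránDegrees⇒colourable : ∀ {f κ} {F : Graph f} → CriticalColouring F (suc κ) → ∀ N → precision κ f ≤ N →
  ∃[ n₀ ] (∀ {n} (G : Graph n) → n₀ ≤ n → G IsFree F → NearTuránDegrees (suc κ) N G → Colorable G (suc κ))
nearTuránDegrees⇒colourable {f} {κ} C N N-large = n₁ + (N * suc f + 1) , λ G n-large free minDegree →
  let n-large′ = ≤-trans (m≤n+m (N * suc f + 1) n₁) n-large
      dense    = nearTuránDegrees⇒dense κ N (≤-trans (m≤n+m 1 (N * suc f)) n-large′) 1≤N 2κ≤N minDegree
      𝔸 , _    = proj₂ blowups G (λ _ → 1) 1 (≤-trans (m≤m+n n₁ _) n-large) dense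
  in Clusters.colouring C N (N * suc f) N-large ≤-refl G free (≤-trans (m≤m+n _ 1) n-large′) minDegree 𝔸
  where
  1≤k : 1 ≤ suc κ
  1≤k = s≤s z≤n
  1≤N : 1 ≤ N
  1≤N = ≤-trans (*-mono-≤ (s≤s (z≤n {61})) (*-mono-≤ (*-mono-≤ 1≤k 1≤k) (s≤s (z≤n {f})))) N-large
  2κ≤N : 2 * κ ≤ N
  2κ≤N =
    ≤-trans (*-mono-≤ (m≤m+n 2 60) (≤-trans (n≤1+n κ) (≤-trans (m≤m*n (suc κ) (suc κ * suc f)) (≤-reflexive (sym (*-assoc (suc κ) (suc κ) (suc f))))))) N-large
  blowups = dense⇒blowup κ (2 * suc κ) (s≤s z≤n) κ ≤-refl (N * suc f) (*-mono-≤ 1≤N (s≤s (z≤n {f})))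
  n₁ = proj₁ blowups

-- Asymptotic inequalities

n<2^n : ∀ n → n < 2 ^ n
n<2^n zero    = s≤s z≤n
n<2^n (suc n) = ≤-trans (+-mono-≤ (m^n>0 2 n) (n<2^n n)) (≤-reflexive (cong (2 ^ n +_) (sym (+-identityʳ (2 ^ n)))))

^-distribʳ-* : ∀ m a b → (a * b) ^ m ≡ a ^ m * b ^ m
^-distribʳ-* zero    a b = refl
^-distribʳ-* (suc m) a b = trans (cong (a * b *_) (^-distribʳ-* m a b)) (interchange a b (a ^ m) (b ^ m))

bernoulli : ∀ q m → q ^ m * (q + m) ≤ suc q ^ m * q
bernoulli q zero    = ≤-reflexive (cong (1 *_) (+-identityʳ q))
bernoulli q (suc m) = begin
  q * q ^ m * (q + suc m)            ≡⟨ regroup q (q ^ m) m ⟩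
  q ^ m * (q * (q + suc m))          ≤⟨ *-monoʳ-≤ (q ^ m) (≤-trans (m≤m+n _ m) (≤-reflexive (factor q m))) ⟩
  q ^ m * (suc q * (q + m))          ≡⟨ x∙yz≈y∙xz (q ^ m) (suc q) (q + m) ⟩
  suc q * (q ^ m * (q + m))          ≤⟨ *-monoʳ-≤ (suc q) (bernoulli q m) ⟩
  suc q * (suc q ^ m * q)            ≡⟨ *-assoc (suc q) (suc q ^ m) q ⟨
  suc q * suc q ^ m * q              ∎
  where
  open ≤-Reasoning
  regroup : ∀ q p m → q * p * (q + suc m) ≡ p * (q * (q + suc m))
  regroup = solve-∀
  factor : ∀ q m → q * (q + suc m) + m ≡ suc q * (q + m)
  factor = solve-∀

-- A gap between x and y of relative size 1/q becomes a factor L after raising to a power m ≥ L q.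
power-gap : ∀ {q x y L} m → 1 ≤ q → L * q ≤ m → suc q * y ≤ q * x → L * y ^ m ≤ x ^ m
power-gap {q} {x} {y} {L} m 1≤q Lq≤m gap = *-cancelˡ-≤ (q * q ^ m) {{>-nonZero (*-mono-≤ 1≤q (m^n>0 q {{>-nonZero 1≤q}} m))}} (begin
  q * q ^ m * (L * y ^ m)            ≡⟨ regroup₁ q (q ^ m) L (y ^ m) ⟩
  q ^ m * (L * q) * y ^ m            ≤⟨ *-monoˡ-≤ (y ^ m) (*-monoʳ-≤ (q ^ m) (≤-trans Lq≤m (m≤n+m m q))) ⟩
  q ^ m * (q + m) * y ^ m            ≤⟨ *-monoˡ-≤ (y ^ m) (bernoulli q m) ⟩
  suc q ^ m * q * y ^ m              ≡⟨ regroup₂ (suc q ^ m) q (y ^ m) ⟩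
  q * (suc q ^ m * y ^ m)            ≡⟨ cong (q *_) (^-distribʳ-* m (suc q) y) ⟨
  q * (suc q * y) ^ m                ≤⟨ *-monoʳ-≤ q (^-monoˡ-≤ m gap) ⟩
  q * (q * x) ^ m                    ≡⟨ cong (q *_) (^-distribʳ-* m q x) ⟩
  q * (q ^ m * x ^ m)                ≡⟨ *-assoc q (q ^ m) (x ^ m) ⟨
  q * q ^ m * x ^ m                  ∎)
  where
  open ≤-Reasoning
  regroup₁ : ∀ q p L y → q * p * (L * y) ≡ p * (L * q) * y
  regroup₁ = solve-∀
  regroup₂ : ∀ s q y → s * q * y ≡ q * (s * y)
  regroup₂ = solve-∀

-- If x exceeds y by more than sᵈ / N, then a large power of x exceeds the same power of y by any constant factor.
amplified-gap : ∀ x y s d κ K C N → 1 ≤ κ → y ≤ suc C * s ^ d → suc N * y + s ^ d < suc N * x →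
  let M = 2 ^ (2 * K * (suc C * suc N)) in 2 * suc N ^ M * (K * y ^ M) + s ^ (d * M) < 2 * suc N ^ M * (κ * x ^ M)
amplified-gap x y s d κ K C N₋₁ 1≤κ y≤ gap = begin-strict
  2 * N ^ M * (K * y ^ M) + s ^ (d * M)      ≡⟨ cong₂ _+_ (regroup₁ (N ^ M) K (y ^ M)) (sym (^-*-assoc s d M)) ⟩
  N ^ M * (2 * K * y ^ M) + (s ^ d) ^ M      <⟨ +-mono-≤-< (*-monoʳ-≤ (N ^ M) powers) sizes ⟩
  N ^ M * x ^ M + N ^ M * x ^ M              ≡⟨ double (N ^ M * x ^ M) ⟩
  2 * (N ^ M * x ^ M)                        ≤⟨ *-monoˡ-≤ _ (*-monoʳ-≤ 2 1≤κ) ⟩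
  2 * κ * (N ^ M * x ^ M)                    ≡⟨ regroup₂ κ (N ^ M) (x ^ M) ⟩
  2 * N ^ M * (κ * x ^ M)                    ∎
  where
  open ≤-Reasoning
  N q j M : ℕ
  N = suc N₋₁
  q = suc C * N
  j = 2 * K * q
  M = 2 ^ j
  regroup₁ : ∀ p K y → 2 * p * (K * y) ≡ p * (2 * K * y)
  regroup₁ = solve-∀
  regroup₂ : ∀ κ p x → 2 * κ * (p * x) ≡ 2 * p * (κ * x)
  regroup₂ = solve-∀
  double : ∀ x → x + x ≡ 2 * x
  double = solve-∀
  expand : ∀ c N y p → c * (N * y + p) ≡ c * N * y + c * p
  expand = solve-∀
  powers : 2 * K * y ^ M ≤ x ^ M
  powers = power-gap {q} {x} {y} {2 * K} M (s≤s z≤n) (<⇒≤ (n<2^n j)) (begin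
    y + q * y                     ≡⟨ +-comm y _ ⟩
    q * y + y                     ≤⟨ +-monoʳ-≤ (q * y) y≤ ⟩
    q * y + suc C * s ^ d         ≡⟨ expand (suc C) N y (s ^ d) ⟨
    suc C * (N * y + s ^ d)       ≤⟨ *-monoʳ-≤ (suc C) (<⇒≤ gap) ⟩
    suc C * (N * x)               ≡⟨ *-assoc (suc C) N x ⟨
    q * x                         ∎)
  sizes : (s ^ d) ^ M < N ^ M * x ^ M
  sizes = subst ((s ^ d) ^ M <_) (^-distribʳ-* M N x)
    (^-monoˡ-< M {{>-nonZero (m^n>0 2 j)}} (≤-trans (s≤s (m≤n+m (s ^ d) (N * y))) gap))

module Asymptotics (I : Set₁) (size : I → ℕ) (size-pos : ∀ i → 1 ≤ size i) where

  infix 4 _≲[_]_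

  -- X ≤ Y + o(sizeᵈ)
  record _≲[_]_ (X : I → ℕ) (d : ℕ) (Y : I → ℕ) : Set₁ where
    constructor asymptotically
    field within : ∀ N → ∃[ n₀ ] (∀ i → n₀ ≤ size i → N * X i ≤ N * Y i + size i ^ d)

  open _≲[_]_ public

  ≤⇒≲ : ∀ {X Y d} → (∀ i → X i ≤ Y i) → X ≲[ d ] Y
  ≤⇒≲ X≤Y = asymptotically λ N → 0 , λ i _ → ≤-trans (*-monoʳ-≤ N (X≤Y i)) (m≤m+n _ _)

  ≲-resp-≗ : ∀ {X X′ Y Y′ d} → X ≗ X′ → Y ≗ Y′ → X ≲[ d ] Y → X′ ≲[ d ] Y′
  ≲-resp-≗ {d = d} X≗X′ Y≗Y′ h = asymptotically λ N →
    let n₀ , bound = within h N in n₀ , λ i large → subst₂ (λ x y → N * x ≤ N * y + size i ^ d) (X≗X′ i) (Y≗Y′ i) (bound i large)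

  ≲-order : ∀ {X Y d d′} → d ≡ d′ → X ≲[ d ] Y → X ≲[ d′ ] Y
  ≲-order refl h = h

  ≲-+ : ∀ {X X′ Y Y′ d} → X ≲[ d ] Y → X′ ≲[ d ] Y′ → (λ i → X i + X′ i) ≲[ d ] (λ i → Y i + Y′ i)
  ≲-+ {X} {X′} {Y} {Y′} {d} h h′ = asymptotically λ N →
    let n₁ , bound = within h (2 * N) ; n₂ , bound′ = within h′ (2 * N) in
    n₁ + n₂ , λ i large → *-cancelˡ-≤ 2 (begin
      2 * (N * (X i + X′ i))                                         ≡⟨ expand N (X i) (X′ i) ⟩
      2 * N * X i + 2 * N * X′ i
        ≤⟨ +-mono-≤ (bound i (≤-trans (m≤m+n n₁ n₂) large)) (bound′ i (≤-trans (m≤n+m n₂ n₁) large)) ⟩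
      (2 * N * Y i + size i ^ d) + (2 * N * Y′ i + size i ^ d)       ≡⟨ collect N (Y i) (Y′ i) (size i ^ d) ⟩
      2 * (N * (Y i + Y′ i) + size i ^ d)                            ∎)
    where
    open ≤-Reasoning
    expand : ∀ N x x′ → 2 * (N * (x + x′)) ≡ 2 * N * x + 2 * N * x′
    expand = solve-∀
    collect : ∀ N y y′ p → (2 * N * y + p) + (2 * N * y′ + p) ≡ 2 * (N * (y + y′) + p)
    collect = solve-∀

  ≲-+-cancelʳ : ∀ {X Y d} (Z : I → ℕ) → (λ i → X i + Z i) ≲[ d ] (λ i → Y i + Z i) → X ≲[ d ] Y
  ≲-+-cancelʳ {X} {Y} {d} Z h = asymptotically λ N → let n₀ , bound = within h N in n₀ , λ i large → +-cancelʳ-≤ (N * Z i) _ _ (begin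
      N * X i + N * Z i                     ≡⟨ *-distribˡ-+ N (X i) (Z i) ⟨
      N * (X i + Z i)                       ≤⟨ bound i large ⟩
      N * (Y i + Z i) + size i ^ d          ≡⟨ regroup N (Y i) (Z i) (size i ^ d) ⟩
      N * Y i + size i ^ d + N * Z i        ∎)
    where
    open ≤-Reasoning
    regroup : ∀ N y z p → N * (y + z) + p ≡ N * y + p + N * z
    regroup = solve-∀

  ≲-trans : ∀ {X Y Z d} → X ≲[ d ] Y → Y ≲[ d ] Z → X ≲[ d ] Z
  ≲-trans {Y = Y} {Z} h h′ = ≲-+-cancelʳ Y (≲-resp-≗ (λ _ → refl) (λ i → +-comm (Y i) (Z i)) (≲-+ h h′))

  ≲-drop : ∀ {X Y Z d} → X ≲[ d ] (λ i → Y i + Z i) → Z ≲[ d ] (λ _ → 0) → X ≲[ d ] Y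
  ≲-drop {Y = Y} h negligible = ≲-trans h (≲-resp-≗ (λ _ → refl) (λ i → +-identityʳ _) (≲-+ (≤⇒≲ λ i → ≤-refl {Y i}) negligible))

  -- Z = O(sizeᵉ)
  record Bounded (e : ℕ) (Z : I → ℕ) : Set₁ where
    constructor bounded-by
    field
      factor : ℕ
      bound  : ∀ i → Z i ≤ suc factor * size i ^ e

  ≤⇒bounded : ∀ {e Z} → (∀ i → Z i ≤ size i ^ e) → Bounded e Z
  ≤⇒bounded Z≤ = bounded-by 0 λ i → ≤-trans (Z≤ i) (≤-reflexive (sym (*-identityˡ _)))

  bounded-^ : ∀ e → Bounded e (λ i → size i ^ e)
  bounded-^ e = ≤⇒bounded λ _ → ≤-refl

  bounded-const : ∀ c → Bounded 0 (λ _ → c)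
  bounded-const c = bounded-by c λ _ → ≤-trans (n≤1+n c) (≤-reflexive (sym (*-identityʳ (suc c))))

  bounded-* : ∀ {d e X Y} → Bounded d X → Bounded e Y → Bounded (d + e) (λ i → X i * Y i)
  bounded-* {d} {e} (bounded-by a X≤) (bounded-by b Y≤) = bounded-by (b + a * suc b) λ i → ≤-trans (*-mono-≤ (X≤ i) (Y≤ i))
    (≤-reflexive (trans (interchange (suc a) (size i ^ d) (suc b) (size i ^ e)) (cong (suc a * suc b *_) (sym (^-distribˡ-+-* (size i) d e)))))

  bounded-size* : ∀ {e X} → Bounded e X → Bounded (suc e) (λ i → size i * X i)
  bounded-size* {e} (bounded-by a X≤) = bounded-by a λ i → ≤-trans (*-monoʳ-≤ (size i) (X≤ i)) (≤-reflexive (x∙yz≈y∙xz (size i) (suc a) (size i ^ e)))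

  ≲-*ʳ : ∀ {X Y d e} Z → Bounded e Z → X ≲[ d ] Y → (λ i → X i * Z i) ≲[ d + e ] (λ i → Y i * Z i)
  ≲-*ʳ {X} {Y} {d} {e} Z (bounded-by C Z≤) h = asymptotically λ N → let n₀ , bound = within h (suc C * N) in n₀ , λ i large → *-cancelˡ-≤ (suc C) (begin
      suc C * (N * (X i * Z i))                                   ≡⟨ regroup₁ (suc C) N (X i) (Z i) ⟩
      suc C * N * X i * Z i                                       ≤⟨ *-monoˡ-≤ (Z i) (bound i large) ⟩
      (suc C * N * Y i + size i ^ d) * Z i                        ≡⟨ *-distribʳ-+ (Z i) (suc C * N * Y i) _ ⟩
      suc C * N * Y i * Z i + size i ^ d * Z i                    ≤⟨ +-monoʳ-≤ (suc C * N * Y i * Z i) (*-monoʳ-≤ (size i ^ d) (Z≤ i)) ⟩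
      suc C * N * Y i * Z i + size i ^ d * (suc C * size i ^ e)   ≡⟨ regroup₂ (suc C) N (Y i) (Z i) (size i ^ d) (size i ^ e) ⟩
      suc C * (N * (Y i * Z i) + size i ^ d * size i ^ e)         ≡⟨ cong (λ p → suc C * (N * (Y i * Z i) + p)) (^-distribˡ-+-* (size i) d e) ⟨
      suc C * (N * (Y i * Z i) + size i ^ (d + e))                ∎)
    where
    open ≤-Reasoning
    regroup₁ : ∀ c N x z → c * (N * (x * z)) ≡ c * N * x * z
    regroup₁ = solve-∀
    regroup₂ : ∀ c N y z p q → c * N * y * z + p * (c * q) ≡ c * (N * (y * z) + p * q)
    regroup₂ = solve-∀

  ≲-const* : ∀ {X Y d} c → X ≲[ d ] Y → (λ i → c * X i) ≲[ d ] (λ i → c * Y i)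
  ≲-const* {X} {Y} {d} c h = ≲-order (+-identityʳ d) (≲-resp-≗ (λ i → *-comm (X i) c) (λ i → *-comm (Y i) c) (≲-*ʳ (λ _ → c) (bounded-const c) h))

  ≲-size^* : ∀ {X Y d} e → X ≲[ d ] Y → (λ i → size i ^ e * X i) ≲[ d + e ] (λ i → size i ^ e * Y i)
  ≲-size^* {X} {Y} e h = ≲-resp-≗ (λ i → *-comm (X i) _) (λ i → *-comm (Y i) _) (≲-*ʳ (λ i → size i ^ e) (bounded-^ e) h)

  ≲-size* : ∀ {X Y d} → X ≲[ d ] Y → (λ i → size i * X i) ≲[ suc d ] (λ i → size i * Y i)
  ≲-size* {X} {Y} {d} h =
    ≲-order (+-comm d 1) (≲-resp-≗ (λ i → cong (_* X i) (*-identityʳ (size i))) (λ i → cong (_* Y i) (*-identityʳ (size i))) (≲-size^* 1 h))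

  ≲-*-mono : ∀ {X X′ Y Y′ d d′} → Bounded d′ X′ → Bounded d Y → X ≲[ d ] Y → X′ ≲[ d′ ] Y′ → (λ i → X i * X′ i) ≲[ d + d′ ] (λ i → Y i * Y′ i)
  ≲-*-mono {X} {X′} {Y} {Y′} {d} {d′} X′-bounded Y-bounded h h′ = ≲-trans (≲-*ʳ X′ X′-bounded h)
    (≲-order (+-comm d′ d) (≲-resp-≗ (λ i → *-comm (X′ i) (Y i)) (λ i → *-comm (Y′ i) (Y i)) (≲-*ʳ Y Y-bounded h′)))

  ≲-const*-cancel : ∀ {X Y d} c → 1 ≤ c → (λ i → c * X i) ≲[ d ] (λ i → c * Y i) → X ≲[ d ] Y
  ≲-const*-cancel {X} {Y} {d} c 1≤c h = asymptotically λ N → let n₀ , bound = within h N in n₀ , λ i large → *-cancelˡ-≤ c {{>-nonZero 1≤c}} (begin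
      c * (N * X i)                      ≡⟨ x∙yz≈y∙xz c N (X i) ⟩
      N * (c * X i)                      ≤⟨ bound i large ⟩
      N * (c * Y i) + size i ^ d         ≤⟨ +-monoʳ-≤ (N * (c * Y i)) (≤-trans (≤-reflexive (sym (*-identityˡ _))) (*-monoˡ-≤ (size i ^ d) 1≤c)) ⟩
      N * (c * Y i) + c * size i ^ d     ≡⟨ factor c N (Y i) (size i ^ d) ⟩
      c * (N * Y i + size i ^ d)         ∎)
    where
    open ≤-Reasoning
    factor : ∀ c N y p → N * (c * y) + c * p ≡ c * (N * y + p)
    factor = solve-∀

  ≲-size^*-cancel : ∀ {X Y d} e → (λ i → size i ^ e * X i) ≲[ d + e ] (λ i → size i ^ e * Y i) → X ≲[ d ] Y
  ≲-size^*-cancel {X} {Y} {d} e h = asymptotically λ N → let n₀ , bound = within h N in n₀ , λ i large → *-cancelˡ-≤ (size i ^ e) {{size^≢0 i}} (begin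
      size i ^ e * (N * X i)                               ≡⟨ x∙yz≈y∙xz (size i ^ e) N (X i) ⟩
      N * (size i ^ e * X i)                               ≤⟨ bound i large ⟩
      N * (size i ^ e * Y i) + size i ^ (d + e)            ≡⟨ cong (N * (size i ^ e * Y i) +_) (^-distribˡ-+-* (size i) d e) ⟩
      N * (size i ^ e * Y i) + size i ^ d * size i ^ e     ≡⟨ factor (size i ^ e) N (Y i) (size i ^ d) ⟩
      size i ^ e * (N * Y i + size i ^ d)                  ∎)
    where
    open ≤-Reasoning
    size^≢0 : ∀ i → NonZero (size i ^ e)
    size^≢0 i = m^n≢0 (size i) e {{>-nonZero (size-pos i)}}
    factor : ∀ c N y p → N * (c * y) + p * c ≡ c * (N * y + p)
    factor = solve-∀

  bounded⇒≲0 : ∀ {X d} → Bounded d X → X ≲[ suc d ] (λ _ → 0)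
  bounded⇒≲0 {X} {d} (bounded-by C X≤) = asymptotically λ N → N * suc C , λ i large → begin
      N * X i                           ≤⟨ *-monoʳ-≤ N (X≤ i) ⟩
      N * (suc C * size i ^ d)          ≡⟨ *-assoc N (suc C) _ ⟨
      N * suc C * size i ^ d            ≤⟨ *-monoˡ-≤ (size i ^ d) large ⟩
      size i * size i ^ d               ≤⟨ m≤n+m _ (N * 0) ⟩
      N * 0 + size i * size i ^ d       ∎
    where open ≤-Reasoning

  ≲0-sqrt : ∀ {X d} → (λ i → X i * X i) ≲[ d + d ] (λ _ → 0) → X ≲[ d ] (λ _ → 0)
  ≲0-sqrt {X} {d} h = asymptotically λ N → let n₀ , bound = within h (N * N) in n₀ , λ i large → ≮⇒≥ λ big → contradiction (begin
      N * X i * (N * X i)                       ≡⟨ interchange N (X i) N (X i) ⟩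
      N * N * (X i * X i)                       ≤⟨ bound i large ⟩
      N * N * 0 + size i ^ (d + d)              ≡⟨ cong₂ _+_ (*-zeroʳ (N * N)) (^-distribˡ-+-* (size i) d d) ⟩
      size i ^ d * size i ^ d                   ∎) (<⇒≱ (square-mono N i big))
    where
    open ≤-Reasoning
    square-mono : ∀ N i → N * 0 + size i ^ d < N * X i → size i ^ d * size i ^ d < N * X i * (N * X i)
    square-mono N i big = *-mono-< size^d< size^d<
      where
      size^d< : size i ^ d < N * X i
      size^d< = subst (λ z → z + size i ^ d < N * X i) (*-zeroʳ N) big

  -- The constants κ and K do not matter, since a gap between X and Y would be amplified by large powers.
  ≲-from-powers : ∀ {X Y d κ K} → 1 ≤ κ → Bounded d Y →
    (∀ j → (λ i → κ * X i ^ (2 ^ j)) ≲[ d * 2 ^ j ] (λ i → K * Y i ^ (2 ^ j))) → X ≲[ d ] Y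
  ≲-from-powers {X} {Y} {d} {κ} {K} 1≤κ (bounded-by C Y≤) h = asymptotically λ
    { zero    → 0 , λ i _ → z≤n
    ; (suc N) → let m = 2 ^ (2 * K * (suc C * suc N)) ; n₀ , bound = within (h (2 * K * (suc C * suc N))) (2 * suc N ^ m) in
        n₀ , λ i large → ≮⇒≥ λ gap → contradiction (bound i large) (<⇒≱ (amplified-gap (X i) (Y i) (size i) d κ K C N 1≤κ (Y≤ i) gap))
    }

-- Walks

∸-square : ∀ x y → (x ∸ y) * (x ∸ y) + 2 * (x * y) ≤ x * x + y * y
∸-square x y with ≤-total y x
... | inj₁ y≤x = ≤-reflexive (subst (λ t → (x ∸ y) * (x ∸ y) + 2 * (t * y) ≡ t * t + y * y) (m+[n∸m]≡n y≤x) (expand y (x ∸ y)))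
  where
  expand : ∀ y d → d * d + 2 * ((y + d) * y) ≡ (y + d) * (y + d) + y * y
  expand = solve-∀
... | inj₂ x≤y rewrite m≤n⇒m∸n≡0 x≤y = subst (λ t → 2 * (x * t) ≤ x * x + t * t) (m+[n∸m]≡n x≤y)
  (≤-trans (m≤m+n _ ((y ∸ x) * (y ∸ x))) (≤-reflexive (expand x (y ∸ x))))
  where
  expand : ∀ x d → 2 * (x * (x + d)) + d * d ≡ x * x + (x + d) * (x + d)
  expand = solve-∀

cauchy-schwarz : (x : Fin n → ℕ) → ∑ x * ∑ x ≤ n * ∑ (λ v → x v * x v)
cauchy-schwarz {n} x = *-cancelˡ-≤ 2 (begin
  2 * (∑ x * ∑ x)                                       ≡⟨ cong (2 *_) (trans (*-distribʳ-sum (∑ x) x) (sum-cong-≗ λ u → *-distribˡ-sum (x u) x)) ⟩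
  2 * ∑ (λ u → ∑ λ v → x u * x v)
    ≡⟨ trans (*-distribˡ-sum 2 λ u → ∑ λ v → x u * x v) (sum-cong-≗ λ u → *-distribˡ-sum 2 λ v → x u * x v) ⟩
  ∑ (λ u → ∑ λ v → 2 * (x u * x v))
    ≤⟨ ∑-mono (λ u → ∑-mono λ v → ≤-trans (m≤n+m _ ((x u ∸ x v) * (x u ∸ x v))) (∸-square (x u) (x v))) ⟩
  ∑ (λ u → ∑ λ v → x u * x u + x v * x v)
    ≡⟨ sum-cong-≗ (λ u → trans (∑-distrib-+ (λ _ → x u * x u) λ v → x v * x v) (cong (_+ q) (∑-const n (x u * x u)))) ⟩
  ∑ (λ u → n * (x u * x u) + q)
    ≡⟨ trans (∑-distrib-+ (λ u → n * (x u * x u)) _) (cong₂ _+_ (∑-*ˡ n λ u → x u * x u) (∑-const n q)) ⟩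
  n * q + n * q                                         ≡⟨ double (n * q) ⟩
  2 * (n * q)                                           ∎)
  where
  open ≤-Reasoning
  q = ∑ λ v → x v * x v
  double : ∀ x → x + x ≡ 2 * x
  double = solve-∀

walksFrom : Graph n → ℕ → Fin n → ℕ
walksFrom G a = homsFrom G (replicate a true)

walks : Graph n → ℕ → ℕ
walks G a = ∑ (walksFrom G a)

∑-walksFrom² : (G : Graph n) (a b : ℕ) → ∑ (λ v → walksFrom G a v * walksFrom G b v) ≡ walks G (a + b)
∑-walksFrom² G zero    b = sum-cong-≗ λ v → *-identityˡ (walksFrom G b v)
∑-walksFrom² G (suc a) b = begin
  ∑ (λ v → transfer G true (walksFrom G a) v * walksFrom G b v)   ≡⟨ transfer-adjoint G true (walksFrom G a) (walksFrom G b) ⟨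
  ∑ (λ v → walksFrom G a v * walksFrom G (suc b) v)               ≡⟨ ∑-walksFrom² G a (suc b) ⟩
  walks G (a + suc b)                                             ≡⟨ cong (walks G) (+-suc a b) ⟩
  walks G (suc a + b)                                             ∎
  where open ≡-Reasoning

walksFrom-1 : (G : Graph n) (v : Fin n) → walksFrom G 1 v ≡ deg G v
walksFrom-1 G v = trans (transfer-const G 1 v) (*-identityʳ (deg G v))

walks≤ : (G : Graph n) (a : ℕ) → walks G a ≤ n ^ suc a
walks≤ {n} G a = ∑≤n*c (n ^ a) (homsFrom≤ G (replicate a true))

walks-suc≤ : (G : Graph n) (a : ℕ) → walks G (suc a) ≤ n * walks G a
walks-suc≤ G a = ∑≤n*c _ (transfer≤∑ G true (walksFrom G a))

walks²≤ : (G : Graph n) (a : ℕ) → walks G a * walks G a ≤ n * walks G (a + a)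
walks²≤ {n} G a = ≤-trans (cauchy-schwarz (walksFrom G a)) (≤-reflexive (cong (n *_) (∑-walksFrom² G a a)))

-- Walks whose number of vertices is 2ⁱ (a + 1).
doubled : ℕ → ℕ → ℕ
doubled a zero    = a
doubled a (suc i) = doubled a i + suc (doubled a i)

suc-doubled : ∀ a i → suc (doubled a i) ≡ suc a * 2 ^ i
suc-doubled a zero    = sym (*-identityʳ (suc a))
suc-doubled a (suc i) = trans (cong₂ _+_ (suc-doubled a i) (suc-doubled a i)) (collect (suc a) (2 ^ i))
  where
  collect : ∀ a p → a * p + a * p ≡ a * (2 * p)
  collect = solve-∀

^-2^suc : ∀ x i → x ^ (2 ^ suc i) ≡ x ^ (2 ^ i) * x ^ (2 ^ i)
^-2^suc x i = trans (cong (λ e → x ^ (2 ^ i + e)) (+-identityʳ (2 ^ i))) (^-distribˡ-+-* x (2 ^ i) (2 ^ i))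

walks-^-2^ : (G : Graph (suc n)) (a i : ℕ) → walks G (suc a) ^ (2 ^ i) * suc n ≤ suc n ^ (2 ^ i) * walks G (suc (doubled a i))
walks-^-2^ {n} G a zero    = ≤-reflexive (regroup (walks G (suc a)) (suc n))
  where
  regroup : ∀ w s → w * 1 * s ≡ s * 1 * w
  regroup = solve-∀
walks-^-2^ {n} G a (suc i) = *-cancelʳ-≤ _ _ (suc n) (begin
  w ^ (2 ^ suc i) * s * s                        ≡⟨ cong (λ p → p * s * s) (^-2^suc w i) ⟩
  w ^ (2 ^ i) * w ^ (2 ^ i) * s * s              ≡⟨ regroup (w ^ (2 ^ i)) s ⟩
  w ^ (2 ^ i) * s * (w ^ (2 ^ i) * s)            ≤⟨ *-mono-≤ (walks-^-2^ G a i) (walks-^-2^ G a i) ⟩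
  s ^ (2 ^ i) * w′ * (s ^ (2 ^ i) * w′)          ≡⟨ interchange (s ^ (2 ^ i)) w′ (s ^ (2 ^ i)) w′ ⟩
  s ^ (2 ^ i) * s ^ (2 ^ i) * (w′ * w′)          ≤⟨ *-monoʳ-≤ (s ^ (2 ^ i) * s ^ (2 ^ i)) (walks²≤ G (suc (doubled a i))) ⟩
  s ^ (2 ^ i) * s ^ (2 ^ i) * (s * w″)           ≡⟨ cong (_* (s * w″)) (^-2^suc s i) ⟨
  s ^ (2 ^ suc i) * (s * w″)                     ≡⟨ x∙yz≈xz∙y (s ^ (2 ^ suc i)) s w″ ⟩
  s ^ (2 ^ suc i) * w″ * s                       ∎)
  where
  open ≤-Reasoning
  s  = suc n
  w  = walks G (suc a)
  w′ = walks G (suc (doubled a i))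
  w″ = walks G (suc (doubled a (suc i)))
  regroup : ∀ p s → p * p * s * s ≡ p * s * (p * s)
  regroup = solve-∀

walks-^-2^≤ : (G : Graph (suc n)) (a i : ℕ) → walks G (suc a) ^ (2 ^ i) ≤ suc n ^ (2 ^ i) * walks G (doubled a i)
walks-^-2^≤ {n} G a i = *-cancelʳ-≤ _ _ (suc n) (begin
  walks G (suc a) ^ (2 ^ i) * suc n                          ≤⟨ walks-^-2^ G a i ⟩
  suc n ^ (2 ^ i) * walks G (suc (doubled a i))              ≤⟨ *-monoʳ-≤ (suc n ^ (2 ^ i)) (walks-suc≤ G (doubled a i)) ⟩
  suc n ^ (2 ^ i) * (suc n * walks G (doubled a i))          ≡⟨ x∙yz≈xz∙y (suc n ^ (2 ^ i)) (suc n) (walks G (doubled a i)) ⟩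
  suc n ^ (2 ^ i) * walks G (doubled a i) * suc n            ∎)
  where open ≤-Reasoning

-- Walks in F-free graphs

module FreeFamily {f κ : ℕ} {F : Graph f} (C : CriticalColouring F (suc κ)) (1≤κ : 1 ≤ κ)
  (I : Set₁) (order : I → ℕ) (G : ∀ i → Graph (suc (order i))) (free : ∀ i → G i IsFree F) where

  K : ℕ
  K = suc κ

  size : I → ℕ
  size i = suc (order i)

  open Asymptotics I size (λ _ → s≤s z≤n) public

  one : I → ℕ
  one _ = 1

  infix 4 _⊴[_,_,_]_

  -- X ≤ (κ / K)ᵉ sizeᵈ Y + o(sizeᵈ⁺ᶜ), for Y of order sizeᶜ
  record _⊴[_,_,_]_ (X : I → ℕ) (e d c : ℕ) (Y : I → ℕ) : Set₁ where
    constructor ratio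
    field scaled : (λ i → K ^ e * X i) ≲[ d + c ] (λ i → κ ^ e * (size i ^ d * Y i))

  open _⊴[_,_,_]_ public

  ≤⇒⊴ : ∀ {X Y d c} → (∀ i → X i ≤ size i ^ d * Y i) → X ⊴[ 0 , d , c ] Y
  ≤⇒⊴ X≤Y = ratio (≤⇒≲ λ i → *-monoʳ-≤ 1 (X≤Y i))

  ⊴-resp : ∀ {X X′ Y Y′ e e′ d d′ c} → e ≡ e′ → d ≡ d′ → X ≗ X′ → Y ≗ Y′ → X ⊴[ e , d , c ] Y → X′ ⊴[ e′ , d′ , c ] Y′
  ⊴-resp {e = e} {d = d} refl refl X≗X′ Y≗Y′ h = ratio
    (≲-resp-≗ (λ i → cong (K ^ e *_) (X≗X′ i)) (λ i → cong (λ y → κ ^ e * (size i ^ d * y)) (Y≗Y′ i)) (scaled h))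

  ⊴-+ : ∀ {X X′ Y Y′ e d c} → X ⊴[ e , d , c ] Y → X′ ⊴[ e , d , c ] Y′ → (λ i → X i + X′ i) ⊴[ e , d , c ] (λ i → Y i + Y′ i)
  ⊴-+ {X} {X′} {Y} {Y′} {e} {d} h h′ = ratio (≲-resp-≗ (λ i → sym (*-distribˡ-+ (K ^ e) (X i) (X′ i)))
    (λ i → factor (κ ^ e) (size i ^ d) (Y i) (Y′ i)) (≲-+ (scaled h) (scaled h′)))
    where
    factor : ∀ p q y y′ → p * (q * y) + p * (q * y′) ≡ p * (q * (y + y′))
    factor = solve-∀

  ⊴-const* : ∀ {X Y e d c} a → X ⊴[ e , d , c ] Y → (λ i → a * X i) ⊴[ e , d , c ] (λ i → a * Y i)
  ⊴-const* {X} {Y} {e} {d} a h =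
    ratio (≲-resp-≗ (λ i → x∙yz≈y∙xz a (K ^ e) (X i)) (λ i → regroup a (κ ^ e) (size i ^ d) (Y i)) (≲-const* a (scaled h)))
    where
    regroup : ∀ a p q y → a * (p * (q * y)) ≡ p * (q * (a * y))
    regroup = solve-∀

  ⊴-trans : ∀ {X Y Z e d c e′ d′ c′} → c ≡ d′ + c′ → X ⊴[ e , d , c ] Y → Y ⊴[ e′ , d′ , c′ ] Z → X ⊴[ e + e′ , d + d′ , c′ ] Z
  ⊴-trans {X} {Y} {Z} {e} {d} {_} {e′} {d′} {c′} refl h h′ = ratio (≲-order (sym (+-assoc d d′ c′)) (≲-trans
    (≲-resp-≗ (λ i → trans (x∙yz≈yx∙z (K ^ e′) (K ^ e) (X i)) (cong (_* X i) (sym (^-distribˡ-+-* K e e′)))) (λ _ → refl) (≲-const* (K ^ e′) (scaled h)))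
    (≲-order (+-comm (d′ + c′) d) (≲-resp-≗
      (λ i → regroup₁ (κ ^ e) (size i ^ d) (K ^ e′) (Y i))
      (λ i → trans (regroup₂ (κ ^ e) (size i ^ d) (κ ^ e′) (size i ^ d′) (Z i)) (cong₂ (λ p q → p * (q * Z i)) (sym (^-distribˡ-+-* κ e e′)) (sym (^-distribˡ-+-* (size i) d d′))))
      (≲-const* (κ ^ e) (≲-size^* d (scaled h′)))))))
    where
    regroup₁ : ∀ p q r y → p * (q * (r * y)) ≡ r * (p * (q * y))
    regroup₁ = solve-∀
    regroup₂ : ∀ p q p′ q′ z → p * (q * (p′ * (q′ * z))) ≡ p * p′ * (q * q′ * z)
    regroup₂ = solve-∀

  ⊴-* : ∀ {X X′ Y Y′ e d c e′ d′ c′} → Bounded (d′ + c′) X′ → Bounded c Y → X ⊴[ e , d , c ] Y → X′ ⊴[ e′ , d′ , c′ ] Y′ →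
    (λ i → X i * X′ i) ⊴[ e + e′ , d + d′ , c + c′ ] (λ i → Y i * Y′ i)
  ⊴-* {X} {X′} {Y} {Y′} {e} {d} {c} {e′} {d′} {c′} X′-bounded Y-bounded h h′ = ratio (≲-order (+-interchange d c d′ c′) (≲-resp-≗
    (λ i → trans (interchange (K ^ e) (X i) (K ^ e′) (X′ i)) (cong (_* (X i * X′ i)) (sym (^-distribˡ-+-* K e e′))))
    (λ i → trans (regroup (κ ^ e) (size i ^ d) (Y i) (κ ^ e′) (size i ^ d′) (Y′ i)) (cong₂ (λ p q → p * (q * (Y i * Y′ i))) (sym (^-distribˡ-+-* κ e e′)) (sym (^-distribˡ-+-* (size i) d d′))))
    (≲-*-mono (bounded-* (bounded-const (K ^ e′)) X′-bounded) (bounded-* (bounded-const (κ ^ e)) (bounded-* (bounded-^ d) Y-bounded)) (scaled h) (scaled h′))))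
    where
    regroup : ∀ p q y p′ q′ y′ → p * (q * y) * (p′ * (q′ * y′)) ≡ p * p′ * (q * q′ * (y * y′))
    regroup = solve-∀

  ⊴-peel : ∀ {X Y e d c} → X ⊴[ suc e , suc d , c ] Y → (λ i → K * X i) ⊴[ e , d , suc c ] (λ i → κ * (size i * Y i))
  ⊴-peel {X} {Y} {e} {d} {c} h = ratio (≲-order (sym (+-suc d c)) (≲-resp-≗ (λ i → sym (x∙yz≈yx∙z (K ^ e) K (X i)))
    (λ i → regroup κ (κ ^ e) (size i) (size i ^ d) (Y i)) (scaled h)))
    where
    regroup : ∀ κ p n q y → κ * p * (n * q * y) ≡ p * (q * (κ * (n * y)))
    regroup = solve-∀

  w : ℕ → I → ℕ
  w a i = walks (G i) a

  bounded-w : ∀ a → Bounded (suc a) (w a)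
  bounded-w a = ≤⇒bounded λ i → walks≤ (G i) a

  walks-double : ∀ a → (λ i → K * w (a + suc a) i) ≲[ suc a + suc a ] (λ i → κ * (w a i * w a i))
  walks-double a = asymptotically λ N → let n₀ , bound = weighted-turán C N in n₀ , λ i large →
    +-cancelʳ-≤ (N * (w a i * w a i)) _ _ (begin
      N * (K * w (a + suc a) i) + N * (w a i * w a i)                                 ≡⟨ *-distribˡ-+ N _ _ ⟨
      N * (K * w (a + suc a) i + w a i * w a i)
        ≡⟨ cong (λ e → N * (K * e + w a i * w a i)) (∑-walksFrom² (G i) a (suc a)) ⟨
      N * (K * energy (G i) (walksFrom (G i) a) + w a i * w a i)
        ≤⟨ bound (G i) large (free i) (size i ^ a) (walksFrom (G i) a) (homsFrom≤ (G i) (replicate a true)) ⟩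
      N * (K * (w a i * w a i)) + size i * (size i * (size i ^ a * size i ^ a))
        ≡⟨ cong₂ _+_ (expand N κ (w a i * w a i)) (trans (regroup₁ (size i) (size i ^ a)) (sym (^-distribˡ-+-* (size i) (suc a) (suc a)))) ⟩
      N * (κ * (w a i * w a i)) + N * (w a i * w a i) + size i ^ (suc a + suc a)
        ≡⟨ regroup₂ (N * (κ * (w a i * w a i))) (N * (w a i * w a i)) (size i ^ (suc a + suc a)) ⟩
      N * (κ * (w a i * w a i)) + size i ^ (suc a + suc a) + N * (w a i * w a i)      ∎)
    where
    open ≤-Reasoning
    expand : ∀ N κ x → N * (suc κ * x) ≡ N * (κ * x) + N * x
    expand = solve-∀
    regroup₁ : ∀ n p → n * (n * (p * p)) ≡ n * p * (n * p)
    regroup₁ = solve-∀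
    regroup₂ : ∀ x y z → x + y + z ≡ x + z + y
    regroup₂ = solve-∀

  walks-doubled : ∀ a j → (λ i → κ * (K ^ (2 ^ j) * w (doubled a j) i)) ≲[ suc (doubled a j) ] (λ i → K * (κ ^ (2 ^ j) * w a i ^ (2 ^ j)))
  walks-doubled a zero = ≤⇒≲ λ i → ≤-reflexive (regroup κ (w a i))
    where
    regroup : ∀ κ x → κ * (suc κ * 1 * x) ≡ suc κ * (κ * 1 * (x * 1))
    regroup = solve-∀
  walks-doubled a (suc j) = ≲-const*-cancel K (s≤s z≤n) (≲-trans
    (≲-resp-≗
      (λ i → trans (regroup₁ κ (K ^ M * K ^ M) K (w (d + suc d) i)) (cong (λ p → K * (κ * (p * w (d + suc d) i))) (sym (^-2^suc K j))))
      (λ i → regroup₂ κ (K ^ M) (w d i))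
      (≲-const* (κ * (K ^ M * K ^ M)) (walks-double d)))
    (≲-resp-≗ (λ _ → refl)
      (λ i → trans (regroup₃ K (κ ^ M) (w a i ^ M)) (cong₂ (λ p q → K * (K * (p * q))) (sym (^-2^suc κ j)) (sym (^-2^suc (w a i) j))))
      (≲-*-mono (bounded-* (bounded-const κ) (bounded-* (bounded-const (K ^ M)) (bounded-w d))) (bounded-* (bounded-const K) (bounded-* (bounded-const (κ ^ M)) bounded-power))
        (walks-doubled a j) (walks-doubled a j))))
    where
    M = 2 ^ j
    d = doubled a j
    regroup₁ : ∀ κ p K x → κ * p * (K * x) ≡ K * (κ * (p * x))
    regroup₁ = solve-∀
    regroup₂ : ∀ κ p x → κ * (p * p) * (κ * (x * x)) ≡ κ * (p * x) * (κ * (p * x))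
    regroup₂ = solve-∀
    regroup₃ : ∀ K p x → K * (p * x) * (K * (p * x)) ≡ K * (K * (p * p * (x * x)))
    regroup₃ = solve-∀
    bounded-power : Bounded (suc d) (λ i → w a i ^ M)
    bounded-power = ≤⇒bounded λ i → ≤-trans (^-monoˡ-≤ M (walks≤ (G i) a))
      (≤-reflexive (trans (^-*-assoc (size i) (suc a) M) (cong (size i ^_) (sym (suc-doubled a j)))))

  walks-ratio : ∀ a → w (suc a) ⊴[ 1 , 1 , suc a ] w a
  walks-ratio a = ratio (≲-resp-≗ (λ i → cong (_* w (suc a) i) (sym (*-identityʳ K))) (λ i → regroup κ (size i) (w a i))
    (≲-from-powers {κ = κ} {K = K} 1≤κ (bounded-* (bounded-const κ) (bounded-size* (bounded-w a))) powers))
    where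
    regroup : ∀ κ n x → κ * (n * x) ≡ κ * 1 * (n * 1 * x)
    regroup = solve-∀
    powers : ∀ j → (λ i → κ * (K * w (suc a) i) ^ (2 ^ j)) ≲[ suc (suc a) * 2 ^ j ] (λ i → K * (κ * (size i * w a i)) ^ (2 ^ j))
    powers j = ≲-trans (≤⇒≲ bound)
      (≲-order (trans (cong (_+ M) (suc-doubled a j)) (+-comm (suc a * M) M))
        (≲-resp-≗ (λ _ → refl) (λ i → trans (regroup₂ (size i ^ M) K (κ ^ M) (w a i ^ M))
            (cong (K *_) (trans (cong (κ ^ M *_) (sym (^-distribʳ-* M (size i) (w a i)))) (sym (^-distribʳ-* M κ (size i * w a i))))))
          (≲-size^* M (walks-doubled a j))))
      where
      M = 2 ^ j
      regroup₁ : ∀ κ p q x → κ * (p * (q * x)) ≡ q * (κ * (p * x))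
      regroup₁ = solve-∀
      regroup₂ : ∀ q K p x → q * (K * (p * x)) ≡ K * (p * (q * x))
      regroup₂ = solve-∀
      bound : ∀ i → κ * (K * w (suc a) i) ^ M ≤ size i ^ M * (κ * (K ^ M * w (doubled a j) i))
      bound i = begin
        κ * (K * w (suc a) i) ^ M                          ≡⟨ cong (κ *_) (^-distribʳ-* M K (w (suc a) i)) ⟩
        κ * (K ^ M * w (suc a) i ^ M)                      ≤⟨ *-monoʳ-≤ κ (*-monoʳ-≤ (K ^ M) (walks-^-2^≤ (G i) a j)) ⟩
        κ * (K ^ M * (size i ^ M * w (doubled a j) i))     ≡⟨ regroup₁ κ (K ^ M) (size i ^ M) (w (doubled a j) i) ⟩
        size i ^ M * (κ * (K ^ M * w (doubled a j) i))     ∎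
        where open ≤-Reasoning

  walks-ratio-iterated : ∀ b a → w (b + a) ⊴[ b , b , suc a ] w a
  walks-ratio-iterated zero    a = ≤⇒⊴ λ i → ≤-reflexive (sym (*-identityˡ (w a i)))
  walks-ratio-iterated (suc b) a = ⊴-trans (sym (+-suc b a)) (walks-ratio (b + a)) (walks-ratio-iterated b a)

  homsAfterWalk : ℕ → Vec Bool m → I → ℕ
  homsAfterWalk a bs i = ∑ λ v → walksFrom (G i) a v * homsFrom (G i) bs v

  homsAfterWalk-[] : ∀ a → w a ≗ homsAfterWalk a []
  homsAfterWalk-[] a i = sum-cong-≗ λ v → sym (*-identityʳ (walksFrom (G i) a v))

  homsAfterWalk-true : ∀ a (bs : Vec Bool m) → homsAfterWalk (suc a) bs ≗ homsAfterWalk a (true ∷ bs)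
  homsAfterWalk-true a bs i = sym (transfer-adjoint (G i) true (walksFrom (G i) a) (homsFrom (G i) bs))

  homsAfterWalk-false : ∀ a (bs : Vec Bool m) → (λ i → w a i * homsAfterWalk 0 bs i) ≗ homsAfterWalk a (false ∷ bs)
  homsAfterWalk-false a bs i = *-distribʳ-sum (homsAfterWalk 0 bs i) (walksFrom (G i) a)

  bounded-homs : (bs : Vec Bool m) → Bounded (suc m + 0) (homsAfterWalk 0 bs)
  bounded-homs {m} bs = ≤⇒bounded λ i → ≤-trans (∑≤n*c (size i ^ m) λ v → ≤-trans (≤-reflexive (*-identityˡ _)) (homsFrom≤ (G i) bs v))
    (≤-reflexive (cong (size i ^_) (sym (+-identityʳ (suc m)))))

  homs-ratio : ∀ a (bs : Vec Bool m) → homsAfterWalk a bs ⊴[ a + edgeCount bs , a + suc m , 0 ] one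
  homs-ratio a []                   = ⊴-resp refl refl (λ i → trans (cong (λ b → w b i) (+-identityʳ a)) (homsAfterWalk-[] a i)) (λ _ → refl)
    (⊴-trans {d′ = 1} refl (walks-ratio-iterated a 0) (≤⇒⊴ λ i → ≤-trans (walks≤ (G i) 0) (≤-reflexive (sym (*-identityʳ _)))))
  homs-ratio {suc m} a (true ∷ bs)  =
    ⊴-resp (sym (+-suc a (edgeCount bs))) (sym (+-suc a (suc m))) (homsAfterWalk-true a bs) (λ _ → refl) (homs-ratio (suc a) bs)
  homs-ratio {suc m} a (false ∷ bs) = ⊴-resp (cong (_+ edgeCount bs) (+-identityʳ a)) (trans (cong (_+ suc m) (+-comm a 1)) (sym (+-suc a (suc m))))
    (homsAfterWalk-false a bs) (λ _ → refl)
    (⊴-* (bounded-homs bs) (bounded-const 1) (⊴-resp refl refl (λ i → sym (homsAfterWalk-[] a i)) (λ _ → refl) (homs-ratio a [])) (homs-ratio 0 bs))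

  homs-ratio-edges : ∀ a (bs : Vec Bool m) {e d} → a + edgeCount bs ≡ suc e → a + suc m ≡ suc (suc d) → homsAfterWalk a bs ⊴[ e , d , 2 ] w 1
  homs-ratio-edges zero    []                 () _
  homs-ratio-edges (suc a) []                 e≡ d≡ = ⊴-resp
    (suc-injectiveℕ (trans (sym (+-identityʳ (suc a))) e≡)) (suc-injectiveℕ (trans (+-comm 1 a) (suc-injectiveℕ d≡)))
    (λ i → trans (cong (λ b → w b i) (+-comm a 1)) (homsAfterWalk-[] (suc a) i)) (λ _ → refl) (walks-ratio-iterated a 1)
  homs-ratio-edges {suc m} a    (true ∷ bs)        e≡ d≡ = ⊴-resp refl refl (homsAfterWalk-true a bs) (λ _ → refl)
    (homs-ratio-edges (suc a) bs (trans (sym (+-suc a (edgeCount bs))) e≡) (trans (sym (+-suc a (suc m))) d≡))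
  homs-ratio-edges {suc m} (suc a) (false ∷ bs)    e≡ d≡ =
    ⊴-resp (suc-injectiveℕ e≡) (suc-injectiveℕ (trans (sym (+-suc a (suc m))) (suc-injectiveℕ d≡)))
    (homsAfterWalk-false (suc a) bs) (λ i → *-identityʳ (w 1 i))
    (⊴-* (bounded-homs bs) (bounded-w 1) (⊴-resp refl refl (λ i → cong (λ b → w b i) (+-comm a 1)) (λ _ → refl) (walks-ratio-iterated a 1)) (homs-ratio 0 bs))
  homs-ratio-edges {suc zero}    zero (false ∷ []) () _
  homs-ratio-edges {suc (suc m)} zero (false ∷ bs) {e} e≡ refl = ⊴-resp (+-identityʳ e) (+-comm m 1)
    (λ i → trans (*-comm (homsAfterWalk 0 bs i) (w 0 i)) (homsAfterWalk-false 0 bs i)) (λ i → *-identityʳ (w 1 i))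
    (⊴-* (bounded-w 0) (bounded-w 1) (homs-ratio-edges 0 bs e≡ refl)
      (≤⇒⊴ {d = 1} λ i → ≤-trans (walks≤ (G i) 0) (≤-reflexive (sym (*-identityʳ _)))))

-- Graphs without light vertices

module Heaviness {f κ : ℕ} {F : Graph f} (C : CriticalColouring F (suc κ)) (1≤κ : 1 ≤ κ)
  {d₀ e₀ : ℕ} (bs₀ : Vec Bool (suc d₀)) (edges₀ : edgeCount bs₀ ≡ suc e₀) where

  record HeavyGraph : Set₁ where
    field
      order      : ℕ
      G          : Graph (suc order)
      free       : G IsFree F
      heavy      : ∀ v → turánIncrement order κ bs₀ ≤ embeddingsThrough G bs₀ v
      z          : Fin (suc order)
      low-degree : suc κ * deg G z ≤ κ * suc order

  open HeavyGraph

  open FreeFamily C 1≤κ HeavyGraph order G free public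

  increment : HeavyGraph → ℕ
  increment i = turánIncrement (order i) κ bs₀

  size^≲order^ : ∀ p → (λ i → size i ^ p) ≲[ p ] (λ i → order i ^ p)
  size^≲order^ zero    = ≤⇒≲ λ _ → ≤-refl
  size^≲order^ (suc p) = ≲-trans (≲-size* (size^≲order^ p)) (≲-drop
    (≤⇒≲ λ i → ≤-reflexive (+-comm (order i ^ p) (order i * order i ^ p)))
    (bounded⇒≲0 (≤⇒bounded λ i → ^-monoˡ-≤ p (n≤1+n (order i)))))

  collisions-negligible : (λ i → ∑ᵛ (suc (suc d₀)) λ x → collisions x * occ (fromℕ (order i)) x) ≲[ suc d₀ ] (λ _ → 0)
  collisions-negligible = asymptotically λ N → N * c , λ i large → *-cancelˡ-≤ (size i * size i) (begin
      size i * size i * (N * B i)                          ≡⟨ regroup (size i) N (B i) ⟩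
      N * (size i * (size i * B i))                        ≤⟨ *-monoʳ-≤ N (∑ᵛ-collisions*occ≤ (suc (suc d₀)) (fromℕ (order i))) ⟩
      N * (c * size i ^ suc (suc d₀))                      ≡⟨ *-assoc N c _ ⟨
      N * c * (size i * size i ^ suc d₀)                   ≤⟨ *-monoˡ-≤ (size i * size i ^ suc d₀) large ⟩
      size i * (size i * size i ^ suc d₀)                  ≡⟨ *-assoc (size i) (size i) _ ⟨
      size i * size i * size i ^ suc d₀                    ≤⟨ *-monoʳ-≤ (size i * size i) (m≤n+m _ (N * 0)) ⟩
      size i * size i * (N * 0 + size i ^ suc d₀)          ∎)
    where
    open ≤-Reasoning
    c = suc (suc d₀) * suc (suc d₀) * suc (suc d₀)
    B : HeavyGraph → ℕ
    B i = ∑ᵛ (suc (suc d₀)) λ x → collisions x * occ (fromℕ (order i)) x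
    regroup : ∀ n N b → n * n * (N * b) ≡ N * (n * (n * b))
    regroup = solve-∀

  increment-lower : (λ i → suc (suc d₀) * (κ ^ suc e₀ * size i ^ suc d₀)) ≲[ suc d₀ ] (λ i → K ^ suc e₀ * increment i)
  increment-lower = ≲-trans (≲-const* (suc (suc d₀)) (≲-const* (κ ^ suc e₀) (size^≲order^ (suc d₀)))) (≲-drop (≤⇒≲ bound)
    (≲-resp-≗ (λ _ → refl) (λ _ → *-zeroʳ (K ^ suc e₀)) (≲-const* (K ^ suc e₀) collisions-negligible)))
    where
    open ≤-Reasoning
    lastCollisions : HeavyGraph → ℕ
    lastCollisions i = ∑ᵛ (suc (suc d₀)) λ x → collisions x * occ (fromℕ (order i)) x
    bound : ∀ i → suc (suc d₀) * (κ ^ suc e₀ * order i ^ suc d₀) ≤ K ^ suc e₀ * increment i + K ^ suc e₀ * lastCollisions i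
    bound i = begin
      suc (suc d₀) * (κ ^ suc e₀ * order i ^ suc d₀)
        ≤⟨ subst (λ e → suc (suc d₀) * (κ ^ e * order i ^ suc d₀) ≤ K ^ e * homsThrough T bs₀ last) edges₀
            (LargeMinDegree.homsThrough-lower T κ (turán-deg (order i) κ) bs₀ last) ⟩
      K ^ suc e₀ * homsThrough T bs₀ last
        ≤⟨ *-monoʳ-≤ (K ^ suc e₀) (homsThrough≤embeddingsThrough+collisions T bs₀ last) ⟩
      K ^ suc e₀ * (increment i + lastCollisions i)                      ≡⟨ *-distribˡ-+ (K ^ suc e₀) (increment i) (lastCollisions i) ⟩
      K ^ suc e₀ * increment i + K ^ suc e₀ * lastCollisions i           ∎
      where
      T    = turán (size i) K
      last = fromℕ (order i)

  homsThrough-z-lower : (λ i → suc (suc d₀) * (κ ^ suc e₀ * size i ^ suc d₀)) ≲[ suc d₀ ] (λ i → K ^ suc e₀ * weightedHomsThrough (G i) (z i) (λ _ → 1) bs₀)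
  homsThrough-z-lower = ≲-trans increment-lower (≤⇒≲ λ i → *-monoʳ-≤ (K ^ suc e₀) (≤-trans (heavy i (z i))
    (≤-trans (embeddingsThrough≤homsThrough (G i) bs₀ (z i)) (≤-reflexive (homsThrough≡weighted (G i) bs₀ (z i))))))

  homs-lower : (λ i → κ ^ suc e₀ * size i ^ suc (suc d₀)) ≲[ suc (suc d₀) ] (λ i → K ^ suc e₀ * homsAfterWalk 0 bs₀ i)
  homs-lower = ≲-const*-cancel (suc (suc d₀)) (s≤s z≤n) (≲-trans
    (≲-resp-≗ (λ i → regroup (size i) (suc (suc d₀)) (κ ^ suc e₀) (size i ^ suc d₀)) (λ _ → refl) (≲-size* increment-lower))
    (≤⇒≲ bound))
    where
    open ≤-Reasoning
    regroup : ∀ n s p q → n * (s * (p * q)) ≡ s * (p * (n * q))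
    regroup = solve-∀
    bound : ∀ i → size i * (K ^ suc e₀ * increment i) ≤ suc (suc d₀) * (K ^ suc e₀ * homsAfterWalk 0 bs₀ i)
    bound i = begin
      size i * (K ^ suc e₀ * increment i)                          ≡⟨ x∙yz≈y∙xz (size i) (K ^ suc e₀) (increment i) ⟩
      K ^ suc e₀ * (size i * increment i)                          ≡⟨ cong (K ^ suc e₀ *_) (∑-const (size i) (increment i)) ⟨
      K ^ suc e₀ * ∑ {size i} (λ _ → increment i)
        ≤⟨ *-monoʳ-≤ (K ^ suc e₀) (∑-mono λ v → ≤-trans (heavy i v) (embeddingsThrough≤homsThrough (G i) bs₀ v)) ⟩
      K ^ suc e₀ * ∑ (homsThrough (G i) bs₀)
        ≡⟨ cong (K ^ suc e₀ *_) (trans (∑-homsThrough (G i) bs₀) (cong (suc (suc d₀) *_) (sum-cong-≗ λ v → sym (*-identityˡ (homsFrom (G i) bs₀ v))))) ⟩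
      K ^ suc e₀ * (suc (suc d₀) * homsAfterWalk 0 bs₀ i)          ≡⟨ x∙yz≈y∙xz (K ^ suc e₀) (suc (suc d₀)) _ ⟩
      suc (suc d₀) * (K ^ suc e₀ * homsAfterWalk 0 bs₀ i)          ∎

  1≤κ^ : ∀ e → 1 ≤ κ ^ e
  1≤κ^ e = m^n>0 κ {{>-nonZero 1≤κ}} e

  many-edges : (λ i → κ * (size i * size i)) ≲[ 2 ] (λ i → K * w 1 i)
  many-edges = ≲-size^*-cancel d₀ (≲-const*-cancel (κ ^ e₀) (1≤κ^ e₀) (≲-trans
    (≲-resp-≗ (λ i → regroup₁ κ (κ ^ e₀) (size i) (size i ^ d₀)) (λ i → *-assoc K (K ^ e₀) (homsAfterWalk 0 bs₀ i)) homs-lower)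
    (≲-order (+-comm d₀ 2) (≲-resp-≗ (λ _ → refl) (λ i → regroup₂ K (κ ^ e₀) (size i ^ d₀) (w 1 i)) (≲-const* K (scaled (homs-ratio-edges 0 bs₀ edges₀ refl)))))))
    where
    regroup₁ : ∀ κ p n q → κ * p * (n * (n * q)) ≡ p * (q * (κ * (n * n)))
    regroup₁ = solve-∀
    regroup₂ : ∀ K p q x → K * (p * (q * x)) ≡ p * (q * (K * x))
    regroup₂ = solve-∀

  degreeExcess : ∀ i → Fin (size i) → ℕ
  degreeExcess i v = K * deg (G i) v ∸ κ * size i

  -- ∑ (K d(v) - κ n)² = K² w₂ - 2 κ K n w₁ + κ² n³, restricted to the positive parts.
  ∑-degreeExcess² : ∀ i → ∑ (λ v → degreeExcess i v * degreeExcess i v) + 2 * (κ * (size i * (K * w 1 i))) ≤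
    K * (K * w 2 i) + κ * (size i * (κ * (size i * size i)))
  ∑-degreeExcess² i = begin
    ∑ x² + 2 * (κ * (s * (K * w 1 i)))
      ≡⟨ cong (∑ x² +_) (trans (regroup₁ κ s K (w 1 i)) (trans (*-distribˡ-sum c (walksFrom (G i) 1)) (sum-cong-≗ λ v → cong (c *_) (walksFrom-1 (G i) v)))) ⟩
    ∑ x² + ∑ (λ v → c * d v)                                        ≡⟨ ∑-distrib-+ x² (λ v → c * d v) ⟨
    ∑ (λ v → x² v + c * d v)
      ≤⟨ ∑-mono (λ v → ≤-trans (≤-reflexive (cong (x² v +_) (regroup₂ κ s K (d v)))) (∸-square (K * d v) (κ * s))) ⟩
    ∑ (λ v → K * d v * (K * d v) + κ * s * (κ * s))                 ≡⟨ ∑-distrib-+ (λ v → K * d v * (K * d v)) (λ _ → κ * s * (κ * s)) ⟩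
    ∑ (λ v → K * d v * (K * d v)) + ∑ {s} (λ _ → κ * s * (κ * s))   ≡⟨ cong₂ _+_ degrees² (trans (∑-const s (κ * s * (κ * s))) (regroup₄ κ s)) ⟩
    K * (K * w 2 i) + κ * (s * (κ * (s * s)))                       ∎
    where
    open ≤-Reasoning
    s = size i
    c = 2 * (κ * (s * K))
    d x² : Fin s → ℕ
    d = deg (G i)
    x² v = degreeExcess i v * degreeExcess i v
    regroup₁ : ∀ κ s K x → 2 * (κ * (s * (K * x))) ≡ 2 * (κ * (s * K)) * x
    regroup₁ = solve-∀
    regroup₂ : ∀ κ n K d → 2 * (κ * (n * K)) * d ≡ 2 * (K * d * (κ * n))
    regroup₂ = solve-∀
    regroup₃ : ∀ K d → K * d * (K * d) ≡ K * K * (d * d)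
    regroup₃ = solve-∀
    regroup₄ : ∀ κ n → n * (κ * n * (κ * n)) ≡ κ * (n * (κ * (n * n)))
    regroup₄ = solve-∀
    degrees² : ∑ (λ v → K * d v * (K * d v)) ≡ K * (K * w 2 i)
    degrees² = begin-equality
      ∑ (λ v → K * d v * (K * d v))
        ≡⟨ sum-cong-≗ (λ v → trans (regroup₃ K (d v)) (cong (λ t → K * K * (t * t)) (sym (walksFrom-1 (G i) v)))) ⟩
      ∑ (λ v → K * K * (walksFrom (G i) 1 v * walksFrom (G i) 1 v))     ≡⟨ ∑-*ˡ (K * K) (λ v → walksFrom (G i) 1 v * walksFrom (G i) 1 v) ⟩
      K * K * ∑ (λ v → walksFrom (G i) 1 v * walksFrom (G i) 1 v)       ≡⟨ cong (K * K *_) (∑-walksFrom² (G i) 1 1) ⟩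
      K * K * w 2 i                                                     ≡⟨ *-assoc K K _ ⟩
      K * (K * w 2 i)                                                   ∎

  ∑-degreeExcess²-negligible : (λ i → ∑ λ v → degreeExcess i v * degreeExcess i v) ≲[ 3 ] (λ _ → 0)
  ∑-degreeExcess²-negligible = ≲-+-cancelʳ (λ i → 2 * (κ * (size i * (K * w 1 i)))) (≲-trans (≤⇒≲ ∑-degreeExcess²)
    (≲-resp-≗ (λ _ → refl) (λ i → double (κ * (size i * (K * w 1 i)))) (≲-+
      (≲-resp-≗ (λ i → cong (λ t → K * (t * w 2 i)) (*-identityʳ K)) (λ i → regroup K κ (size i) (w 1 i)) (≲-const* K (scaled (walks-ratio 1))))
      (≲-const* κ (≲-size* many-edges)))))
    where
    double : ∀ x → x + x ≡ 2 * x
    double = solve-∀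
    regroup : ∀ K κ n x → K * (κ * 1 * (n * 1 * x)) ≡ κ * (n * (K * x))
    regroup = solve-∀

  ∑-degreeExcess-negligible : (λ i → ∑ (degreeExcess i)) ≲[ 2 ] (λ _ → 0)
  ∑-degreeExcess-negligible = ≲0-sqrt (≲-trans (≤⇒≲ λ i → cauchy-schwarz (degreeExcess i))
    (≲-resp-≗ (λ _ → refl) (λ i → *-zeroʳ (size i)) (≲-size* ∑-degreeExcess²-negligible)))

  Weights : Set₁
  Weights = ∀ i → Fin (size i) → ℕ

  transferred : Bool → Weights → Weights
  transferred b y i = transfer (G i) b (y i)

  excess : ℕ → ℕ → Weights → HeavyGraph → ℕ
  excess e d y i = ∑ λ v → K ^ e * y i v ∸ κ ^ e * size i ^ d

  record Typical (e d : ℕ) (y : Weights) : Set₁ where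
    field
      excess-negligible : excess e d y ≲[ suc d ] (λ _ → 0)
      at-z              : (λ i → y i (z i)) ⊴[ e , d , 0 ] one
      weights≤          : ∀ i v → y i v ≤ size i ^ d

  open Typical

  entry≤ : ∀ e d (y : Weights) i v → K ^ e * y i v ≤ κ ^ e * size i ^ d + (K ^ e * y i v ∸ κ ^ e * size i ^ d)
  entry≤ e d y i v = m≤n+m∸n (K ^ e * y i v) (κ ^ e * size i ^ d)

  transferred-true≤ : ∀ e d (y : Weights) i v → K ^ e * transferred true y i v ≤ κ ^ e * size i ^ d * deg (G i) v + excess e d y i
  transferred-true≤ e d y i v = begin
    K ^ e * transferred true y i v                   ≡⟨ *-distribˡ-sum (K ^ e) (λ u → a u * y i u) ⟩
    ∑ (λ u → K ^ e * (a u * y i u))                  ≤⟨ ∑-mono pointwise ⟩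
    ∑ (λ u → c * a u + x u)                          ≡⟨ ∑-distrib-+ (λ u → c * a u) x ⟩
    ∑ (λ u → c * a u) + excess e d y i               ≡⟨ cong (_+ excess e d y i) (∑-*ˡ c a) ⟩
    c * deg (G i) v + excess e d y i                 ∎
    where
    open ≤-Reasoning
    c = κ ^ e * size i ^ d
    a x : Fin (size i) → ℕ
    a = adjacency (G i) v
    x u = K ^ e * y i u ∸ c
    pointwise : ∀ u → K ^ e * (a u * y i u) ≤ c * a u + x u
    pointwise u = begin
      K ^ e * (a u * y i u)      ≡⟨ x∙yz≈y∙xz (K ^ e) (a u) (y i u) ⟩
      a u * (K ^ e * y i u)      ≤⟨ *-monoʳ-≤ (a u) (entry≤ e d y i u) ⟩
      a u * (c + x u)            ≡⟨ *-distribˡ-+ (a u) c (x u) ⟩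
      a u * c + a u * x u        ≤⟨ +-mono-≤ (≤-reflexive (*-comm (a u) c)) (𝟙*≤ (adj? (G i) v u) (x u)) ⟩
      c * a u + x u              ∎

  transferred-false≤ : ∀ e d (y : Weights) i v → K ^ e * transferred false y i v ≤ κ ^ e * size i ^ suc d + excess e d y i
  transferred-false≤ e d y i v = begin
    K ^ e * transferred false y i v
      ≡⟨ trans (*-distribˡ-sum (K ^ e) (λ u → 1 * y i u)) (sum-cong-≗ λ u → cong (K ^ e *_) (*-identityˡ (y i u))) ⟩
    ∑ (λ u → K ^ e * y i u)                        ≤⟨ ∑-mono (entry≤ e d y i) ⟩
    ∑ (λ u → c + (K ^ e * y i u ∸ c))              ≡⟨ ∑-distrib-+ {size i} (λ _ → c) (λ u → K ^ e * y i u ∸ c) ⟩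
    ∑ {size i} (λ _ → c) + excess e d y i
      ≡⟨ cong (_+ excess e d y i) (trans (∑-const (size i) c) (x∙yz≈y∙xz (size i) (κ ^ e) (size i ^ d))) ⟩
    κ ^ e * size i ^ suc d + excess e d y i        ∎
    where
    open ≤-Reasoning
    c = κ ^ e * size i ^ d

  transferred-true-at-z : ∀ {e d y} → Typical e d y → (λ i → transferred true y i (z i)) ⊴[ e , d , 1 ] (λ i → deg (G i) (z i))
  transferred-true-at-z {e} {d} {y} T = ratio (≲-order (+-comm 1 d) (≲-resp-≗ (λ _ → refl) (λ i → *-assoc (κ ^ e) (size i ^ d) _)
    (≲-drop (≤⇒≲ λ i → transferred-true≤ e d y i (z i)) (excess-negligible T))))

  excess-transferred-true : ∀ e d (y : Weights) i → excess (suc e) (suc d) (transferred true y) i ≤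
    κ ^ e * (size i ^ d * ∑ (degreeExcess i)) + K * (size i * excess e d y i)
  excess-transferred-true e d y i = begin
    ∑ (λ v → K ^ suc e * y′ v ∸ κ ^ suc e * size i ^ suc d)                ≤⟨ ∑-mono pointwise ⟩
    ∑ (λ v → c * degreeExcess i v + K * x)                                 ≡⟨ ∑-distrib-+ (λ v → c * degreeExcess i v) (λ _ → K * x) ⟩
    ∑ (λ v → c * degreeExcess i v) + ∑ {size i} (λ _ → K * x)
      ≡⟨ cong₂ _+_ (trans (∑-*ˡ c (degreeExcess i)) (*-assoc (κ ^ e) (size i ^ d) _)) (trans (∑-const (size i) (K * x)) (x∙yz≈y∙xz (size i) K x)) ⟩
    κ ^ e * (size i ^ d * ∑ (degreeExcess i)) + K * (size i * x)           ∎
    where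
    open ≤-Reasoning
    c = κ ^ e * size i ^ d
    x = excess e d y i
    y′ = transferred true y i
    regroup₁ : ∀ K p d x → K * (p * d + x) ≡ p * (K * d) + K * x
    regroup₁ = solve-∀
    regroup₂ : ∀ κ p n q x t → p * q * (κ * n + x) + t ≡ κ * p * (n * q) + (p * q * x + t)
    regroup₂ = solve-∀
    pointwise : ∀ v → K ^ suc e * y′ v ∸ κ ^ suc e * size i ^ suc d ≤ c * degreeExcess i v + K * x
    pointwise v = m≤n+o⇒m∸n≤o (K ^ suc e * y′ v) (κ ^ suc e * size i ^ suc d) (begin
      K * K ^ e * y′ v                                                       ≡⟨ *-assoc K (K ^ e) _ ⟩
      K * (K ^ e * y′ v)                                                     ≤⟨ *-monoʳ-≤ K (transferred-true≤ e d y i v) ⟩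
      K * (c * deg (G i) v + x)                                              ≡⟨ regroup₁ K c (deg (G i) v) x ⟩
      c * (K * deg (G i) v) + K * x                                          ≤⟨ +-monoˡ-≤ _ (*-monoʳ-≤ c (m≤n+m∸n (K * deg (G i) v) (κ * size i))) ⟩
      c * (κ * size i + degreeExcess i v) + K * x                            ≡⟨ regroup₂ κ (κ ^ e) (size i) (size i ^ d) (degreeExcess i v) (K * x) ⟩
      κ * κ ^ e * (size i * size i ^ d) + (c * degreeExcess i v + K * x)     ∎)

  typical-one : Typical 0 0 (λ _ _ → 1)
  typical-one = record
    { excess-negligible = ≤⇒≲ λ i → ≤-reflexive (∑-zero {size i} λ _ → refl)
    ; at-z              = ≤⇒⊴ λ _ → ≤-refl
    ; weights≤          = λ _ _ → ≤-refl
    }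

  typical-true : ∀ {e d y} → Typical e d y → Typical (suc e) (suc d) (transferred true y)
  typical-true {e} {d} {y} T = record
    { excess-negligible = ≲-trans (≤⇒≲ (excess-transferred-true e d y)) (≲-resp-≗ (λ _ → refl) (λ i → vanish (κ ^ e) (size i ^ d) K (size i))
        (≲-+ (≲-const* (κ ^ e) (≲-size^* d ∑-degreeExcess-negligible)) (≲-const* K (≲-size* (excess-negligible T)))))
    ; at-z     = ratio (≲-trans
        (≲-order (trans (+-comm d 1) (sym (+-identityʳ (suc d)))) (≲-resp-≗ (λ i → sym (*-assoc K (K ^ e) _)) (λ i → regroup₁ K (κ ^ e) (size i ^ d) (deg (G i) (z i)))
          (≲-const* K (scaled (transferred-true-at-z T)))))
        (≤⇒≲ λ i → ≤-trans (*-monoʳ-≤ (κ ^ e * size i ^ d) (low-degree i)) (≤-reflexive (regroup₂ κ (κ ^ e) (size i ^ d) (size i)))))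
    ; weights≤ = λ i v → transfer≤ (G i) true (y i) _ (weights≤ T i) v
    }
    where
    vanish : ∀ p q K n → p * (q * 0) + K * (n * 0) ≡ 0
    vanish = solve-∀
    regroup₁ : ∀ K p q d → K * (p * (q * d)) ≡ p * q * (K * d)
    regroup₁ = solve-∀
    regroup₂ : ∀ κ p q n → p * q * (κ * n) ≡ κ * p * (n * q * 1)
    regroup₂ = solve-∀

  typical-false : ∀ {e d y} → Typical e d y → Typical e (suc d) (transferred false y)
  typical-false {e} {d} {y} T = record
    { excess-negligible = ≲-trans
        (≤⇒≲ λ i → ∑≤n*c (excess e d y i) λ v → m≤n+o⇒m∸n≤o (K ^ e * transferred false y i v) (κ ^ e * size i ^ suc d) (transferred-false≤ e d y i v))
        (≲-resp-≗ (λ _ → refl) (λ i → *-zeroʳ (size i)) (≲-size* (excess-negligible T)))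
    ; at-z     = ratio (≲-order (sym (+-identityʳ (suc d))) (≲-resp-≗ (λ _ → refl) (λ i → cong (κ ^ e *_) (sym (*-identityʳ _)))
        (≲-drop (≤⇒≲ λ i → transferred-false≤ e d y i (z i)) (excess-negligible T))))
    ; weights≤ = λ i v → transfer≤ (G i) false (y i) _ (weights≤ T i) v
    }

  typical-homsFrom : (bs : Vec Bool m) → Typical (edgeCount bs) m (λ i → homsFrom (G i) bs)
  typical-homsFrom []           = typical-one
  typical-homsFrom (true ∷ bs)  = typical-true (typical-homsFrom bs)
  typical-homsFrom (false ∷ bs) = typical-false (typical-homsFrom bs)

  bounded-at-z : ∀ {e d y} → Typical e d y → Bounded (d + 0) (λ i → y i (z i))
  bounded-at-z {d = d} T = ≤⇒bounded λ i → ≤-trans (weights≤ T i (z i)) (≤-reflexive (cong (size i ^_) (sym (+-identityʳ d))))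

  throughZ : Weights → Vec Bool m → HeavyGraph → ℕ
  throughZ y bs i = weightedHomsThrough (G i) (z i) (y i) bs

  first-through-z : ∀ {e d y} → Typical e d y → (bs : Vec Bool m) → (λ i → y i (z i) * homsFrom (G i) bs (z i)) ⊴[ e + edgeCount bs , d + m , 0 ] one
  first-through-z T bs = ⊴-* (bounded-at-z (typical-homsFrom bs)) (bounded-const 1) (at-z T) (at-z (typical-homsFrom bs))

  throughZ-ratio : ∀ {e d y} → Typical e d y → (bs : Vec Bool m) → throughZ y bs ⊴[ e + edgeCount bs , d + m , 0 ] (λ _ → suc m)
  throughZ-ratio {e = e} {d} T [] = ⊴-resp (sym (+-identityʳ e)) (sym (+-identityʳ d)) (λ _ → refl) (λ _ → refl) (at-z T)
  throughZ-ratio {suc m} {e} {d} T (true ∷ bs) = ⊴-+ (first-through-z T (true ∷ bs))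
    (⊴-resp (sym (+-suc e (edgeCount bs))) (sym (+-suc d m)) (λ _ → refl) (λ _ → refl) (throughZ-ratio (typical-true T) bs))
  throughZ-ratio {suc m} {e} {d} T (false ∷ bs) = ⊴-+ (first-through-z T (false ∷ bs))
    (⊴-resp refl (sym (+-suc d m)) (λ _ → refl) (λ _ → refl) (throughZ-ratio (typical-false T) bs))

  first-edge-at-z : ∀ {e d y} → Typical e d y → (bs : Vec Bool m) →
    (λ i → y i (z i) * homsFrom (G i) (true ∷ bs) (z i)) ⊴[ e + edgeCount bs , d + m , 1 ] (λ i → deg (G i) (z i))
  first-edge-at-z {m} T bs = ⊴-resp refl refl (λ _ → refl) (λ i → *-identityˡ (deg (G i) (z i)))
    (⊴-* (subst (λ o → Bounded o (λ i → homsFrom (G i) (true ∷ bs) (z i))) (trans (+-identityʳ (suc m)) (+-comm 1 m)) (bounded-at-z (typical-homsFrom (true ∷ bs)))) (bounded-const 1)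
      (at-z T) (transferred-true-at-z (typical-homsFrom bs)))

  -- Only the part of the forest before its first edge may avoid the neighbourhood of z, so one
  -- position of z contributes the factor d(z).
  throughZ-degree : ∀ {e d y ℓ} → Typical e d y → (bs : Vec Bool (suc m)) → edgeCount bs ≡ suc ℓ →
    (λ i → K * throughZ y bs i) ⊴[ e + ℓ , d + m , 1 ] (λ i → suc m * (κ * size i) + K * deg (G i) (z i))
  throughZ-degree {m} {e} {d} {y} T (true ∷ bs) refl = ⊴-resp refl refl
    (λ i → sym (*-distribˡ-+ K _ (throughZ (transferred true y) bs i))) (λ i → regroup K (deg (G i) (z i)) κ (size i) (suc m))
    (⊴-+ (⊴-const* K (first-edge-at-z T bs)) (⊴-peel (throughZ-ratio (typical-true T) bs)))
    where
    regroup : ∀ K d κ n s → K * d + κ * (n * s) ≡ s * (κ * n) + K * d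
    regroup = solve-∀
  throughZ-degree {zero} _ (false ∷ []) ()
  throughZ-degree {suc m} {e} {d} {y} {ℓ} T (false ∷ bs) edges = ⊴-resp refl refl
    (λ i → sym (*-distribˡ-+ K _ (throughZ (transferred false y) bs i))) (λ i → regroup κ (size i) (suc m) (K * deg (G i) (z i)))
    (⊴-+
      (⊴-peel (⊴-resp (trans (cong (e +_) edges) (+-suc e ℓ)) (+-suc d (suc m)) (λ _ → refl) (λ _ → refl) (first-through-z T (false ∷ bs))))
      (⊴-resp refl (sym (+-suc d m)) (λ _ → refl) (λ _ → refl) (throughZ-degree (typical-false T) bs edges)))
    where
    regroup : ∀ κ n s x → κ * (n * 1) + (s * (κ * n) + x) ≡ suc s * (κ * n) + x
    regroup = solve-∀

  large-degree : (λ i → κ * size i) ≲[ 1 ] (λ i → K * deg (G i) (z i))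
  large-degree = ≲-+-cancelʳ (λ i → suc d₀ * (κ * size i)) (≲-size^*-cancel d₀ (≲-const*-cancel (κ ^ e₀) (1≤κ^ e₀) (≲-trans
    (≲-resp-≗ (λ i → regroup₁ d₀ κ (κ ^ e₀) (size i) (size i ^ d₀)) (λ i → regroup₂ K (K ^ e₀) (throughZ (λ _ _ → 1) bs₀ i)) homsThrough-z-lower)
    (≲-order (+-comm d₀ 1) (≲-resp-≗ (λ _ → refl) (λ i → cong (λ x → κ ^ e₀ * (size i ^ d₀ * x)) (+-comm (suc d₀ * (κ * size i)) _))
      (scaled (throughZ-degree typical-one bs₀ edges₀)))))))
    where
    regroup₁ : ∀ d κ p n q → suc (suc d) * (κ * p * (n * q)) ≡ p * (q * (κ * n + suc d * (κ * n)))
    regroup₁ = solve-∀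
    regroup₂ : ∀ K p x → K * p * x ≡ p * (K * x)
    regroup₂ = solve-∀

heavy⇒nearTuránDegrees : ∀ {f κ e} {F : Graph f} → CriticalColouring F (suc κ) → 1 ≤ κ → (bs : Vec Bool (suc m)) → edgeCount bs ≡ suc e → ∀ N →
  ∃[ n₀ ] (∀ {n} (G : Graph (suc n)) → n₀ ≤ suc n → G IsFree F → (∀ v → turánIncrement n κ bs ≤ embeddingsThrough G bs v) → NearTuránDegrees (suc κ) N G)
heavy⇒nearTuránDegrees {κ = κ} {F = F} C 1≤κ bs edges N = proj₁ low-degrees , nearTurán
  where
  open ≤-Reasoning
  open Heaviness C 1≤κ bs edges
  open HeavyGraph
  low-degrees : ∃[ n₀ ] (∀ i → n₀ ≤ suc (order i) → N * (κ * suc (order i)) ≤ N * (suc κ * deg (G i) (z i)) + suc (order i) ^ 1)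
  low-degrees = within large-degree N
  nearTurán : ∀ {n} (G : Graph (suc n)) → proj₁ low-degrees ≤ suc n → G IsFree F →
    (∀ v → turánIncrement n κ bs ≤ embeddingsThrough G bs v) → NearTuránDegrees (suc κ) N G
  nearTurán {n} G large free heavy v = begin
    N * (suc κ * suc n)                             ≡⟨ regroup₁ N κ (suc n) ⟩
    N * (κ * suc n) + N * suc n                     ≤⟨ +-monoˡ-≤ (N * suc n) degree ⟩
    N * (suc κ * deg G v) + suc n + N * suc n       ≡⟨ regroup₂ N (suc κ * deg G v) (suc n) ⟩
    N * (suc κ * deg G v + suc n) + suc n           ∎
    where
    regroup₁ : ∀ N κ s → N * (suc κ * s) ≡ N * (κ * s) + N * s
    regroup₁ = solve-∀
    regroup₂ : ∀ N x s → N * x + s + N * s ≡ N * (x + s) + s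
    regroup₂ = solve-∀
    degree : N * (κ * suc n) ≤ N * (suc κ * deg G v) + suc n
    degree = [ low-degree-bound , (λ high → ≤-trans (*-monoʳ-≤ N high) (m≤m+n _ (suc n))) ]′ (≤-total (suc κ * deg G v) (κ * suc n))
      where
      low-degree-bound : suc κ * deg G v ≤ κ * suc n → N * (κ * suc n) ≤ N * (suc κ * deg G v) + suc n
      low-degree-bound low = ≤-trans (proj₂ low-degrees (record { order = n ; G = G ; free = free ; heavy = heavy ; z = v ; low-degree = low }) large)
        (≤-reflexive (cong (N * (suc κ * deg G v) +_) (*-identityʳ (suc n))))

-- Progressive induction

TuránMaximal : ∀ {f} → Graph f → ℕ → Vec Bool m → ℕ → Set₁
TuránMaximal F κ bs n = (G : Graph n) → G IsFree F → embeddings G bs ≤ embeddings (turán n (suc κ)) bs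

LightVertex : ℕ → Graph (suc n) → Vec Bool m → Set
LightVertex {n} κ G bs = ∃[ v ] embeddingsThrough G bs v < turánIncrement n κ bs

module ProgressiveInduction {f κ m : ℕ} (F : Graph f) (bs : Vec Bool m) (n₀ : ℕ)
  (light-or-maximal : ∀ {n} (G : Graph (suc n)) → n₀ ≤ suc n → G IsFree F →
    LightVertex κ G bs ⊎ embeddings G bs ≤ embeddings (turán (suc n) (suc κ)) bs) where

  t : ℕ → ℕ
  t n = embeddings (turán n (suc κ)) bs

  slack : ℕ
  slack = n₀ ^ suc m

  -- Deleting a light vertex raises the surplus over the Turán graph.
  embeddings≤turán+slack : ∀ j (G : Graph (j + n₀)) → G IsFree F → embeddings G bs ≤ t (j + n₀) + (slack ∸ j)
  embeddings≤turán+slack zero    G free = ≤-trans (embeddings≤ G bs) (m≤n+m slack _)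
  embeddings≤turán+slack (suc j) G free with light-or-maximal G (≤-trans (m≤n+m n₀ j) (n≤1+n _)) free
  ... | inj₂ maximal     = ≤-trans maximal (m≤m+n _ _)
  ... | inj₁ (v , light) = begin
    embeddings G bs                                                          ≡⟨ embeddings-deleteVertex G bs v ⟩
    embeddings (deleteVertex G v) bs + embeddingsThrough G bs v
      ≤⟨ +-monoˡ-≤ _ (embeddings≤turán+slack j (deleteVertex G v) (deleteVertex-free F G free v)) ⟩
    t (j + n₀) + (slack ∸ j) + embeddingsThrough G bs v                      ≤⟨ +-monoˡ-≤ _ (+-monoʳ-≤ (t (j + n₀)) slack-drops) ⟩
    t (j + n₀) + suc (slack ∸ suc j) + embeddingsThrough G bs v              ≡⟨ regroup (t (j + n₀)) (slack ∸ suc j) (embeddingsThrough G bs v) ⟩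
    t (j + n₀) + suc (embeddingsThrough G bs v) + (slack ∸ suc j)            ≤⟨ +-monoˡ-≤ (slack ∸ suc j) (+-monoʳ-≤ (t (j + n₀)) light) ⟩
    t (j + n₀) + turánIncrement (j + n₀) κ bs + (slack ∸ suc j)              ≡⟨ cong (_+ (slack ∸ suc j)) (embeddings-turán-suc (j + n₀) κ bs) ⟨
    t (suc j + n₀) + (slack ∸ suc j)                                         ∎
    where
    open ≤-Reasoning
    regroup : ∀ e s x → e + suc s + x ≡ e + suc x + s
    regroup = solve-∀
    slack-drops : slack ∸ j ≤ suc (slack ∸ suc j)
    slack-drops = subst (λ s → slack ∸ j ≤ suc s) (trans (∸-+-assoc slack j 1) (cong (slack ∸_) (+-comm j 1))) (m≤n+m∸n (slack ∸ j) 1)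

  turánMaximal : ∀ n → slack + n₀ ≤ n → TuránMaximal F κ bs n
  turánMaximal n large = subst (TuránMaximal F κ bs) (m∸n+n≡m (≤-trans (m≤n+m n₀ slack) large)) λ G free →
    ≤-trans (embeddings≤turán+slack (n ∸ n₀) G free)
      (≤-reflexive (trans (cong (t (n ∸ n₀ + n₀) +_) (m≤n⇒m∸n≡0 (m+n≤o⇒m≤o∸n slack large))) (+-identityʳ _)))

light-or-turánMaximal : ∀ {f κ e} {F : Graph f} → CriticalColouring F (suc κ) → 1 ≤ κ → (bs : Vec Bool (suc m)) → edgeCount bs ≡ suc e →
  ∃[ n₀ ] (∀ {n} (G : Graph (suc n)) → n₀ ≤ suc n → G IsFree F →
    LightVertex κ G bs ⊎ embeddings G bs ≤ embeddings (turán (suc n) (suc κ)) bs)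
light-or-turánMaximal {f = f} {κ} C 1≤κ bs edges =
  let N                    = precision κ f
      n₁ , heavy⇒near      = heavy⇒nearTuránDegrees C 1≤κ bs edges N
      n₂ , near⇒colourable = nearTuránDegrees⇒colourable C N ≤-refl
  in n₁ + n₂ , λ {n} G large free → case any? (λ v → embeddingsThrough G bs v <? turánIncrement n κ bs) of λ
    { (yes light) → inj₁ light
    ; (no ¬light) → inj₂ (embeddings-colourable κ G bs (near⇒colourable G (≤-trans (m≤n+m n₂ n₁) large) free
        (heavy⇒near G (≤-trans (m≤m+n n₁ n₂) large) free λ v → ≮⇒≥ λ light → ¬light (v , light))))
    }

eventually-turánMaximal : ∀ {f κ} {F : Graph f} → CriticalColouring F (suc κ) → (bs : Vec Bool m) → ∃[ n₀ ] (∀ n → n₀ ≤ n → TuránMaximal F κ bs n)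
eventually-turánMaximal {f = f} {zero} C bs =
  let N               = precision 0 f
      n₀ , colourable = nearTuránDegrees⇒colourable C N ≤-refl
  in n₀ , λ n large G free → embeddings-colourable 0 G bs (colourable G large free (nearTuránDegrees-1 N G))
  where
  nearTuránDegrees-1 : ∀ N (G : Graph n) → NearTuránDegrees 1 N G
  nearTuránDegrees-1 {n} N G v = ≤-trans (*-monoʳ-≤ N (≤-trans (≤-reflexive (*-identityˡ n)) (m≤n+m n _))) (m≤m+n _ n)
eventually-turánMaximal {κ = suc κ} {F} C bs = by-edges bs (edgeCount bs) refl
  where
  by-edges : (bs : Vec Bool m) → ∀ e → edgeCount bs ≡ e → ∃[ n₀ ] (∀ n → n₀ ≤ n → TuránMaximal F (suc κ) bs n)
  by-edges bs         zero    edgeless = 0 , λ n _ G _ → edgeless-embeddings-mono G (turán n (suc (suc κ))) bs edgeless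
  by-edges bs@(_ ∷ _) (suc e) edges    =
    let n₀ , light-or-maximal = light-or-turánMaximal C (s≤s z≤n) bs edges
    in _ , ProgressiveInduction.turánMaximal F bs n₀ light-or-maximal

turán-ex : ∀ {f h κ} (F : Graph f) (H : Graph h) → χ[ F ]≡ suc (suc κ) → ((G : Graph n) → G IsFree F → 𝓝 H G ≤ 𝓝 H (turán n (suc κ))) →
  ex[ n , H , F ]≡ 𝓝 H (turán n (suc κ))
turán-ex {n} {κ = κ} F H χF maximal = (turán n (suc κ) , turán-free F χF n , refl) , maximal

linearForest-turánGood : ∀ {f h} (F : Graph f) (H : Graph h) k → HasColorCriticalEdge F → χ[ F ]≡ suc k → LinearForest H → TuránGood k F H
linearForest-turánGood F H zero    critical χF _ = ⊥-elim (¬Fin0 (colour e₁))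
  where open CriticalColouring (criticalColouring F critical χF)
linearForest-turánGood F H (suc κ) critical χF linear with 𝓝-linearForest H linear
... | inj₁ constant            = χF , 0 , λ n _ → turán-ex F H χF λ G _ → constant G (turán n (suc κ))
... | inj₂ (_ , bs , monotone) =
  let n₀ , maximal = eventually-turánMaximal (criticalColouring F critical χF) bs
  in χF , n₀ , λ n large → turán-ex F H χF λ G free → monotone G (turán n (suc κ)) (maximal n large G free)

complete-χ : ∀ n → χ[ complete n ]≡ n
complete-χ n = (id , λ u v u≢v → u≢v) , λ d (colour , proper) →
  injective⇒≤ {f = colour} λ {i} {j} e → decidable-stable (i ≟ j) λ i≢j → proper i j i≢j e

complete-colorCritical : ∀ k → HasColorCriticalEdge (complete (suc (suc k)))
complete-colorCritical k = zero , suc zero , (λ ()) , suc (suc k) , suc k , complete-χ (suc (suc k)) , ((colour , proper) , minimal) , ≤-refl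
  where
  K⁻ : Graph (suc (suc k))
  K⁻ = deleteEdge (complete (suc (suc k))) zero (suc zero)
  colour : Fin (suc (suc k)) → Fin (suc k)
  colour zero    = zero
  colour (suc i) = i
  proper : ∀ u v → Adj K⁻ u v → colour u ≢ colour v
  proper zero    zero    (u≢v , _) e    = u≢v refl
  proper zero    (suc v) (_ , ≢uv) refl = ≢uv (inj₁ (refl , refl))
  proper (suc u) zero    (_ , ≢uv) refl = ≢uv (inj₂ (refl , refl))
  proper (suc u) (suc v) (u≢v , _) e    = u≢v (cong suc e)
  minimal : ∀ d → Colorable K⁻ d → suc k ≤ d
  minimal d (colour′ , proper′) = injective⇒≤ {f = colour′ ∘ suc} λ {i} {j} e → decidable-stable (i ≟ j)
    λ i≢j → proper′ (suc i) (suc j) (i≢j ∘ suc-injective , λ { (inj₁ (() , _)) ; (inj₂ (_ , ())) }) e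

path-linearForest : ∀ ℓ → LinearForest (path ℓ)
path-linearForest (suc ℓ) v = suc ℓ ,
  mkIso id id (λ w → mk⇔ (λ _ → w , refl) (λ _ → reverse (symm (path (suc ℓ))) (from-zero v) ◅◅ from-zero w)) (λ i j → mk⇔ id id)
  where
  from-zero : ∀ w → Star (Adj (path (suc ℓ))) zero w
  from-zero = <-weakInduction (Star (Adj (path (suc ℓ))) zero) ε λ i s → s ◅◅ (inj₁ (cong suc (sym (toℕ-inject₁ i))) ◅ ε)

mainTheorem1 :
    (∀ {f h} (F : Graph f) (H : Graph h) (k : ℕ) →
      HasColorCriticalEdge F → χ[ F ]≡ suc k → LinearForest H → TuránGood k F H)
    × (∀ (k ℓ : ℕ) → 2 ≤ k → 1 ≤ ℓ → TuránGood k (complete (suc k)) (path ℓ))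
mainTheorem1 = linearForest-turánGood , λ where
  (suc k) ℓ _ _ → linearForest-turánGood (complete (suc (suc k))) (path ℓ) (suc k)
    (complete-colorCritical k) (complete-χ (suc (suc k))) (path-linearForest ℓ)
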